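{- For every integer $d>1$ and every $k\in\mathbb{N}$ there exists a positive constant $c(d,k)$ such that \[N_{Q,d}(k)=c(d,k)\,Q^2+O_{d,k}(Q\log Q)\] as $Q\rightarrow\infty$.
   Context: For $Q\in\mathbb{N}$ the Farey fractions of order $Q$ are $\mathcal{F}_Q=\{a/q\in\mathbb{Q}: 1\le q\le Q,\ 0<a\le q,\ (a,q)=1\}$, ordered increasingly in the unit interval, where $(a,q)$ denotes the greatest common divisor. For $d\in\mathbb{N}$ let $\mathcal{F}_{Q,d}=\{a/q\in\mathcal{F}_Q : (q,d)=1\}$ (fractions written in lowest terms with positive denominator). For $k\in\mathbb{N}$ define \[N_{Q,d}(k)=\#\left\{\tfrac{a}{q}<\tfrac{a'}{q'} \text{ consecutive in } \mathcal{F}_{Q,d} : qa'-aq'=k\right\}.\] The notation $O_{d,k}$ means the implied constant may depend on $d$ and $k$. -}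

module Defs where

open import Data.Nat as ℕ using (ℕ; zero; suc; _≤_; _<_; _≟_)
open import Data.Nat.GCD using (gcd)
open import Data.List using (List; []; _∷_; length; filter; concatMap; upTo; map)
open import Data.Bool.ListAction using (all)
open import Data.Product using (_×_; _,_; proj₁; proj₂)
open import Data.Bool using (Bool; true; false; _∧_; _∨_; not; if_then_else_)
open import Relation.Nullary.Decidable using (⌊_⌋)
open import Data.Integer as ℤ using (ℤ; +_)
open import Data.Rational as ℚ using (ℚ)

-- A fraction a/q is represented by the pair (a , q) of naturals.
Frac : Set
Frac = ℕ × ℕ

FareyD : ℕ → ℕ → List Frac
FareyD Q d =
  filter (λ p → (gcd (proj₁ p) (proj₂ p) ≟ 1) )
   (filter (λ p → gcd (proj₂ p) d ≟ 1)
     (concatMap (λ q → map (λ a → (suc a , q)) (upTo q)) (map suc (upTo Q))))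

-- a/q < a'/q' (for positive denominators)
_≺ᵇ_ : Frac → Frac → Bool
(a , q) ≺ᵇ (a' , q') = ⌊ ℕ.suc (a ℕ.* q') ℕ.≤? a' ℕ.* q ⌋

consecutiveᵇ : List Frac → Frac → Frac → Bool
consecutiveᵇ L x y = (x ≺ᵇ y) ∧ all (λ z → not ((x ≺ᵇ z) ∧ (z ≺ᵇ y))) L

-- determinant condition  q a' - a q' = k  (stated additively in ℕ)
detᵇ : ℕ → Frac → Frac → Bool
detᵇ k (a , q) (a' , q') = ⌊ q ℕ.* a' ≟ a ℕ.* q' ℕ.+ k ⌋

N : ℕ → ℕ → ℕ → ℕ
N Q d k = length
  (filter (λ xy → consecutiveᵇ F (proj₁ xy) (proj₂ xy) ∧ detᵇ k (proj₁ xy) (proj₂ xy) Data.Bool.≟ true)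
    (concatMap (λ x → map (λ y → (x , y)) F) F))
  where F = FareyD Q d

-- Constructive real numbers (Bishop): regular sequences of rationals,
-- | f m - f n | ≤ 1/(m+1) + 1/(n+1).
record ℝ : Set where
  field
    seq : ℕ → ℚ
    reg : ∀ m n → ℚ.∣ seq m ℚ.- seq n ∣ ℚ.≤ (+ 1 ℚ./ suc m) ℚ.+ (+ 1 ℚ./ suc n)
open ℝ public

-- Bishop positivity: x > 0 iff some approximation exceeds its error bound.
Positive : ℝ → Set
Positive x = Data.Product.∃ λ n → (+ 1 ℚ./ suc n) ℚ.< seq x n

-- | A - x·B | ≤ E  for naturals A, B, E and a real x, unfolded through the
-- approximations (|x - seq x n| ≤ 1/(n+1)):
--   ∀ n, | A - seq x n · B | ≤ E + B/(n+1).
AbsDiffLe : ℕ → ℝ → ℕ → ℕ → Set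
AbsDiffLe A x B E = ∀ n →
  ℚ.∣ (+ A ℚ./ 1) ℚ.- seq x n ℚ.* (+ B ℚ./ 1) ∣ ℚ.≤ (+ E ℚ./ 1) ℚ.+ (+ B ℚ./ suc n)

{-# OPTIONS --safe #-}
-- Adjoin to a pair u = (a , q), u′ = (a′ , q′) of determinant k the vector w = (u′ + J u) / k, where J mod k is
-- the unique residue making it integral. Then (u , w) is a basis of ℤ², the pair is determined by (q , q′ , J), and
-- its fractions are consecutive iff no lattice vector strictly between u and u′ has a denominator that is ≤ Q and
-- coprime to d. So N_{Q,d}(k) is, up to O(Q), the number of points (q , q′) with (q , w₂) = 1 in Q-fold dilates of
-- planar regions that depend only on J and on (q , q′) mod d k.
--
-- Let A(X) and G(X) count all points, respectively those with (q , w₂) = 1, in the X-fold dilates. Comparing the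
-- n-fold dilate with n² shifted copies gives A(nX + s) = n² A(X) + O(n² X) for 0 ≤ s < n. A common divisor e coprime
-- to d only replaces X by ⌊X/e⌋, so Möbius inversion reads G(X) = Σ_e μ(e) A(⌊X/e⌋) over (e , d) = 1, whence
-- G(nX) = n² G(X) + O(n² X log X). This makes G(X)/X² Cauchy with rate log X / X. Positivity: the terms e ≥ 2 remove
-- at most 3/4 of A(X) up to O(X log X), and A(X) ≫ X² because of the pairs with J = 1 and d ∣ w₂.
module Submission where

open import Defs
open import Data.Bool using (Bool; true; false; T; _∧_; not)
open import Data.Bool.ListAction using (all)
open import Data.Bool.Properties using (T-≡; T-∧; T-not-≡)
open import Data.Integer as ℤ using ()
open import Data.Integer.Properties using (pos-*)
open import Data.List using (List; []; _∷_; _++_; length; filter; concatMap; map; upTo; applyUpTo)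
open import Data.List.Membership.Propositional using (_∈_)
open import Data.List.Membership.Propositional.Properties using (∈-filter⁺; ∈-filter⁻; ∈-concat⁺′; ∈-concat⁻′; ∈-map⁺; ∈-map⁻; ∈-upTo⁺; ∈-upTo⁻)
open import Data.List.Relation.Unary.All as All using ()
open import Data.List.Relation.Unary.All.Properties using (all⁺; all⁻)
open import Data.Nat
open import Data.Nat.Coprimality using (coprime-divisor; gcd≡1⇒coprime; coprime⇒gcd≡1; coprime-factors; coprime-Bézout; coprime-/gcd)
open import Data.Nat.DivMod
open import Data.Nat.Divisibility
open import Data.Nat.GCD
open import Data.Nat.Induction using (<-rec)
open import Data.Nat.Logarithm
open import Data.Nat.Properties
open import Data.Nat.Tactic.RingSolver using (solve-∀)
open import Data.Product using (Σ; ∃; _×_; _,_; proj₁; proj₂; swap)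
open import Data.Rational as ℚ using (ℚ)
open import Data.Rational.Properties as ℚₚ using ()
open import Data.Rational.Unnormalised as ℚᵘ using (mkℚᵘ; *≤*; *<*)
open import Data.Rational.Unnormalised.Properties as ℚᵘₚ using ()
open import Data.Sum using (_⊎_; inj₁; inj₂)
open import Function using (_∘_; id; case_of_; it; Equivalence)
open import Relation.Binary using (tri<; tri≈; tri>)
open import Relation.Binary.PropositionalEquality hiding (J)
open import Relation.Nullary using (¬_; Dec; yes; no; contradiction)
open import Relation.Nullary.Decidable using (_×-dec_; ¬?; map′; toWitness; fromWitness)
open import Relation.Unary using (Decidable)
open import Algebra.Properties.Group ℚₚ.+-0-group using (⁻¹-involutive)


-- The planar regions are never described and their boundaries never measured. Monotonicity takes
-- their place: every condition on a pair apart from primitivity and the bound on blocking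
-- denominators depends only on q and q′ modulo d k, and enlarging q and q′ under a fixed bound can
-- only destroy blockers. So two pairs with equal residues, one of which dominates n times the
-- other, can be compared directly. Primitivity (q , w₂) = 1 is not periodic, so it cannot be
-- carried through such a comparison and has to be sieved out afterwards.
--
-- The identification of neighbours with good primitive triples (j , q , q′) is exact for q ≥ 2.
-- Only q = 1, where the fraction 1/1 has no successor, causes the discrepancy O(Q).
--
-- The constant has no closed form here. It is the limit of G(X)/X² along sparse points X = W 2^t,
-- where the logarithm is explicit and the pairs that prove positivity are available. To compare
-- G(m) with G(n), both are compared with G(m n). All estimates are pairs of inequalities in ℕ with
-- μ split into its two parts, and rationals appear only at the very end.

-- Finite sums and indicators.

Σ< : ℕ → (ℕ → ℕ) → ℕ
Σ< zero f = 0
Σ< (suc n) f = Σ< n f + f n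

Σ<-cong : ∀ n {f g : ℕ → ℕ} → (∀ i → i < n → f i ≡ g i) → Σ< n f ≡ Σ< n g
Σ<-cong zero h = refl
Σ<-cong (suc n) h = cong₂ _+_ (Σ<-cong n λ i i<n → h i (m<n⇒m<1+n i<n)) (h n ≤-refl)

Σ<-mono : ∀ n {f g : ℕ → ℕ} → (∀ i → i < n → f i ≤ g i) → Σ< n f ≤ Σ< n g
Σ<-mono zero h = z≤n
Σ<-mono (suc n) h = +-mono-≤ (Σ<-mono n λ i i<n → h i (m<n⇒m<1+n i<n)) (h n ≤-refl)

Σ<-const : ∀ n c → Σ< n (λ _ → c) ≡ n * c
Σ<-const zero c = refl
Σ<-const (suc n) c = trans (cong (_+ c) (Σ<-const n c)) (+-comm (n * c) c)

Σ<-zero : ∀ n {f : ℕ → ℕ} → (∀ i → i < n → f i ≡ 0) → Σ< n f ≡ 0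
Σ<-zero n h = trans (Σ<-cong n h) (trans (Σ<-const n 0) (*-zeroʳ n))

Σ<-bound : ∀ n {f : ℕ → ℕ} c → (∀ i → i < n → f i ≤ c) → Σ< n f ≤ n * c
Σ<-bound n c h = ≤-trans (Σ<-mono n h) (≤-reflexive (Σ<-const n c))

interchange : ∀ a b c d → (a + b) + (c + d) ≡ (a + c) + (b + d)
interchange = solve-∀

Σ<-+ : ∀ n (f g : ℕ → ℕ) → Σ< n (λ i → f i + g i) ≡ Σ< n f + Σ< n g
Σ<-+ zero f g = refl
Σ<-+ (suc n) f g = trans (cong (_+ (f n + g n)) (Σ<-+ n f g))
  (interchange (Σ< n f) (Σ< n g) (f n) (g n))

Σ<-*ˡ : ∀ n c (f : ℕ → ℕ) → Σ< n (λ i → c * f i) ≡ c * Σ< n f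
Σ<-*ˡ zero c f = sym (*-zeroʳ c)
Σ<-*ˡ (suc n) c f = trans (cong (_+ c * f n) (Σ<-*ˡ n c f)) (sym (*-distribˡ-+ c (Σ< n f) (f n)))

Σ<-swap : ∀ m n (f : ℕ → ℕ → ℕ) →
  Σ< m (λ i → Σ< n (λ j → f i j)) ≡ Σ< n (λ j → Σ< m (λ i → f i j))
Σ<-swap zero n f = sym (Σ<-zero n λ _ _ → refl)
Σ<-swap (suc m) n f = trans (cong (_+ Σ< n (f m)) (Σ<-swap m n f))
  (sym (Σ<-+ n (λ j → Σ< m (λ i → f i j)) (f m)))

Σ<-split : ∀ m n (f : ℕ → ℕ) → Σ< (m + n) f ≡ Σ< m f + Σ< n (λ i → f (m + i))
Σ<-split m zero f = trans (cong (λ z → Σ< z f) (+-identityʳ m)) (sym (+-identityʳ (Σ< m f)))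
Σ<-split m (suc n) f = begin
  Σ< (m + suc n) f ≡⟨ cong (λ z → Σ< z f) (+-suc m n) ⟩
  Σ< (m + n) f + f (m + n) ≡⟨ cong (_+ f (m + n)) (Σ<-split m n f) ⟩
  Σ< m f + Σ< n (λ i → f (m + i)) + f (m + n) ≡⟨ +-assoc (Σ< m f) _ _ ⟩
  Σ< m f + Σ< (suc n) (λ i → f (m + i)) ∎
  where open ≡-Reasoning

Σ<-split-≤ : ∀ {m n} → m ≤ n → (f : ℕ → ℕ) → Σ< n f ≡ Σ< m f + Σ< (n ∸ m) (λ i → f (m + i))
Σ<-split-≤ {m} {n} m≤n f = trans (cong (λ z → Σ< z f) (sym (m+[n∸m]≡n m≤n))) (Σ<-split m (n ∸ m) f)

Σ<-mono-range : ∀ {m n} → m ≤ n → (f : ℕ → ℕ) → Σ< m f ≤ Σ< n f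
Σ<-mono-range {m} m≤n f = ≤-trans (m≤m+n (Σ< m f) _) (≤-reflexive (sym (Σ<-split-≤ m≤n f)))

Σ<-zero-tail : ∀ {m n} → m ≤ n → (f : ℕ → ℕ) → (∀ i → m ≤ i → i < n → f i ≡ 0) → Σ< n f ≡ Σ< m f
Σ<-zero-tail {m} {n} m≤n f h = trans (Σ<-split-≤ m≤n f)
  (trans (cong (Σ< m f +_) (Σ<-zero (n ∸ m) λ i i<n∸m →
    h (m + i) (m≤m+n m i) (subst (m + i <_) (m+[n∸m]≡n m≤n) (+-monoʳ-< m i<n∸m))))
  (+-identityʳ _))

Σ<-sucˡ : ∀ n (f : ℕ → ℕ) → Σ< (suc n) f ≡ f 0 + Σ< n (f ∘ suc)
Σ<-sucˡ n f = Σ<-split 1 n f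

Σ<-blocks : ∀ m n (f : ℕ → ℕ) → Σ< (m * n) f ≡ Σ< m (λ i → Σ< n (λ j → f (i * n + j)))
Σ<-blocks zero n f = refl
Σ<-blocks (suc m) n f = trans (cong (λ z → Σ< z f) (+-comm n (m * n)))
  (trans (Σ<-split (m * n) n f) (cong (_+ Σ< n (λ j → f (m * n + j))) (Σ<-blocks m n f)))

Σ<-single : ∀ n {f : ℕ → ℕ} {i₀} → i₀ < n → (∀ i → i < n → i ≢ i₀ → f i ≡ 0) → Σ< n f ≡ f i₀
Σ<-single (suc n) {f} {i₀} i₀<1+n h with i₀ ≟ n
... | yes refl = cong (_+ f n) (Σ<-zero n λ i i<n → h i (m<n⇒m<1+n i<n) (<⇒≢ i<n))
... | no i₀≢n = trans
  (cong₂ _+_ (Σ<-single n (≤∧≢⇒< (s≤s⁻¹ i₀<1+n) i₀≢n) λ i i<n → h i (m<n⇒m<1+n i<n))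
             (h n ≤-refl (i₀≢n ∘ sym)))
  (+-identityʳ (f i₀))

Σ<-term : ∀ n (f : ℕ → ℕ) {i} → i < n → f i ≤ Σ< n f
Σ<-term (suc n) f {i} i<1+n with i ≟ n
... | yes refl = m≤n+m (f n) (Σ< n f)
... | no i≢n = ≤-trans (Σ<-term n f (≤∧≢⇒< (s≤s⁻¹ i<1+n) i≢n)) (m≤m+n _ (f n))

𝟙 : ∀ {p} {P : Set p} → Dec P → ℕ
𝟙 (yes _) = 1
𝟙 (no _) = 0

𝟙-yes : ∀ {p} {P : Set p} (P? : Dec P) → P → 𝟙 P? ≡ 1
𝟙-yes (yes _) x = refl
𝟙-yes (no ¬x) x = contradiction x ¬x

𝟙-no : ∀ {p} {P : Set p} (P? : Dec P) → ¬ P → 𝟙 P? ≡ 0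
𝟙-no (yes x) ¬x = contradiction x ¬x
𝟙-no (no _) ¬x = refl

𝟙≤1 : ∀ {p} {P : Set p} (P? : Dec P) → 𝟙 P? ≤ 1
𝟙≤1 (yes _) = ≤-refl
𝟙≤1 (no _) = z≤n

𝟙-mono : ∀ {p q} {P : Set p} {Q : Set q} (P? : Dec P) (Q? : Dec Q) → (P → Q) → 𝟙 P? ≤ 𝟙 Q?
𝟙-mono (yes x) Q? f = ≤-reflexive (sym (𝟙-yes Q? (f x)))
𝟙-mono (no _) Q? f = z≤n

𝟙-cong : ∀ {p q} {P : Set p} {Q : Set q} (P? : Dec P) (Q? : Dec Q) → (P → Q) → (Q → P) → 𝟙 P? ≡ 𝟙 Q?
𝟙-cong P? Q? f g = ≤-antisym (𝟙-mono P? Q? f) (𝟙-mono Q? P? g)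

𝟙-× : ∀ {p q} {P : Set p} {Q : Set q} (P? : Dec P) (Q? : Dec Q) → 𝟙 (P? ×-dec Q?) ≡ 𝟙 P? * 𝟙 Q?
𝟙-× P? Q? with P? | Q?
... | yes _ | yes _ = refl
... | yes _ | no _ = refl
... | no _ | yes _ = refl
... | no _ | no _ = refl

-- Prepares a double count: the indicator of an object is traded for a sum over the single index
-- attached to it.
Σ<-𝟙-unique : ∀ n {p r} {P : Set p} {R : ℕ → Set r} (P? : Dec P) (R? : ∀ i → Dec (R i)) →
  (∀ i → i < n → R i → P) →
  (P → ∃ λ i₀ → i₀ < n × R i₀ × (∀ i → i < n → R i → i ≡ i₀)) →
  Σ< n (λ i → 𝟙 (R? i)) ≡ 𝟙 P?
Σ<-𝟙-unique n (no ¬x) R? sound _ = Σ<-zero n λ i i<n → 𝟙-no (R? i) λ r → ¬x (sound i i<n r)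
Σ<-𝟙-unique n (yes x) R? _ compl with compl x
... | i₀ , i₀<n , r₀ , uniq = trans
  (Σ<-single n i₀<n λ i i<n i≢i₀ → 𝟙-no (R? i) λ r → i≢i₀ (uniq i i<n r))
  (𝟙-yes (R? i₀) r₀)

∸-quotient-< : ∀ X e .{{_ : NonZero e}} {i} → X / e * e ≤ i → i < X → suc (i ∸ X / e * e) < e
∸-quotient-< X e {i} lo i<X = begin-strict
  suc (i ∸ X / e * e) ≡⟨ sym (+-∸-assoc 1 lo) ⟩
  suc i ∸ X / e * e ≤⟨ ∸-monoˡ-≤ (X / e * e) i<X ⟩
  X ∸ X / e * e ≡⟨ sym (m%n≡m∸m/n*n X e) ⟩
  X % e <⟨ m%n<n X e ⟩
  e ∎
  where open ≤-Reasoning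

-- Among e consecutive values i + 1 starting right after a multiple of e, only the last is a
-- multiple of e. The incomplete block at the end contains none.
Σ<-multiples : ∀ X e .{{_ : NonZero e}} (f : ℕ → ℕ) →
  Σ< X (λ i → 𝟙 (e ∣? suc i) * f (suc i)) ≡ Σ< (X / e) (λ i → f (e * suc i))
Σ<-multiples X e@(suc e′) f = begin
  Σ< X g ≡⟨ Σ<-zero-tail (m/n*n≤m X e) g tail ⟩
  Σ< (X / e * e) g ≡⟨ Σ<-blocks (X / e) e g ⟩
  Σ< (X / e) (λ i → Σ< e (λ j → g (i * e + j))) ≡⟨ Σ<-cong (X / e) (λ i _ → block i) ⟩
  Σ< (X / e) (λ i → f (e * suc i)) ∎
  where
  open ≡-Reasoning
  g : ℕ → ℕ
  g i = 𝟙 (e ∣? suc i) * f (suc i)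
  g-no : ∀ y j → suc j < e → g (y * e + j) ≡ 0
  g-no y j 1+j<e = cong (_* f (suc (y * e + j))) (𝟙-no (e ∣? suc (y * e + j)) λ e∣ →
    >⇒∤ {n = suc j} 1+j<e (∣m+n∣m⇒∣n (subst (e ∣_) (sym (+-suc (y * e) j)) e∣) (n∣m*n y)))
  last : ∀ i → suc (i * e + e′) ≡ e * suc i
  last i = trans (sym (+-suc (i * e) e′)) (trans (+-comm (i * e) e) (*-comm (suc i) e))
  block : ∀ i → Σ< e (λ j → g (i * e + j)) ≡ f (e * suc i)
  block i = begin
    Σ< e (λ j → g (i * e + j))
      ≡⟨ Σ<-single e {i₀ = e′} ≤-refl (λ j j<e j≢e′ → g-no i j (s≤s (≤∧≢⇒< (s≤s⁻¹ j<e) j≢e′))) ⟩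
    g (i * e + e′) ≡⟨ cong (λ z → 𝟙 (e ∣? z) * f z) (last i) ⟩
    𝟙 (e ∣? e * suc i) * f (e * suc i) ≡⟨ cong (_* f (e * suc i)) (𝟙-yes (e ∣? e * suc i) (m∣m*n (suc i))) ⟩
    1 * f (e * suc i) ≡⟨ *-identityˡ _ ⟩
    f (e * suc i) ∎
  tail : ∀ i → X / e * e ≤ i → i < X → g i ≡ 0
  tail i lo i<X = subst (λ z → g z ≡ 0) (m+[n∸m]≡n lo) (g-no (X / e) (i ∸ X / e * e) (∸-quotient-< X e lo i<X))

-- Least factors and the Möbius function.

searchDivisor : ℕ → ℕ → ℕ → ℕ
searchDivisor zero c n = c
searchDivisor (suc f) c n with 2 + c ∣? n
... | yes _ = c
... | no _ = searchDivisor f (suc c) n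

-- Shifted by 2, so that instance search sees a nonzero divisor.
leastFactor : ℕ → ℕ
leastFactor n = 2 + searchDivisor n 0 n

-- For p ≥ 2 this makes p the smallest prime factor of n; primality enters through
-- `leastFactor-coprime`.
IsLeastFactor : ℕ → ℕ → Set
IsLeastFactor p n = p ∣ n × (∀ i → 2 ≤ i → i ∣ n → p ≤ i)

-- The invariant n ≤ 2 + c + f means that when the fuel is exhausted the candidate 2 + c has reached
-- n, which divides itself.
searchDivisor-least : ∀ f c n → 2 + c ≤ n → n ≤ 2 + c + f → (∀ i → 2 ≤ i → i ∣ n → 2 + c ≤ i) →
  IsLeastFactor (2 + searchDivisor f c n) n
searchDivisor-least zero c n lo hi least = ∣-reflexive (≤-antisym lo (subst (n ≤_) (+-identityʳ (2 + c)) hi)) , least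
searchDivisor-least (suc f) c n lo hi least with 2 + c ∣? n
... | yes d = d , least
... | no ¬d = searchDivisor-least f (suc c) n
  (≤∧≢⇒< lo λ eq → ¬d (∣-reflexive eq))
  (subst (n ≤_) (+-suc (2 + c) f) hi)
  λ i 2≤i i∣n → ≤∧≢⇒< (least i 2≤i i∣n) λ eq → ¬d (subst (_∣ n) (sym eq) i∣n)

leastFactor-least : ∀ n → 2 ≤ n → IsLeastFactor (leastFactor n) n
leastFactor-least n 2≤n = searchDivisor-least n 0 n 2≤n (m≤n+m n 2) λ _ 2≤i _ → 2≤i

leastFactor-unique : ∀ {p} n → 2 ≤ n → 2 ≤ p → IsLeastFactor p n → leastFactor n ≡ p
leastFactor-unique n 2≤n 2≤p (p∣n , p-least) with leastFactor-least n 2≤n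
... | q∣n , q-least = ≤-antisym (q-least _ 2≤p p∣n) (p-least _ (s≤s (s≤s z≤n)) q∣n)

leastFactor-∣ : ∀ {p g e} → IsLeastFactor p g → p ∣ e → e ∣ g → IsLeastFactor p e
leastFactor-∣ (_ , least) p∣e e∣g = p∣e , λ i 2≤i i∣e → least i 2≤i (∣-trans i∣e e∣g)

-- μ as the pair (μ⁺ , μ⁻) of its positive and negative parts.
mobiusAux : ℕ → ℕ → ℕ × ℕ
mobiusAux zero n = 1 , 0
mobiusAux (suc f) n with 2 ≤? n | leastFactor n ∣? n / leastFactor n
... | no _ | _ = 1 , 0
... | yes _ | yes _ = 0 , 0
... | yes _ | no _ = swap (mobiusAux f (n / leastFactor n))

mobius : ℕ → ℕ × ℕ
mobius n = mobiusAux n n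

μ⁺ μ⁻ : ℕ → ℕ
μ⁺ n = proj₁ (mobius n)
μ⁻ n = proj₂ (mobius n)

-- Each recursive call divides n by a factor ≥ 2, so any fuel that is at least n suffices.
mobiusAux-stable : ∀ f f′ n → n ≤ f → n ≤ f′ → mobiusAux f n ≡ mobiusAux f′ n
mobiusAux-stable zero zero n _ _ = refl
mobiusAux-stable zero (suc f′) zero _ _ = refl
mobiusAux-stable (suc f) zero zero _ _ = refl
mobiusAux-stable (suc f) (suc f′) n n≤f n≤f′ with 2 ≤? n | leastFactor n ∣? n / leastFactor n
... | no _ | _ = refl
... | yes _ | yes _ = refl
... | yes 2≤n | no _ = cong swap (mobiusAux-stable f f′ (n / leastFactor n)
    (s≤s⁻¹ (≤-trans smaller n≤f)) (s≤s⁻¹ (≤-trans smaller n≤f′)))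
  where
  smaller : n / leastFactor n < n
  smaller = m/n<m n (leastFactor n) {{>-nonZero (≤-trans (s≤s z≤n) 2≤n)}} (s≤s (s≤s z≤n))

2≤p*e : ∀ {p e} → 2 ≤ p → 1 ≤ e → 2 ≤ p * e
2≤p*e {p} {e} 2≤p 1≤e = ≤-trans 2≤p (m≤m*n p e {{>-nonZero 1≤e}})

mobiusAux-square : ∀ f n → 2 ≤ n → leastFactor n ∣ n / leastFactor n → mobiusAux (suc f) n ≡ (0 , 0)
mobiusAux-square f n 2≤n d with 2 ≤? n | leastFactor n ∣? n / leastFactor n
... | no ¬2≤n | _ = contradiction 2≤n ¬2≤n
... | yes _ | yes _ = refl
... | yes _ | no ¬d = contradiction d ¬d

mobiusAux-flip : ∀ f n → 2 ≤ n → ¬ leastFactor n ∣ n / leastFactor n →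
  mobiusAux (suc f) n ≡ swap (mobiusAux f (n / leastFactor n))
mobiusAux-flip f n 2≤n ¬d with 2 ≤? n | leastFactor n ∣? n / leastFactor n
... | no ¬2≤n | _ = contradiction 2≤n ¬2≤n
... | yes _ | yes d = contradiction d ¬d
... | yes _ | no _ = refl

p*e/p : ∀ p e .{{_ : NonZero p}} → p * e / p ≡ e
p*e/p p e = trans (cong (_/ p) (*-comm p e)) (m*n/n≡m e p)

quotient-by : ∀ {p q} e .{{_ : NonZero p}} .{{_ : NonZero q}} → q ≡ p → p * e / q ≡ e
quotient-by {p} e refl = p*e/p p e

mobius-square : ∀ p e .{{_ : NonZero p}} → 2 ≤ p → 1 ≤ e → IsLeastFactor p (p * e) → p ∣ e → mobius (p * e) ≡ (0 , 0)
mobius-square p e 2≤p 1≤e lf p∣e = trans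
  (mobiusAux-stable (p * e) (suc (p * e)) (p * e) ≤-refl (n≤1+n _))
  (mobiusAux-square (p * e) (p * e) (2≤p*e 2≤p 1≤e) (subst₂ _∣_ (sym lf≡p) (sym (quotient-by e lf≡p)) p∣e))
  where
  lf≡p : leastFactor (p * e) ≡ p
  lf≡p = leastFactor-unique (p * e) (2≤p*e 2≤p 1≤e) 2≤p lf

-- The recursion strips the least factor, so the sign change is read off when p is the least factor
-- of p e. The pairing below multiplies by the least factor of one fixed g, where this holds for
-- every divisor p e of g.
mobius-flip : ∀ p e .{{_ : NonZero p}} → 2 ≤ p → 1 ≤ e → IsLeastFactor p (p * e) → ¬ p ∣ e →
  mobius (p * e) ≡ swap (mobius e)
mobius-flip p e 2≤p 1≤e lf ¬p∣e = begin
  mobius (p * e)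
    ≡⟨ mobiusAux-stable (p * e) (suc (p * e)) (p * e) ≤-refl (n≤1+n _) ⟩
  mobiusAux (suc (p * e)) (p * e)
    ≡⟨ mobiusAux-flip (p * e) (p * e) (2≤p*e 2≤p 1≤e) (λ d → ¬p∣e (subst₂ _∣_ lf≡p (quotient-by e lf≡p) d)) ⟩
  swap (mobiusAux (p * e) (p * e / leastFactor (p * e)))
    ≡⟨ cong (λ z → swap (mobiusAux (p * e) z)) (quotient-by e lf≡p) ⟩
  swap (mobiusAux (p * e) e)
    ≡⟨ cong swap (mobiusAux-stable (p * e) e e (m≤n*m e p) ≤-refl) ⟩
  swap (mobius e) ∎
  where
  open ≡-Reasoning
  lf≡p : leastFactor (p * e) ≡ p
  lf≡p = leastFactor-unique (p * e) (2≤p*e 2≤p 1≤e) 2≤p lf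

mobiusAux≤1 : ∀ f n → proj₁ (mobiusAux f n) ≤ 1 × proj₂ (mobiusAux f n) ≤ 1
mobiusAux≤1 zero n = ≤-refl , z≤n
mobiusAux≤1 (suc f) n with 2 ≤? n | leastFactor n ∣? n / leastFactor n
... | no _ | _ = ≤-refl , z≤n
... | yes _ | yes _ = z≤n , z≤n
... | yes _ | no _ = swap (mobiusAux≤1 f (n / leastFactor n))

-- A common divisor ≥ 2 of e and p divides g, so by minimality it is at least p, hence equal to p.
leastFactor-coprime : ∀ {p g e} → 2 ≤ p → IsLeastFactor p g → e ∣ g → ¬ p ∣ e → gcd e p ≡ 1
leastFactor-coprime {p} {g} {e} 2≤p (p∣g , least) e∣g ¬p∣e with 2 ≤? gcd e p
... | no ¬2≤ = ≤-antisym (s≤s⁻¹ (≰⇒> ¬2≤)) (n≢0⇒n>0 λ eq → contradiction (gcd[m,n]≡0⇒n≡0 e eq) λ p≡0 →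
    contradiction (subst (2 ≤_) p≡0 2≤p) λ ())
... | yes 2≤c = contradiction (subst (_∣ e) c≡p (gcd[m,n]∣m e p)) ¬p∣e
  where
  c≡p : gcd e p ≡ p
  c≡p = ≤-antisym (∣⇒≤ {{>-nonZero (≤-trans (s≤s z≤n) 2≤p)}} (gcd[m,n]∣n e p))
                  (least _ 2≤c (∣-trans (gcd[m,n]∣m e p) e∣g))

module _ {p g} .{{_ : NonZero p}} (2≤p : 2 ≤ p) (1≤g : 1 ≤ g) (lf : IsLeastFactor p g) where

  multiple-∣ : ∀ {e} → e ∣ g → ¬ p ∣ e → p * e ∣ g
  multiple-∣ {e} e∣g ¬p∣e with proj₁ lf
  ... | divides h refl = subst (p * e ∣_) (*-comm p h) (*-monoʳ-∣ p
    (coprime-divisor (gcd≡1⇒coprime (leastFactor-coprime 2≤p lf e∣g ¬p∣e)) (subst (e ∣_) (*-comm h p) e∣g)))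

  -- The divisors e and p e of g with e prime to p form pairs, and the divisors divisible by p²
  -- contribute nothing. The result is symmetric in a and b, so it serves for (μ⁺ , μ⁻) and (μ⁻ ,
  -- μ⁺) alike.
  divisor-pairing : ∀ {B} (a b : ℕ → ℕ) → g ≤ B →
    (∀ e → 1 ≤ e → p * e ∣ g → ¬ p ∣ e → a (p * e) ≡ b e) →
    (∀ e → 1 ≤ e → p * e ∣ g → p ∣ e → a (p * e) ≡ 0) →
    Σ< B (λ i → 𝟙 (suc i ∣? g) * a (suc i)) ≡
    Σ< (B / p) (λ i → 𝟙 (p * suc i ∣? g ×-dec ¬? (p ∣? suc i)) * (a (suc i) + b (suc i)))
  divisor-pairing {B} a b g≤B flip vanish = begin
    Σ< B (λ i → 𝟙 (suc i ∣? g) * a (suc i))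
      ≡⟨ Σ<-cong B (λ i _ → separate (suc i)) ⟩
    Σ< B (λ i → u (suc i) + v (suc i))
      ≡⟨ Σ<-+ B (λ i → u (suc i)) (λ i → v (suc i)) ⟩
    Σ< B (λ i → u (suc i)) + Σ< B (λ i → v (suc i))
      ≡⟨ cong₂ _+_ (Σ<-zero-tail (m/n≤m B p) (λ i → u (suc i)) tail)
                   (trans (Σ<-multiples B p (λ e → 𝟙 (e ∣? g) * a e)) (Σ<-cong (B / p) λ i _ → folded i)) ⟩
    Σ< (B / p) (λ i → u (suc i)) + Σ< (B / p) (λ i → w (suc i))
      ≡⟨ sym (Σ<-+ (B / p) (λ i → u (suc i)) (λ i → w (suc i))) ⟩
    Σ< (B / p) (λ i → u (suc i) + w (suc i))
      ≡⟨ Σ<-cong (B / p) (λ i _ → sym (*-distribˡ-+ (𝟙 (χ? (suc i))) (a (suc i)) (b (suc i)))) ⟩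
    Σ< (B / p) (λ i → 𝟙 (χ? (suc i)) * (a (suc i) + b (suc i))) ∎
    where
    open ≡-Reasoning
    χ? : ∀ e → Dec (p * e ∣ g × ¬ p ∣ e)
    χ? e = p * e ∣? g ×-dec ¬? (p ∣? e)
    u v w : ℕ → ℕ
    u e = 𝟙 (χ? e) * a e
    v e = 𝟙 (p ∣? e) * (𝟙 (e ∣? g) * a e)
    w e = 𝟙 (χ? e) * b e
    separate : ∀ e → 𝟙 (e ∣? g) * a e ≡ u e + v e
    separate e with p ∣? e
    ... | yes p∣e = sym (cong₂ _+_ (cong (_* a e) (trans (𝟙-× (p * e ∣? g) (no _)) (*-zeroʳ (𝟙 (p * e ∣? g))))) (*-identityˡ _))
    ... | no ¬p∣e = sym (trans (+-identityʳ _) (cong (_* a e)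
      (𝟙-cong (p * e ∣? g ×-dec ¬? (no ¬p∣e)) (e ∣? g) (λ { (pe∣g , _) → m*n∣⇒n∣ p e pe∣g }) (λ e∣g → multiple-∣ e∣g ¬p∣e , ¬p∣e))))
    -- A divisor e with p e ∣ g satisfies p e ≤ B, so both halves of the pairing live on e ≤ B / p.
    tail : ∀ i → B / p ≤ i → i < B → u (suc i) ≡ 0
    tail i lo _ = cong (_* a (suc i)) (𝟙-no (χ? (suc i)) λ { (pe∣g , _) → <⇒≱ (s≤s lo)
      (subst (_≤ B / p) (p*e/p p (suc i)) (/-monoˡ-≤ p (≤-trans (∣⇒≤ {{>-nonZero 1≤g}} pe∣g) g≤B))) })
    folded : ∀ i → 𝟙 (p * suc i ∣? g) * a (p * suc i) ≡ w (suc i)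
    folded i with p * suc i ∣? g | p ∣? suc i
    ... | no _ | _ = refl
    ... | yes d | yes p∣e = trans (*-identityˡ _) (vanish (suc i) (s≤s z≤n) d p∣e)
    ... | yes d | no ¬p∣e = cong (1 *_) (flip (suc i) (s≤s z≤n) d ¬p∣e)

-- The classical Σ_{e ∣ g} μ(e) = [g = 1], with the negative part moved to the right. For g ≥ 2 both
-- sides reduce to the same paired sum.
mobius-sum : ∀ g B → 1 ≤ g → g ≤ B →
  Σ< B (λ i → 𝟙 (suc i ∣? g) * μ⁺ (suc i)) ≡ Σ< B (λ i → 𝟙 (suc i ∣? g) * μ⁻ (suc i)) + 𝟙 (g ≟ 1)
mobius-sum g B 1≤g g≤B with 2 ≤? g
... | no ¬2≤g with ≤-antisym 1≤g (s≤s⁻¹ (≰⇒> ¬2≤g))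
... | refl = trans (single μ⁺) (sym (cong (_+ 1) (single μ⁻)))
  where
  single : (a : ℕ → ℕ) → Σ< B (λ i → 𝟙 (suc i ∣? 1) * a (suc i)) ≡ a 1
  single a = trans (Σ<-single B {i₀ = 0} g≤B λ i _ i≢0 →
    cong (_* a (suc i)) (𝟙-no (suc i ∣? 1) λ d → i≢0 (suc-injective (∣1⇒≡1 d))))
    (*-identityˡ (a 1))
mobius-sum g B 1≤g g≤B | yes 2≤g = begin
  Σ< B (λ i → 𝟙 (suc i ∣? g) * μ⁺ (suc i))
    ≡⟨ divisor-pairing 2≤p 1≤g lf μ⁺ μ⁻ g≤B (flip proj₁) (vanish proj₁ refl) ⟩
  Σ< (B / p) (λ i → 𝟙 (χ? i) * (μ⁺ (suc i) + μ⁻ (suc i)))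
    ≡⟨ Σ<-cong (B / p) (λ i _ → cong (𝟙 (χ? i) *_) (+-comm (μ⁺ (suc i)) (μ⁻ (suc i)))) ⟩
  Σ< (B / p) (λ i → 𝟙 (χ? i) * (μ⁻ (suc i) + μ⁺ (suc i)))
    ≡⟨ sym (divisor-pairing 2≤p 1≤g lf μ⁻ μ⁺ g≤B (flip proj₂) (vanish proj₂ refl)) ⟩
  Σ< B (λ i → 𝟙 (suc i ∣? g) * μ⁻ (suc i))
    ≡⟨ sym (+-identityʳ _) ⟩
  Σ< B (λ i → 𝟙 (suc i ∣? g) * μ⁻ (suc i)) + 0
    ≡⟨ cong (Σ< B (λ i → 𝟙 (suc i ∣? g) * μ⁻ (suc i)) +_) (sym (𝟙-no (g ≟ 1) λ g≡1 → <⇒≢ 2≤g (sym g≡1))) ⟩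
  Σ< B (λ i → 𝟙 (suc i ∣? g) * μ⁻ (suc i)) + 𝟙 (g ≟ 1) ∎
  where
  open ≡-Reasoning
  p = leastFactor g
  2≤p : 2 ≤ p
  2≤p = s≤s (s≤s z≤n)
  lf : IsLeastFactor p g
  lf = leastFactor-least g 2≤g
  χ? : ∀ i → Dec (p * suc i ∣ g × ¬ p ∣ suc i)
  χ? i = p * suc i ∣? g ×-dec ¬? (p ∣? suc i)
  flip : ∀ (π : ℕ × ℕ → ℕ) e → 1 ≤ e → p * e ∣ g → ¬ p ∣ e → π (mobius (p * e)) ≡ π (swap (mobius e))
  flip π e 1≤e pe∣g ¬p∣e = cong π (mobius-flip p e 2≤p 1≤e (leastFactor-∣ lf (m∣m*n e) pe∣g) ¬p∣e)
  vanish : ∀ (π : ℕ × ℕ → ℕ) → π (0 , 0) ≡ 0 → ∀ e → 1 ≤ e → p * e ∣ g → p ∣ e → π (mobius (p * e)) ≡ 0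
  vanish π eq e 1≤e pe∣g p∣e = trans (cong π (mobius-square p e 2≤p 1≤e (leastFactor-∣ lf (m∣m*n e) pe∣g) p∣e)) eq

-- Harmonic and inverse-square sums.

-- The added 1 keeps the factor positive, so errors without a logarithm are absorbed as well.
L : ℕ → ℕ
L n = suc ⌊log₂ n ⌋

log-half : ∀ n → 2 ≤ n → ⌊log₂ n ⌋ ≡ suc ⌊log₂ ⌊ n /2⌋ ⌋
log-half n 2≤n = sym (trans (cong suc (⌊log₂⌊n/2⌋⌋≡⌊log₂n⌋∸1 n)) (m+[n∸m]≡n 1≤log))
  where
  1≤log : 1 ≤ ⌊log₂ n ⌋
  1≤log = subst (_≤ ⌊log₂ n ⌋) (⌊log₂[2^n]⌋≡n 1) (⌊log₂⌋-mono-≤ 2≤n)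

⌈n/2⌉≤1+⌊n/2⌋ : ∀ n → ⌈ n /2⌉ ≤ suc ⌊ n /2⌋
⌈n/2⌉≤1+⌊n/2⌋ zero = z≤n
⌈n/2⌉≤1+⌊n/2⌋ (suc zero) = ≤-refl
⌈n/2⌉≤1+⌊n/2⌋ (suc (suc n)) = s≤s (⌈n/2⌉≤1+⌊n/2⌋ n)

-- Halving n removes at most ⌊n/2⌋ + 1 terms, each at most T / (⌊n/2⌋ + 1).
harmonic : ∀ T (b : ℕ → ℕ) n → (∀ i → i < n → suc i * b i ≤ T) → Σ< n b ≤ T * L n
harmonic T b = <-rec _ step
  where
  open ≤-Reasoning
  step : ∀ n → (∀ {m} → m < n → (∀ i → i < m → suc i * b i ≤ T) → Σ< m b ≤ T * L m) →
    (∀ i → i < n → suc i * b i ≤ T) → Σ< n b ≤ T * L n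
  step zero rec h = z≤n
  step (suc zero) rec h = begin
    b 0 ≡⟨ sym (*-identityˡ (b 0)) ⟩
    1 * b 0 ≤⟨ h 0 (s≤s z≤n) ⟩
    T ≤⟨ m≤m*n T (L 1) ⟩
    T * L 1 ∎
  step n@(suc (suc n′)) rec h = begin
    Σ< n b ≡⟨ Σ<-split-≤ (⌊n/2⌋≤n n) b ⟩
    Σ< m b + tail ≤⟨ +-mono-≤ (rec (⌊n/2⌋<n (suc n′)) λ i i<m → h i (<-≤-trans i<m (⌊n/2⌋≤n n))) tail≤T ⟩
    T * L m + T ≡⟨ +-comm _ T ⟩
    T + T * L m ≡⟨ sym (*-suc T (L m)) ⟩
    T * suc (L m) ≡⟨ cong (λ z → T * suc z) (sym (log-half n (s≤s (s≤s z≤n)))) ⟩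
    T * L n ∎
    where
    m = ⌊ n /2⌋
    tail = Σ< (n ∸ m) (λ i → b (m + i))
    n∸m : n ∸ m ≡ ⌈ n /2⌉
    n∸m = trans (cong (_∸ m) (sym (⌊n/2⌋+⌈n/2⌉≡n n))) (m+n∸m≡n m ⌈ n /2⌉)
    tail≤T : tail ≤ T
    tail≤T = *-cancelˡ-≤ (suc m) (begin
      suc m * tail ≡⟨ sym (Σ<-*ˡ (n ∸ m) (suc m) _) ⟩
      Σ< (n ∸ m) (λ i → suc m * b (m + i))
        ≤⟨ Σ<-bound (n ∸ m) T (λ i i< → ≤-trans (*-monoˡ-≤ (b (m + i)) (s≤s (m≤m+n m i)))
             (h (m + i) (subst (m + i <_) (m+[n∸m]≡n (⌊n/2⌋≤n n)) (+-monoʳ-< m i<)))) ⟩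
      (n ∸ m) * T ≤⟨ *-monoˡ-≤ T (subst (_≤ suc m) (sym n∸m) (⌈n/2⌉≤1+⌊n/2⌋ n)) ⟩
      suc m * T ∎)

-- The telescoping estimate Σ_{X < e ≤ X + m} e⁻² ≤ 1/X - 1/(X + m).
square-tail : ∀ X T (b : ℕ → ℕ) → 1 ≤ X → ∀ m →
  (∀ i → i < m → suc (X + i) * suc (X + i) * b i ≤ T) →
  X * (X + m) * Σ< m b + X * T ≤ (X + m) * T
square-tail X T b 1≤X zero h = ≤-reflexive (begin-equality
  X * (X + 0) * 0 + X * T ≡⟨ cong (_+ X * T) (*-zeroʳ (X * (X + 0))) ⟩
  X * T ≡⟨ cong (_* T) (sym (+-identityʳ X)) ⟩
  (X + 0) * T ∎)
  where open ≤-Reasoning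
square-tail X T b 1≤X (suc m) h = *-cancelˡ-≤ y {{>-nonZero (≤-trans 1≤X (m≤m+n X m))}} (begin
  y * (X * (X + suc m) * (S + b m) + X * T) ≡⟨ e₁ X m S (b m) T ⟩
  suc y * (X * y * S) + X * (y * suc y * b m) + X * y * T
    ≤⟨ +-monoˡ-≤ (X * y * T) (+-monoʳ-≤ (suc y * (X * y * S)) (*-monoʳ-≤ X last)) ⟩
  suc y * (X * y * S) + X * T + X * y * T ≡⟨ e₂ X y (X * y * S) T ⟩
  suc y * (X * y * S + X * T) ≤⟨ *-monoʳ-≤ (suc y) (square-tail X T b 1≤X m λ i i<m → h i (m<n⇒m<1+n i<m)) ⟩
  suc y * (y * T) ≡⟨ e₃ X m T ⟩
  y * ((X + suc m) * T) ∎)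
  where
  open ≤-Reasoning
  y = X + m
  S = Σ< m b
  e₁ : ∀ X m S b T → (X + m) * (X * (X + suc m) * (S + b) + X * T) ≡
    suc (X + m) * (X * (X + m) * S) + X * ((X + m) * suc (X + m) * b) + X * (X + m) * T
  e₁ = solve-∀
  e₂ : ∀ X y Z T → suc y * Z + X * T + X * y * T ≡ suc y * (Z + X * T)
  e₂ = solve-∀
  e₃ : ∀ X m T → suc (X + m) * ((X + m) * T) ≡ (X + m) * ((X + suc m) * T)
  e₃ = solve-∀
  last : y * suc y * b m ≤ T
  last = ≤-trans (*-monoˡ-≤ (b m) (*-monoˡ-≤ (suc y) (n≤1+n y))) (h m ≤-refl)

square-tail-bound : ∀ X T (b : ℕ → ℕ) → 1 ≤ X → ∀ m →
  (∀ i → i < m → suc (X + i) * suc (X + i) * b i ≤ T) → X * Σ< m b ≤ T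
square-tail-bound X T b 1≤X m h = *-cancelˡ-≤ (X + m) {{>-nonZero (≤-trans 1≤X (m≤m+n X m))}} (begin
  (X + m) * (X * Σ< m b) ≡⟨ sym (*-assoc (X + m) X _) ⟩
  (X + m) * X * Σ< m b ≡⟨ cong (_* Σ< m b) (*-comm (X + m) X) ⟩
  X * (X + m) * Σ< m b ≤⟨ m≤m+n _ (X * T) ⟩
  X * (X + m) * Σ< m b + X * T ≤⟨ square-tail X T b 1≤X m h ⟩
  (X + m) * T ∎)
  where open ≤-Reasoning

-- Σ_{e ≥ 2} e⁻² ≤ 1/4 + 1/2.
three-quarters : ∀ T (b : ℕ → ℕ) m →
  (∀ i → i < m → suc (suc i) * suc (suc i) * b i ≤ T) → 4 * Σ< m b ≤ 3 * T
three-quarters T b zero h = z≤n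
three-quarters T b (suc m) h = begin
  4 * Σ< (suc m) b ≡⟨ cong (4 *_) (Σ<-sucˡ m b) ⟩
  4 * (b 0 + Σ< m (b ∘ suc)) ≡⟨ e (b 0) (Σ< m (b ∘ suc)) ⟩
  4 * b 0 + 2 * (2 * Σ< m (b ∘ suc))
    ≤⟨ +-mono-≤ (h 0 (s≤s z≤n)) (*-monoʳ-≤ 2 (square-tail-bound 2 T (b ∘ suc) (s≤s z≤n) m λ i i<m → h (suc i) (s≤s i<m))) ⟩
  T + 2 * T ∎
  where
  open ≤-Reasoning
  e : ∀ x y → 4 * (x + y) ≡ 4 * x + 2 * (2 * y)
  e = solve-∀

Σ/≤XL : ∀ X → Σ< X (λ i → X / suc i) ≤ X * L X
Σ/≤XL X = harmonic X (λ i → X / suc i) X λ i _ → subst (_≤ X) (*-comm (X / suc i) (suc i)) (m/n*n≤m X (suc i))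

-- Möbius sieve for approximately quadratic counts.

-- Y ranges over a whole interval because the sieve compares X / e with n * X / e, which need not be
-- a multiple of n but always lies in that interval.
Scales : ℕ → (ℕ → ℕ) → Set
Scales C A = ∀ n X Y → 1 ≤ n → n * X ≤ Y → Y < n * suc X →
  A Y ≤ n * n * A X + C * (n * n * suc X) × n * n * A X ≤ A Y + C * (n * n * suc X)

n*[X/e]≤[n*X]/e : ∀ n X e .{{_ : NonZero e}} → n * (X / e) ≤ n * X / e
n*[X/e]≤[n*X]/e n X e = subst (_≤ n * X / e) (m*n/n≡m (n * (X / e)) e)
  (/-monoˡ-≤ e (subst (_≤ n * X) (sym (*-assoc n (X / e) e)) (*-monoʳ-≤ n (m/n*n≤m X e))))

X<e*suc[X/e] : ∀ X e .{{_ : NonZero e}} → X < e * suc (X / e)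
X<e*suc[X/e] X e = begin-strict
  X ≡⟨ m≡m%n+[m/n]*n X e ⟩
  X % e + X / e * e <⟨ +-monoˡ-< (X / e * e) (m%n<n X e) ⟩
  e + X / e * e ≡⟨ *-comm (suc (X / e)) e ⟩
  e * suc (X / e) ∎
  where open ≤-Reasoning

[n*X]/e<n*suc[X/e] : ∀ n X e .{{_ : NonZero e}} → 1 ≤ n → n * X / e < n * suc (X / e)
[n*X]/e<n*suc[X/e] n X e 1≤n = m<n*o⇒m/o<n (begin-strict
  n * X <⟨ *-monoʳ-< n {{>-nonZero 1≤n}} (X<e*suc[X/e] X e) ⟩
  n * (e * suc (X / e)) ≡⟨ cong (n *_) (*-comm e (suc (X / e))) ⟩
  n * (suc (X / e) * e) ≡⟨ sym (*-assoc n (suc (X / e)) e) ⟩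
  n * suc (X / e) * e ∎)
  where open ≤-Reasoning

module Sieve (A : ℕ → ℕ) (C K : ℕ) (A-scales : Scales C A) (A≤ : ∀ X → A X ≤ K * (X * X)) where

  M : (ℕ → ℕ) → ℕ → ℕ
  M w X = Σ< X (λ i → w (suc i) * A (X / suc i))

  -- The part 2 C collects the scaling errors of the terms e ≤ X, where X / e + 1 ≤ 2 (X / e); the
  -- part K bounds the terms e > X.
  E : ℕ
  E = 2 * C + K

  x+1≤2x : ∀ {X i} → i < X → suc (X / suc i) ≤ 2 * (X / suc i)
  x+1≤2x {X} {i} i<X = subst (suc x ≤_) (cong (x +_) (sym (+-identityʳ x)))
    (+-monoˡ-≤ x (subst (_≤ x) (n/n≡1 (suc i)) (/-monoˡ-≤ (suc i) i<X)))
    where x = X / suc i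

  error-sum : ∀ n X → Σ< X (λ i → C * (n * n * (2 * (X / suc i)))) ≤ 2 * C * (n * n * (X * L X))
  error-sum n X = begin
    Σ< X (λ i → C * (n * n * (2 * (X / suc i)))) ≡⟨ Σ<-cong X (λ i _ → e₁ C n (X / suc i)) ⟩
    Σ< X (λ i → 2 * C * (n * n) * (X / suc i)) ≡⟨ Σ<-*ˡ X (2 * C * (n * n)) _ ⟩
    2 * C * (n * n) * Σ< X (λ i → X / suc i) ≤⟨ *-monoʳ-≤ (2 * C * (n * n)) (Σ/≤XL X) ⟩
    2 * C * (n * n) * (X * L X) ≡⟨ *-assoc (2 * C) (n * n) _ ⟩
    2 * C * (n * n * (X * L X)) ∎
    where
    open ≤-Reasoning
    e₁ : ∀ C n x → C * (n * n * (2 * x)) ≡ 2 * C * (n * n) * x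
    e₁ = solve-∀

  module _ (w : ℕ → ℕ) (w≤1 : ∀ e → w e ≤ 1) where

    w*≤ : ∀ e x → w e * x ≤ x
    w*≤ e x = subst (w e * x ≤_) (*-identityˡ x) (*-monoˡ-≤ x (w≤1 e))

    term-upper : ∀ n X i → 1 ≤ n → i < X →
      w (suc i) * A (n * X / suc i) ≤ n * n * (w (suc i) * A (X / suc i)) + C * (n * n * (2 * (X / suc i)))
    term-upper n X i 1≤n i<X = begin
      w′ * A (n * X / suc i)
        ≤⟨ *-monoʳ-≤ w′ (proj₁ (A-scales n x _ 1≤n (n*[X/e]≤[n*X]/e n X (suc i)) ([n*X]/e<n*suc[X/e] n X (suc i) 1≤n))) ⟩
      w′ * (n * n * A x + C * (n * n * suc x)) ≡⟨ *-distribˡ-+ w′ _ _ ⟩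
      w′ * (n * n * A x) + w′ * (C * (n * n * suc x))
        ≤⟨ +-mono-≤ (≤-reflexive (e w′ (n * n) (A x))) (≤-trans (w*≤ (suc i) _) (*-monoʳ-≤ C (*-monoʳ-≤ (n * n) (x+1≤2x i<X)))) ⟩
      n * n * (w′ * A x) + C * (n * n * (2 * x)) ∎
      where
      open ≤-Reasoning
      x = X / suc i
      w′ = w (suc i)
      e : ∀ a b c → a * (b * c) ≡ b * (a * c)
      e = solve-∀

    term-lower : ∀ n X i → 1 ≤ n → i < X →
      n * n * (w (suc i) * A (X / suc i)) ≤ w (suc i) * A (n * X / suc i) + C * (n * n * (2 * (X / suc i)))
    term-lower n X i 1≤n i<X = begin
      n * n * (w′ * A x) ≡⟨ e (n * n) w′ (A x) ⟩
      w′ * (n * n * A x)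
        ≤⟨ *-monoʳ-≤ w′ (proj₂ (A-scales n x _ 1≤n (n*[X/e]≤[n*X]/e n X (suc i)) ([n*X]/e<n*suc[X/e] n X (suc i) 1≤n))) ⟩
      w′ * (A (n * X / suc i) + C * (n * n * suc x)) ≡⟨ *-distribˡ-+ w′ _ _ ⟩
      w′ * A (n * X / suc i) + w′ * (C * (n * n * suc x))
        ≤⟨ +-monoʳ-≤ (w′ * A (n * X / suc i)) (≤-trans (w*≤ (suc i) _) (*-monoʳ-≤ C (*-monoʳ-≤ (n * n) (x+1≤2x i<X)))) ⟩
      w′ * A (n * X / suc i) + C * (n * n * (2 * x)) ∎
      where
      open ≤-Reasoning
      x = X / suc i
      w′ = w (suc i)
      e : ∀ a b c → a * (b * c) ≡ b * (a * c)
      e = solve-∀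

    -- These terms X < e ≤ n X occur only at scale n X. Each is at most K (n X / e)², and Σ_{e > X}
    -- e⁻² ≤ 1/X.
    M-tail : ∀ n X → 1 ≤ X → Σ< (n * X ∸ X) (λ i → w (suc (X + i)) * A (n * X / suc (X + i))) ≤ K * (n * n * X)
    M-tail n X 1≤X = *-cancelˡ-≤ X {{>-nonZero 1≤X}} (≤-trans
      (square-tail-bound X (K * (n * X * (n * X))) (λ i → w (suc (X + i)) * A (n * X / suc (X + i))) 1≤X (n * X ∸ X)
        λ i _ → term (suc (X + i)))
      (≤-reflexive (e₁ X K n)))
      where
      open ≤-Reasoning
      e₁ : ∀ X K n → K * (n * X * (n * X)) ≡ X * (K * (n * n * X))
      e₁ = solve-∀
      e₂ : ∀ e K x → e * e * (K * (x * x)) ≡ K * ((x * e) * (x * e))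
      e₂ = solve-∀
      term : ∀ e .{{_ : NonZero e}} → e * e * (w e * A (n * X / e)) ≤ K * (n * X * (n * X))
      term e = begin
        e * e * (w e * A (n * X / e)) ≤⟨ *-monoʳ-≤ (e * e) (≤-trans (w*≤ e _) (A≤ (n * X / e))) ⟩
        e * e * (K * (n * X / e * (n * X / e))) ≡⟨ e₂ e K (n * X / e) ⟩
        K * ((n * X / e * e) * (n * X / e * e))
          ≤⟨ *-monoʳ-≤ K (*-mono-≤ (m/n*n≤m (n * X) e) (m/n*n≤m (n * X) e)) ⟩
        K * (n * X * (n * X)) ∎

    M-upper : ∀ n X → 1 ≤ n → 1 ≤ X → M w (n * X) ≤ n * n * M w X + E * (n * n * (X * L X))
    M-upper n X 1≤n 1≤X = begin
      M w (n * X) ≡⟨ Σ<-split-≤ (m≤n*m X n {{>-nonZero 1≤n}}) _ ⟩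
      Σ< X (λ i → w (suc i) * A (n * X / suc i)) + Σ< (n * X ∸ X) (λ i → w (suc (X + i)) * A (n * X / suc (X + i)))
        ≤⟨ +-mono-≤ (Σ<-mono X λ i i<X → term-upper n X i 1≤n i<X) (M-tail n X 1≤X) ⟩
      Σ< X (λ i → n * n * (w (suc i) * A (X / suc i)) + C * (n * n * (2 * (X / suc i)))) + K * (n * n * X)
        ≡⟨ cong (_+ K * (n * n * X)) (Σ<-+ X _ _) ⟩
      Σ< X (λ i → n * n * (w (suc i) * A (X / suc i))) + Σ< X (λ i → C * (n * n * (2 * (X / suc i)))) + K * (n * n * X)
        ≤⟨ +-mono-≤ (+-mono-≤ (≤-reflexive (Σ<-*ˡ X (n * n) _)) (error-sum n X))
             (*-monoʳ-≤ K (*-monoʳ-≤ (n * n) (m≤m*n X (L X)))) ⟩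
      n * n * M w X + 2 * C * (n * n * (X * L X)) + K * (n * n * (X * L X))
        ≡⟨ e (n * n * M w X) (2 * C) K (n * n * (X * L X)) ⟩
      n * n * M w X + E * (n * n * (X * L X)) ∎
      where
      open ≤-Reasoning
      e : ∀ a b c x → a + b * x + c * x ≡ a + (b + c) * x
      e = solve-∀

    M-lower : ∀ n X → 1 ≤ n → n * n * M w X ≤ M w (n * X) + E * (n * n * (X * L X))
    M-lower n X 1≤n = begin
      n * n * M w X ≡⟨ sym (Σ<-*ˡ X (n * n) _) ⟩
      Σ< X (λ i → n * n * (w (suc i) * A (X / suc i))) ≤⟨ Σ<-mono X (λ i i<X → term-lower n X i 1≤n i<X) ⟩
      Σ< X (λ i → w (suc i) * A (n * X / suc i) + C * (n * n * (2 * (X / suc i)))) ≡⟨ Σ<-+ X _ _ ⟩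
      Σ< X (λ i → w (suc i) * A (n * X / suc i)) + Σ< X (λ i → C * (n * n * (2 * (X / suc i))))
        ≤⟨ +-mono-≤ (Σ<-mono-range (m≤n*m X n {{>-nonZero 1≤n}}) _) (error-sum n X) ⟩
      M w (n * X) + 2 * C * (n * n * (X * L X))
        ≤⟨ +-monoʳ-≤ (M w (n * X)) (*-monoˡ-≤ (n * n * (X * L X)) (m≤m+n (2 * C) K)) ⟩
      M w (n * X) + E * (n * n * (X * L X)) ∎
      where open ≤-Reasoning

  module _ (G : ℕ → ℕ) (w⁺ w⁻ : ℕ → ℕ) (w⁺≤1 : ∀ e → w⁺ e ≤ 1) (w⁻≤1 : ∀ e → w⁻ e ≤ 1)
    (w⁺1 : w⁺ 1 ≡ 1) (w⁻1 : w⁻ 1 ≡ 0) (inversion : ∀ X → G X + M w⁻ X ≡ M w⁺ X) where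

    private
      e₁ : ∀ n g m r → n * n * (g + m) + r ≡ n * n * g + n * n * m + r
      e₁ = solve-∀
      e₂ : ∀ a m r → a + (m + r) + r ≡ a + 2 * r + m
      e₂ = solve-∀

    -- G is the difference of the two sums `M`, so an upper bound uses the upper estimate for w⁺ and
    -- the lower one for w⁻. The two errors add up, whence the factor 2.
    G-upper : ∀ n X → 1 ≤ n → 1 ≤ X → G (n * X) ≤ n * n * G X + 2 * (E * (n * n * (X * L X)))
    G-upper n X 1≤n 1≤X = +-cancelʳ-≤ (M w⁻ (n * X)) _ _ (begin
      G (n * X) + M w⁻ (n * X) ≡⟨ inversion (n * X) ⟩
      M w⁺ (n * X) ≤⟨ M-upper w⁺ w⁺≤1 n X 1≤n 1≤X ⟩
      n * n * M w⁺ X + r ≡⟨ cong (λ z → n * n * z + r) (sym (inversion X)) ⟩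
      n * n * (G X + M w⁻ X) + r ≡⟨ e₁ n (G X) (M w⁻ X) r ⟩
      n * n * G X + n * n * M w⁻ X + r ≤⟨ +-monoˡ-≤ r (+-monoʳ-≤ (n * n * G X) (M-lower w⁻ w⁻≤1 n X 1≤n)) ⟩
      n * n * G X + (M w⁻ (n * X) + r) + r ≡⟨ e₂ (n * n * G X) (M w⁻ (n * X)) r ⟩
      n * n * G X + 2 * r + M w⁻ (n * X) ∎)
      where
      open ≤-Reasoning
      r = E * (n * n * (X * L X))

    G-lower : ∀ n X → 1 ≤ n → 1 ≤ X → n * n * G X ≤ G (n * X) + 2 * (E * (n * n * (X * L X)))
    G-lower n X 1≤n 1≤X = +-cancelʳ-≤ (n * n * M w⁻ X) _ _ (begin
      n * n * G X + n * n * M w⁻ X ≡⟨ sym (*-distribˡ-+ (n * n) (G X) (M w⁻ X)) ⟩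
      n * n * (G X + M w⁻ X) ≡⟨ cong (n * n *_) (inversion X) ⟩
      n * n * M w⁺ X ≤⟨ M-lower w⁺ w⁺≤1 n X 1≤n ⟩
      M w⁺ (n * X) + r ≡⟨ cong (_+ r) (sym (inversion (n * X))) ⟩
      G (n * X) + M w⁻ (n * X) + r ≤⟨ +-monoˡ-≤ r (+-monoʳ-≤ (G (n * X)) (M-upper w⁻ w⁻≤1 n X 1≤n 1≤X)) ⟩
      G (n * X) + (n * n * M w⁻ X + r) + r ≡⟨ e₂ (G (n * X)) (n * n * M w⁻ X) r ⟩
      G (n * X) + 2 * r + n * n * M w⁻ X ∎)
      where
      open ≤-Reasoning
      r = E * (n * n * (X * L X))

    -- Only the terms e ≥ 2 of the inversion formula can be negative.
    A≤4G : ∀ X → 1 ≤ X → A X ≤ 4 * G X + 8 * C * (X * L X)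
    A≤4G X@(suc X′) 1≤X = +-cancelʳ-≤ (3 * A X) _ _ (begin
      A X + 3 * A X ≤⟨ *-monoʳ-≤ 4 A≤M⁺ ⟩
      4 * M w⁺ X ≡⟨ cong (4 *_) (sym (inversion X)) ⟩
      4 * (G X + M w⁻ X) ≤⟨ *-monoʳ-≤ 4 (+-monoʳ-≤ (G X) M⁻≤) ⟩
      4 * (G X + (Σ< X′ b + 2 * C * (X * L X))) ≡⟨ f₁ (G X) (Σ< X′ b) C (X * L X) ⟩
      4 * Σ< X′ b + (4 * G X + 8 * C * (X * L X)) ≤⟨ +-monoˡ-≤ (4 * G X + 8 * C * (X * L X)) (three-quarters (A X) b X′ b-bound) ⟩
      3 * A X + (4 * G X + 8 * C * (X * L X)) ≡⟨ +-comm (3 * A X) _ ⟩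
      4 * G X + 8 * C * (X * L X) + 3 * A X ∎)
      where
      open ≤-Reasoning
      x : ℕ → ℕ
      x i = X / suc (suc i)
      -- Removing the scaling error by truncated subtraction makes e² times the term at most A X, as
      -- `three-quarters` requires. The removed amounts sum to O(X log X).
      b : ℕ → ℕ
      b i = A (x i) ∸ 2 * C * x i
      f₁ : ∀ g s c z → 4 * (g + (s + 2 * c * z)) ≡ 4 * s + (4 * g + 8 * c * z)
      f₁ = solve-∀
      f₂ : ∀ e c z → c * (e * e * (2 * z)) ≡ e * e * (2 * c * z)
      f₂ = solve-∀
      A≤M⁺ : A X ≤ M w⁺ X
      A≤M⁺ = begin
        A X ≡⟨ sym (trans (cong₂ _*_ w⁺1 (cong A (n/1≡n X))) (*-identityˡ (A X))) ⟩
        w⁺ 1 * A (X / 1) ≤⟨ Σ<-term X (λ i → w⁺ (suc i) * A (X / suc i)) 1≤X ⟩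
        M w⁺ X ∎
      b-bound : ∀ i → i < X′ → suc (suc i) * suc (suc i) * b i ≤ A X
      b-bound i i<X′ = begin
        e * e * b i ≡⟨ *-distribˡ-∸ (e * e) (A (x i)) (2 * C * x i) ⟩
        e * e * A (x i) ∸ e * e * (2 * C * x i) ≤⟨ m≤n+o⇒m∸n≤o _ _ (begin
          e * e * A (x i)
            ≤⟨ proj₂ (A-scales e (x i) X (s≤s z≤n) (subst (_≤ X) (*-comm (x i) e) (m/n*n≤m X e)) (X<e*suc[X/e] X e)) ⟩
          A X + C * (e * e * suc (x i)) ≤⟨ +-monoʳ-≤ (A X) (*-monoʳ-≤ C (*-monoʳ-≤ (e * e) (x+1≤2x (s≤s i<X′)))) ⟩
          A X + C * (e * e * (2 * x i)) ≡⟨ cong (A X +_) (f₂ e C (x i)) ⟩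
          A X + e * e * (2 * C * x i) ≡⟨ +-comm (A X) _ ⟩
          e * e * (2 * C * x i) + A X ∎) ⟩
        A X ∎
        where e = suc (suc i)
      M⁻≤ : M w⁻ X ≤ Σ< X′ b + 2 * C * (X * L X)
      M⁻≤ = begin
        M w⁻ X ≡⟨ Σ<-sucˡ X′ (λ i → w⁻ (suc i) * A (X / suc i)) ⟩
        w⁻ 1 * A (X / 1) + Σ< X′ (λ i → w⁻ (suc (suc i)) * A (x i)) ≡⟨ cong (λ z → z * A (X / 1) + Σ< X′ (λ i → w⁻ (suc (suc i)) * A (x i))) w⁻1 ⟩
        Σ< X′ (λ i → w⁻ (suc (suc i)) * A (x i))
          ≤⟨ Σ<-mono X′ (λ i _ → ≤-trans (w*≤ w⁻ w⁻≤1 (suc (suc i)) _)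
               (subst (A (x i) ≤_) (+-comm (2 * C * x i) (b i)) (m≤n+m∸n (A (x i)) (2 * C * x i)))) ⟩
        Σ< X′ (λ i → b i + 2 * C * x i) ≡⟨ Σ<-+ X′ b _ ⟩
        Σ< X′ b + Σ< X′ (λ i → 2 * C * x i) ≡⟨ cong (Σ< X′ b +_) (Σ<-*ˡ X′ (2 * C) x) ⟩
        Σ< X′ b + 2 * C * Σ< X′ x
          ≤⟨ +-monoʳ-≤ (Σ< X′ b) (*-monoʳ-≤ (2 * C) (≤-trans (≤-trans (m≤n+m (Σ< X′ x) (X / 1))
               (≤-reflexive (sym (Σ<-sucˡ X′ (λ i → X / suc i))))) (Σ/≤XL X))) ⟩
        Σ< X′ b + 2 * C * (X * L X) ∎

-- Dilating boxes of lattice points.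

-- The discarded terms are the index 0, which is no denominator, and the r indices above X.
Σ<-trim : ∀ X r c (f : ℕ → ℕ) → (∀ q → f q ≤ c) → Σ< (X + suc r) f ≤ Σ< X (f ∘ suc) + suc r * c
Σ<-trim X r c f f≤c = begin
  Σ< (X + suc r) f ≡⟨ cong (λ z → Σ< z f) (+-suc X r) ⟩
  Σ< (suc (X + r)) f ≡⟨ Σ<-sucˡ (X + r) f ⟩
  f 0 + Σ< (X + r) (f ∘ suc) ≡⟨ cong (f 0 +_) (Σ<-split X r (f ∘ suc)) ⟩
  f 0 + (Σ< X (f ∘ suc) + Σ< r (λ i → f (suc (X + i))))
    ≤⟨ +-mono-≤ (f≤c 0) (+-monoʳ-≤ (Σ< X (f ∘ suc)) (Σ<-bound r c λ i _ → f≤c (suc (X + i)))) ⟩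
  c + (Σ< X (f ∘ suc) + r * c) ≡⟨ e c (Σ< X (f ∘ suc)) (r * c) ⟩
  Σ< X (f ∘ suc) + suc r * c ∎
  where
  open ≤-Reasoning
  e : ∀ a b c → a + (b + c) ≡ b + (a + c)
  e = solve-∀

module _ (D n : ℕ) (f g : ℕ → ℕ) where

  private
    Σ<-cells : ∀ Z (h : ℕ → ℕ) → Σ< (Z * n * D) h ≡
      Σ< Z (λ m → Σ< n (λ α → Σ< D (λ ρ → h ((m * n + α) * D + ρ))))
    Σ<-cells Z h = trans (Σ<-blocks (Z * n) D h) (Σ<-blocks Z n _)

    Σ<-copies : ∀ Z (h : ℕ → ℕ) → Σ< Z (λ m → Σ< n (λ _ → h m)) ≡ n * Σ< Z h
    Σ<-copies Z h = trans (Σ<-cong Z λ m _ → Σ<-const n (h m)) (Σ<-*ˡ Z n h)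

  -- The index (m n + α) D + ρ is matched with (m + 1) D + ρ: the residue modulo D is kept, and n
  -- times the latter dominates the former. Each coarse cell is used n times, and raising m by one
  -- costs one extra cell on the right.
  cells-upper : (∀ m α ρ → α < n → ρ < D → f ((m * n + α) * D + ρ) ≤ g (suc m * D + ρ)) →
    ∀ Z → Σ< (Z * n * D) f ≤ n * Σ< (suc Z * D) g
  cells-upper f≤g Z = begin
    Σ< (Z * n * D) f ≡⟨ Σ<-cells Z f ⟩
    Σ< Z (λ m → Σ< n (λ α → Σ< D (λ ρ → f ((m * n + α) * D + ρ))))
      ≤⟨ Σ<-mono Z (λ m _ → Σ<-mono n λ α α<n → Σ<-mono D λ ρ ρ<D → f≤g m α ρ α<n ρ<D) ⟩
    Σ< Z (λ m → Σ< n (λ α → G (suc m))) ≡⟨ Σ<-copies Z (G ∘ suc) ⟩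
    n * Σ< Z (G ∘ suc) ≤⟨ *-monoʳ-≤ n (≤-trans (m≤n+m _ (G 0)) (≤-reflexive (sym (Σ<-sucˡ Z G)))) ⟩
    n * Σ< (suc Z) G ≡⟨ cong (n *_) (sym (Σ<-blocks (suc Z) D g)) ⟩
    n * Σ< (suc Z * D) g ∎
    where
    open ≤-Reasoning
    G : ℕ → ℕ
    G m = Σ< D (λ ρ → g (m * D + ρ))

  -- Mirror image of `cells-upper`: here the fine index is raised by one block so that it dominates
  -- n (m D + ρ).
  cells-lower : (∀ m α ρ → α < n → ρ < D → g (m * D + ρ) ≤ f ((suc m * n + α) * D + ρ)) →
    ∀ Z → n * Σ< (Z * D) g ≤ Σ< (suc Z * n * D) f
  cells-lower g≤f Z = begin
    n * Σ< (Z * D) g ≡⟨ cong (n *_) (Σ<-blocks Z D g) ⟩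
    n * Σ< Z (λ m → Σ< D (λ ρ → g (m * D + ρ))) ≡⟨ sym (Σ<-copies Z _) ⟩
    Σ< Z (λ m → Σ< n (λ _ → Σ< D (λ ρ → g (m * D + ρ))))
      ≤⟨ Σ<-mono Z (λ m _ → Σ<-mono n λ α α<n → Σ<-mono D λ ρ ρ<D → g≤f m α ρ α<n ρ<D) ⟩
    Σ< Z (F ∘ suc) ≤⟨ ≤-trans (m≤n+m _ (F 0)) (≤-reflexive (sym (Σ<-sucˡ Z F))) ⟩
    Σ< (suc Z) F ≡⟨ sym (Σ<-cells (suc Z) f) ⟩
    Σ< (suc Z * n * D) f ∎
    where
    open ≤-Reasoning
    F : ℕ → ℕ
    F m = Σ< n (λ α → Σ< D (λ ρ → f ((m * n + α) * D + ρ)))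

-- Cutting n times a box into n × n copies of it shifts each coordinate by less than n D,
-- so the weights can be compared without any estimate of the boundary of the region they define.
module Cells (D κ : ℕ) (T : ℕ → ℕ → ℕ → ℕ) (1≤D : 1 ≤ D) (T≤κ : ∀ X q q′ → T X q q′ ≤ κ)
  (shrink : ∀ n X Y x x′ y y′ ρ ρ′ → 1 ≤ n → n * X ≤ Y →
    x * D + ρ ≤ n * (y * D + ρ) → x′ * D + ρ′ ≤ n * (y′ * D + ρ′) →
    T Y (x * D + ρ) (x′ * D + ρ′) ≤ T X (y * D + ρ) (y′ * D + ρ′))
  (expand : ∀ n X Y x x′ y y′ ρ ρ′ → 1 ≤ n → Y < n * suc X →
    n * (y * D + ρ) ≤ x * D + ρ → n * (y′ * D + ρ′) ≤ x′ * D + ρ′ →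
    T X (y * D + ρ) (y′ * D + ρ′) ≤ T Y (x * D + ρ) (x′ * D + ρ′))
  where

  A : ℕ → ℕ
  A X = Σ< X (λ i → Σ< X (λ i′ → T X (suc i) (suc i′)))

  -- Unlike `A` it starts at 0 and its side is independent of X, so it can be cut into whole blocks
  -- of length D.
  box : ℕ → ℕ → ℕ
  box m X = Σ< m (λ q → Σ< m (λ q′ → T X q q′))

  A≤κX² : ∀ X → A X ≤ κ * (X * X)
  A≤κX² X = ≤-trans (Σ<-bound X (X * κ) λ i _ → Σ<-bound X κ λ i′ _ → T≤κ X (suc i) (suc i′))
    (≤-reflexive (e X κ))
    where
    e : ∀ x c → x * (x * c) ≡ c * (x * x)
    e = solve-∀

  A≤box : ∀ {m} X → X < m → A X ≤ box m X
  A≤box {m} X X<m = begin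
    A X ≤⟨ Σ<-mono X (λ i _ → drop-zero X (T X (suc i))) ⟩
    Σ< X (λ i → Σ< (suc X) (T X (suc i))) ≤⟨ drop-zero X (λ q → Σ< (suc X) (T X q)) ⟩
    Σ< (suc X) (λ q → Σ< (suc X) (T X q)) ≤⟨ Σ<-mono (suc X) (λ q _ → Σ<-mono-range X<m (T X q)) ⟩
    Σ< (suc X) (λ q → Σ< m (T X q)) ≤⟨ Σ<-mono-range X<m _ ⟩
    box m X ∎
    where
    open ≤-Reasoning
    drop-zero : ∀ X (f : ℕ → ℕ) → Σ< X (f ∘ suc) ≤ Σ< (suc X) f
    drop-zero X f = ≤-trans (m≤n+m _ (f 0)) (≤-reflexive (sym (Σ<-sucˡ X f)))

  box≤A : ∀ X r → box (X + suc r) X ≤ A X + 2 * κ * (suc r * (X + suc r))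
  box≤A X r = begin
    box m X ≤⟨ Σ<-trim X r (m * κ) _ (λ q → Σ<-bound m κ λ q′ _ → T≤κ X q q′) ⟩
    Σ< X (λ i → Σ< m (T X (suc i))) + suc r * (m * κ)
      ≤⟨ +-monoˡ-≤ (suc r * (m * κ)) (Σ<-mono X λ i _ → Σ<-trim X r κ (T X (suc i)) (T≤κ X (suc i))) ⟩
    Σ< X (λ i → Σ< X (T X (suc i) ∘ suc) + suc r * κ) + suc r * (m * κ)
      ≡⟨ cong (_+ suc r * (m * κ)) (trans (Σ<-+ X _ _) (cong (A X +_) (Σ<-const X (suc r * κ)))) ⟩
    A X + X * (suc r * κ) + suc r * (m * κ)
      ≤⟨ +-monoˡ-≤ (suc r * (m * κ)) (+-monoʳ-≤ (A X) (*-monoˡ-≤ (suc r * κ) (m≤m+n X (suc r)))) ⟩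
    A X + m * (suc r * κ) + suc r * (m * κ) ≡⟨ e (A X) m (suc r) κ ⟩
    A X + 2 * κ * (suc r * m) ∎
    where
    open ≤-Reasoning
    m = X + suc r
    e : ∀ a m r κ → a + m * (r * κ) + r * (m * κ) ≡ a + 2 * κ * (r * m)
    e = solve-∀

  box≤A′ : ∀ X r {m} → 1 ≤ r → m ≤ X + r → box m X ≤ A X + 2 * κ * (r * (X + r))
  box≤A′ X (suc r) {m} _ m≤ = ≤-trans
    (≤-trans (Σ<-mono m λ q _ → Σ<-mono-range m≤ (T X q)) (Σ<-mono-range m≤ _))
    (box≤A X r)

  -- The product of 2 κ (two boundary strips of weight at most κ), 2 D (their width) and 3 D (from X
  -- + 2 D ≤ 3 D (X + 1)).
  C : ℕ
  C = 12 * κ * (D * D)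

  private
    Z : ℕ → ℕ
    Z X = suc ((X / D) {{>-nonZero 1≤D}})

    X<ZD : ∀ X → X < Z X * D
    X<ZD X = subst (X <_) (*-comm D (Z X)) (X<e*suc[X/e] X D {{>-nonZero 1≤D}})

    1+ZD≤ : ∀ X → suc (Z X) * D ≤ X + 2 * D
    1+ZD≤ X = ≤-trans (≤-reflexive (e (X / D) D)) (+-monoˡ-≤ (2 * D) (m/n*n≤m X D))
      where
      instance _ = >-nonZero 1≤D
      e : ∀ x d → suc (suc x) * d ≡ x * d + 2 * d
      e = solve-∀

    1≤2D : 1 ≤ 2 * D
    1≤2D = ≤-trans 1≤D (m≤m+n D (D + 0))

  module _ (n X Y : ℕ) (1≤n : 1 ≤ n) (lo : n * X ≤ Y) (hi : Y < n * suc X) where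

    -- `cells-upper` is used once in each coordinate, and each use contributes one factor n.
    box-upper : ∀ Z → box (Z * n * D) Y ≤ n * (n * box (suc Z * D) X)
    box-upper Z = ≤-trans
      (cells-upper D n (λ q → Σ< (Z * n * D) (T Y q)) (λ q → n * Σ< (suc Z * D) (T X q))
        (λ m α ρ α<n ρ<D → cells-upper D n (T Y _) (T X _)
          (λ m′ α′ ρ′ α′<n ρ′<D → shrink n X Y (m * n + α) (m′ * n + α′) (suc m) (suc m′) ρ ρ′ 1≤n lo
            (fits m α ρ α<n) (fits m′ α′ ρ′ α′<n)) Z) Z)
      (*-monoʳ-≤ n (≤-reflexive (Σ<-*ˡ (suc Z * D) n _)))
      where
      open ≤-Reasoning
      e : ∀ m n D ρ → (m * n + n) * D + n * ρ ≡ n * (suc m * D + ρ)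
      e = solve-∀
      fits : ∀ m α ρ → α < n → (m * n + α) * D + ρ ≤ n * (suc m * D + ρ)
      fits m α ρ α<n = begin
        (m * n + α) * D + ρ ≤⟨ +-mono-≤ (*-monoˡ-≤ D (+-monoʳ-≤ (m * n) (<⇒≤ α<n))) (m≤n*m ρ n {{>-nonZero 1≤n}}) ⟩
        (m * n + n) * D + n * ρ ≡⟨ e m n D ρ ⟩
        n * (suc m * D + ρ) ∎

    box-lower : ∀ Z → n * (n * box (Z * D) X) ≤ box (suc Z * n * D) Y
    box-lower Z = ≤-trans
      (*-monoʳ-≤ n (≤-reflexive (sym (Σ<-*ˡ (Z * D) n _))))
      (cells-lower D n (λ q → Σ< (suc Z * n * D) (T Y q)) (λ q → n * Σ< (Z * D) (T X q))
        (λ m α ρ α<n ρ<D → cells-lower D n (T Y _) (T X _)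
          (λ m′ α′ ρ′ α′<n ρ′<D → expand n X Y (suc m * n + α) (suc m′ * n + α′) m m′ ρ ρ′ 1≤n hi
            (fits m α ρ ρ<D) (fits m′ α′ ρ′ ρ′<D)) Z) Z)
      where
      open ≤-Reasoning
      e : ∀ m n D → n * (m * D + D) ≡ suc m * n * D
      e = solve-∀
      fits : ∀ m α ρ → ρ < D → n * (m * D + ρ) ≤ (suc m * n + α) * D + ρ
      fits m α ρ ρ<D = begin
        n * (m * D + ρ) ≤⟨ *-monoʳ-≤ n (+-monoʳ-≤ (m * D) (<⇒≤ ρ<D)) ⟩
        n * (m * D + D) ≡⟨ e m n D ⟩
        suc m * n * D ≤⟨ *-monoˡ-≤ D (m≤m+n (suc m * n) α) ⟩
        (suc m * n + α) * D ≤⟨ m≤m+n _ ρ ⟩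
        (suc m * n + α) * D + ρ ∎

    A-upper : A Y ≤ n * n * A X + C * (n * n * suc X)
    A-upper = begin
      A Y ≤⟨ A≤box Y (<-≤-trans hi (≤-trans (*-monoʳ-≤ n (X<ZD X)) (≤-reflexive (e₁ n (Z X) D)))) ⟩
      box (Z X * n * D) Y ≤⟨ box-upper (Z X) ⟩
      n * (n * box (suc (Z X) * D) X) ≤⟨ *-monoʳ-≤ n (*-monoʳ-≤ n (box≤A′ X (2 * D) 1≤2D (1+ZD≤ X))) ⟩
      n * (n * (A X + 2 * κ * (2 * D * (X + 2 * D))))
        ≤⟨ *-monoʳ-≤ n (*-monoʳ-≤ n (+-monoʳ-≤ (A X) (*-monoʳ-≤ (2 * κ) (*-monoʳ-≤ (2 * D) X+2D≤)))) ⟩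
      n * (n * (A X + 2 * κ * (2 * D * (3 * D * suc X)))) ≡⟨ e₂ n (A X) κ D (suc X) ⟩
      n * n * A X + C * (n * n * suc X) ∎
      where
      open ≤-Reasoning
      e₁ : ∀ n z d → n * (z * d) ≡ z * n * d
      e₁ = solve-∀
      e₂ : ∀ n a κ D x → n * (n * (a + 2 * κ * (2 * D * (3 * D * x)))) ≡ n * n * a + 12 * κ * (D * D) * (n * n * x)
      e₂ = solve-∀
      e₃ : ∀ x d → d * x + 2 * d * x ≡ 3 * d * x
      e₃ = solve-∀
      X+2D≤ : X + 2 * D ≤ 3 * D * suc X
      X+2D≤ = begin
        X + 2 * D ≤⟨ +-mono-≤ (≤-trans (n≤1+n X) (m≤n*m (suc X) D {{>-nonZero 1≤D}})) (m≤m*n (2 * D) (suc X)) ⟩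
        D * suc X + 2 * D * suc X ≡⟨ e₃ (suc X) D ⟩
        3 * D * suc X ∎

    A-lower : n * n * A X ≤ A Y + C * (n * n * suc X)
    A-lower = begin
      n * n * A X ≡⟨ *-assoc n n (A X) ⟩
      n * (n * A X) ≤⟨ *-monoʳ-≤ n (*-monoʳ-≤ n (A≤box X (X<ZD X))) ⟩
      n * (n * box (Z X * D) X) ≤⟨ box-lower (Z X) ⟩
      -- At scale Y a cell has side n D, so the box overshoots Y by at most 2 D n.
      box (suc (Z X) * n * D) Y ≤⟨ box≤A′ Y (2 * D * n) (*-mono-≤ 1≤2D 1≤n) m≤ ⟩
      A Y + 2 * κ * (2 * D * n * (Y + 2 * D * n))
        ≤⟨ +-monoʳ-≤ (A Y) (*-monoʳ-≤ (2 * κ) (*-monoʳ-≤ (2 * D * n) Y+≤)) ⟩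
      A Y + 2 * κ * (2 * D * n * (3 * D * (n * suc X))) ≡⟨ e₃ (A Y) κ D n (suc X) ⟩
      A Y + C * (n * n * suc X) ∎
      where
      open ≤-Reasoning
      e₁ : ∀ z n d → z * n * d ≡ n * (z * d)
      e₁ = solve-∀
      e₂ : ∀ n x d → n * (x + 2 * d) ≡ n * x + 2 * d * n
      e₂ = solve-∀
      e₃ : ∀ a κ D n x → a + 2 * κ * (2 * D * n * (3 * D * (n * x))) ≡ a + 12 * κ * (D * D) * (n * n * x)
      e₃ = solve-∀
      e₄ : ∀ x d → d * x + 2 * d * x ≡ 3 * d * x
      e₄ = solve-∀
      m≤ : suc (Z X) * n * D ≤ Y + 2 * D * n
      m≤ = begin
        suc (Z X) * n * D ≡⟨ e₁ (suc (Z X)) n D ⟩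
        n * (suc (Z X) * D) ≤⟨ *-monoʳ-≤ n (1+ZD≤ X) ⟩
        n * (X + 2 * D) ≡⟨ e₂ n X D ⟩
        n * X + 2 * D * n ≤⟨ +-monoˡ-≤ (2 * D * n) lo ⟩
        Y + 2 * D * n ∎
      Y+≤ : Y + 2 * D * n ≤ 3 * D * (n * suc X)
      Y+≤ = begin
        Y + 2 * D * n ≤⟨ +-mono-≤ (≤-trans (<⇒≤ hi) (m≤n*m (n * suc X) D {{>-nonZero 1≤D}}))
                              (*-monoʳ-≤ (2 * D) (m≤m*n n (suc X))) ⟩
        D * (n * suc X) + 2 * D * (n * suc X) ≡⟨ e₄ (n * suc X) D ⟩
        3 * D * (n * suc X) ∎

  A-scales : Scales C A
  A-scales n X Y 1≤n lo hi = A-upper n X Y 1≤n lo hi , A-lower n X Y 1≤n lo hi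

-- Divisibility and coprimality under congruences.

gcd≡1-∣ : ∀ a b c → a ∣ b → gcd b c ≡ 1 → gcd a c ≡ 1
gcd≡1-∣ a b c a∣b eq = ∣1⇒≡1 (subst (gcd a c ∣_) eq
  (gcd-greatest (∣-trans (gcd[m,n]∣m a c) a∣b) (gcd[m,n]∣n a c)))

gcd≡1-* : ∀ a b c → gcd a c ≡ 1 → gcd b c ≡ 1 → gcd (a * b) c ≡ 1
gcd≡1-* a b c ac bc = ∣1⇒≡1 (subst (g ∣_) bc (gcd-greatest
  (coprime-divisor (gcd≡1⇒coprime (trans (gcd-comm g a) ga)) (gcd[m,n]∣m (a * b) c)) (gcd[m,n]∣n (a * b) c)))
  where
  g = gcd (a * b) c
  ga : gcd a g ≡ 1
  ga = trans (gcd-comm a g) (gcd≡1-∣ g c a (gcd[m,n]∣n (a * b) c) (trans (gcd-comm c a) ac))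

-- The congruence a ≡ b modulo c is given by adding multiples of c on both sides, which avoids
-- subtraction in ℕ.
∣-mod : ∀ {c a b} u v → a + c * u ≡ b + c * v → c ∣ a → c ∣ b
∣-mod {c} {a} {b} u v eq c∣a = ∣m+n∣m⇒∣n {m = c * v}
  (subst (c ∣_) (trans eq (+-comm b (c * v))) (∣m∣n⇒∣m+n c∣a (m∣m*n u))) (m∣m*n v)

gcd≡1-mod : ∀ c a b u v → a + c * u ≡ b + c * v → gcd a c ≡ 1 → gcd b c ≡ 1
gcd≡1-mod c a b u v eq ac = ∣1⇒≡1 (subst (g ∣_) ac (gcd-greatest
  (∣m+n∣m⇒∣n {m = c * u}
    (subst (g ∣_) (trans (sym eq) (+-comm a (c * u))) (∣m∣n⇒∣m+n (gcd[m,n]∣m b c) (∣-trans (gcd[m,n]∣n b c) (m∣m*n v))))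
    (∣-trans (gcd[m,n]∣n b c) (m∣m*n u)))
  (gcd[m,n]∣n b c)))
  where g = gcd b c

-- Good pairs of denominators and their sieve.

module Pairs (d k : ℕ) (2≤d : 2 ≤ d) (1≤k : 1 ≤ k) where

  instance
    k-nonZero : NonZero k
    k-nonZero = >-nonZero 1≤k
    d-nonZero : NonZero d
    d-nonZero = >-nonZero (≤-trans (s≤s z≤n) 2≤d)

  record Blocker (j X q q′ : ℕ) : Set where
    constructor blocker
    field
      s t n : ℕ
      1≤s : 1 ≤ s
      1≤t : 1 ≤ t
      inLattice : k ∣ s + t * (k ∸ suc j)
      k*n≡ : k * n ≡ s * q + t * q′
      n≤X : n ≤ X
      coprime : gcd n d ≡ 1

  -- The pairs u = (a , q), u′ = (a′ , q′) of determinant k correspond to the denominators q, q′ together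
  -- with the index 1 ≤ J = suc j ≤ k for which w = (u′ + J u) / k is integral; (u , w) is then a basis of ℤ².
  -- The integral vectors strictly between u and u′ are the (s u + t u′) / k with s, t ≥ 1 and
  -- s + t (k - J) ≡ 0 mod k, and a Blocker is one with denominator n.
  record Good (j X q q′ : ℕ) : Set where
    constructor good
    field
      q-coprime : gcd q d ≡ 1
      q′-coprime : gcd q′ d ≡ 1
      k∣ : k ∣ q′ + suc j * q
      j-coprime : gcd (suc j) k ≡ 1
      unblocked : ¬ Blocker j X q q′

  coprime⇒positive : ∀ q → gcd q d ≡ 1 → 1 ≤ q
  coprime⇒positive zero eq = contradiction (trans (sym (gcd-identityˡ d)) eq) λ d≡1 → <⇒≢ 2≤d (sym d≡1)
  coprime⇒positive (suc q) eq = s≤s z≤n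

  -- Positive q and q′ force s and t below k n ≤ k X, so the search is finite.
  blocker? : ∀ j X q q′ → 1 ≤ q → 1 ≤ q′ → Dec (Blocker j X q q′)
  blocker? j X q q′ 1≤q 1≤q′ = map′
    (λ { (s , _ , t , _ , n , n≤X , 1≤s , 1≤t , l , eq , c) → blocker s t n 1≤s 1≤t l eq (s≤s⁻¹ n≤X) c })
    (λ { (blocker s t n 1≤s 1≤t l eq n≤X c) →
      s , s≤s (≤-trans (≤-trans (m≤m*n s q {{>-nonZero 1≤q}}) (m≤m+n (s * q) (t * q′))) (bound eq n≤X)) ,
      t , s≤s (≤-trans (≤-trans (m≤m*n t q′ {{>-nonZero 1≤q′}}) (m≤n+m (t * q′) (s * q))) (bound eq n≤X)) ,
      n , s≤s n≤X , 1≤s , 1≤t , l , eq , c })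
    (anyUpTo? (λ s → anyUpTo? (λ t → anyUpTo? (λ n →
      1 ≤? s ×-dec 1 ≤? t ×-dec k ∣? s + t * (k ∸ suc j) ×-dec k * n ≟ s * q + t * q′ ×-dec gcd n d ≟ 1)
      (suc X)) (suc (k * X))) (suc (k * X)))
    where
    bound : ∀ {n z} → k * n ≡ z → n ≤ X → z ≤ k * X
    bound refl n≤X = *-monoʳ-≤ k n≤X

  abstract
    -- Coprimality is tested first: as d ≥ 2 it excludes the denominator 0, which the finite search
    -- for a blocker relies on.
    good? : ∀ j X q q′ → Dec (Good j X q q′)
    good? j X q q′ with gcd q d ≟ 1 | gcd q′ d ≟ 1
    ... | no ¬c | _ = no λ g → ¬c (Good.q-coprime g)
    ... | yes _ | no ¬c = no λ g → ¬c (Good.q′-coprime g)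
    ... | yes c | yes c′ = map′
      (λ { (k∣ , jc , ub) → good c c′ k∣ jc ub })
      (λ { (good _ _ k∣ jc ub) → k∣ , jc , ub })
      (k ∣? q′ + suc j * q ×-dec gcd (suc j) k ≟ 1 ×-dec
        ¬? (blocker? j X q q′ (coprime⇒positive q c) (coprime⇒positive q′ c′)))

  -- A common period for all conditions: the denominator n = (s q + t q′) / k is determined modulo d
  -- only by q and q′ modulo d k.
  D : ℕ
  D = d * k

  module _ (x x′ y y′ ρ ρ′ : ℕ) where

    private
      v = x * D + ρ
      v′ = x′ * D + ρ′
      u = y * D + ρ
      u′ = y′ * D + ρ′

    coprime-move : ∀ x y ρ → gcd (x * D + ρ) d ≡ 1 → gcd (y * D + ρ) d ≡ 1
    coprime-move x y ρ = gcd≡1-mod d (x * D + ρ) (y * D + ρ) (y * k) (x * k) (e x y ρ d k)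
      where
      e : ∀ x y ρ d k → x * (d * k) + ρ + d * (y * k) ≡ y * (d * k) + ρ + d * (x * k)
      e = solve-∀

    k∣-move : ∀ J → k ∣ v′ + J * v → k ∣ u′ + J * u
    k∣-move J = ∣-mod (d * y′ + J * (d * y)) (d * x′ + J * (d * x)) (e x x′ y y′ ρ ρ′ d k J)
      where
      e : ∀ x x′ y y′ ρ ρ′ d k J →
        x′ * (d * k) + ρ′ + J * (x * (d * k) + ρ) + k * (d * y′ + J * (d * y)) ≡
        y′ * (d * k) + ρ′ + J * (y * (d * k) + ρ) + k * (d * x′ + J * (d * x))
      e = solve-∀

    -- Shifting v and v′ by multiples of d k changes (s v + t v′) / k by a multiple of d, so
    -- integrality and coprimality to d both survive.
    value-move : ∀ s t n → k * n ≡ s * v + t * v′ → gcd n d ≡ 1 →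
      ∃ λ m → k * m ≡ s * u + t * u′ × gcd m d ≡ 1
    value-move s t n eq c with ∣-mod (d * (s * y + t * y′)) (d * (s * x + t * x′)) (e s t x x′ y y′ ρ ρ′ d k) (divides n (trans (sym eq) (*-comm k n)))
      where
      e : ∀ s t x x′ y y′ ρ ρ′ d k →
        s * (x * (d * k) + ρ) + t * (x′ * (d * k) + ρ′) + k * (d * (s * y + t * y′)) ≡
        s * (y * (d * k) + ρ) + t * (y′ * (d * k) + ρ′) + k * (d * (s * x + t * x′))
      e = solve-∀
    ... | divides m eq′ = m , trans (*-comm k m) (sym eq′) , gcd≡1-mod d n m (s * y + t * y′) (s * x + t * x′)
      (*-cancelˡ-≡ _ _ k (begin
        k * (n + d * (s * y + t * y′)) ≡⟨ *-distribˡ-+ k n _ ⟩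
        k * n + k * (d * (s * y + t * y′)) ≡⟨ cong (_+ k * (d * (s * y + t * y′))) eq ⟩
        s * v + t * v′ + k * (d * (s * y + t * y′)) ≡⟨ e s t x x′ y y′ ρ ρ′ d k ⟩
        s * u + t * u′ + k * (d * (s * x + t * x′)) ≡⟨ cong (_+ k * (d * (s * x + t * x′))) (trans eq′ (*-comm m k)) ⟩
        k * m + k * (d * (s * x + t * x′)) ≡⟨ sym (*-distribˡ-+ k m _) ⟩
        k * (m + d * (s * x + t * x′)) ∎)) c
      where
      open ≡-Reasoning
      e : ∀ s t x x′ y y′ ρ ρ′ d k →
        s * (x * (d * k) + ρ) + t * (x′ * (d * k) + ρ′) + k * (d * (s * y + t * y′)) ≡
        s * (y * (d * k) + ρ) + t * (y′ * (d * k) + ρ′) + k * (d * (s * x + t * x′))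
      e = solve-∀

  dilate : ∀ n s t a a′ → n * (s * a + t * a′) ≡ s * (n * a) + t * (n * a′)
  dilate = solve-∀

  -- A blocker of the coarse pair with denominator m ≤ X has a counterpart with the same s, t for
  -- the fine pair, whose denominator is at most n m ≤ n X ≤ Y.
  good-shrink : ∀ j n X Y x x′ y y′ ρ ρ′ → n * X ≤ Y →
    x * D + ρ ≤ n * (y * D + ρ) → x′ * D + ρ′ ≤ n * (y′ * D + ρ′) →
    Good j Y (x * D + ρ) (x′ * D + ρ′) → Good j X (y * D + ρ) (y′ * D + ρ′)
  good-shrink j n X Y x x′ y y′ ρ ρ′ nX≤Y v≤ v′≤ (good c c′ k∣ jc ub) = good
    (coprime-move x x′ y y′ ρ ρ′ x y ρ c) (coprime-move x x′ y y′ ρ ρ′ x′ y′ ρ′ c′)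
    (k∣-move x x′ y y′ ρ ρ′ (suc j) k∣) jc
    λ { (blocker s t m 1≤s 1≤t l eq m≤X cm) → case value-move y y′ x x′ ρ ρ′ s t m eq cm of λ { (m′ , eq′ , cm′) →
      ub (blocker s t m′ 1≤s 1≤t l eq′ (≤-trans (*-cancelˡ-≤ k (begin
        k * m′ ≡⟨ eq′ ⟩
        s * (x * D + ρ) + t * (x′ * D + ρ′) ≤⟨ +-mono-≤ (*-monoʳ-≤ s v≤) (*-monoʳ-≤ t v′≤) ⟩
        s * (n * (y * D + ρ)) + t * (n * (y′ * D + ρ′)) ≡⟨ sym (dilate n s t _ _) ⟩
        n * (s * (y * D + ρ) + t * (y′ * D + ρ′)) ≡⟨ cong (n *_) (sym eq) ⟩
        n * (k * m) ≤⟨ *-monoʳ-≤ n (*-monoʳ-≤ k m≤X) ⟩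
        n * (k * X) ≡⟨ swap-factor n k X ⟩
        k * (n * X) ∎)) nX≤Y) cm′) } }
    where
    open ≤-Reasoning
    swap-factor : ∀ a b c → a * (b * c) ≡ b * (a * c)
    swap-factor = solve-∀

  -- Conversely a blocker of the fine pair gives n m′ ≤ m ≤ Y < n (X + 1) for its coarse
  -- counterpart, hence m′ ≤ X.
  good-expand : ∀ j n X Y x x′ y y′ ρ ρ′ → Y < n * suc X →
    n * (y * D + ρ) ≤ x * D + ρ → n * (y′ * D + ρ′) ≤ x′ * D + ρ′ →
    Good j X (y * D + ρ) (y′ * D + ρ′) → Good j Y (x * D + ρ) (x′ * D + ρ′)
  good-expand j n X Y x x′ y y′ ρ ρ′ Y< ≤v ≤v′ (good c c′ k∣ jc ub) = good
    (coprime-move x x′ y y′ ρ ρ′ y x ρ c) (coprime-move x x′ y y′ ρ ρ′ y′ x′ ρ′ c′)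
    (k∣-move y y′ x x′ ρ ρ′ (suc j) k∣) jc
    λ { (blocker s t m 1≤s 1≤t l eq m≤Y cm) → case value-move x x′ y y′ ρ ρ′ s t m eq cm of λ { (m′ , eq′ , cm′) →
      ub (blocker s t m′ 1≤s 1≤t l eq′ (s≤s⁻¹ (*-cancelˡ-< n m′ (suc X) (≤-<-trans (*-cancelˡ-≤ k (begin
        k * (n * m′) ≡⟨ swap-factor k n m′ ⟩
        n * (k * m′) ≡⟨ cong (n *_) eq′ ⟩
        n * (s * (y * D + ρ) + t * (y′ * D + ρ′)) ≡⟨ dilate n s t _ _ ⟩
        s * (n * (y * D + ρ)) + t * (n * (y′ * D + ρ′)) ≤⟨ +-mono-≤ (*-monoʳ-≤ s ≤v) (*-monoʳ-≤ t ≤v′) ⟩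
        s * (x * D + ρ) + t * (x′ * D + ρ′) ≡⟨ sym eq ⟩
        k * m ≤⟨ *-monoʳ-≤ k m≤Y ⟩
        k * Y ∎)) Y<))) cm′) } }
    where
    open ≤-Reasoning
    swap-factor : ∀ a b c → a * (b * c) ≡ b * (a * c)
    swap-factor = solve-∀

  goodCount : ℕ → ℕ → ℕ → ℕ
  goodCount X q q′ = Σ< k (λ j → 𝟙 (good? j X q q′))

  goodCount≤k : ∀ X q q′ → goodCount X q q′ ≤ k
  goodCount≤k X q q′ = ≤-trans (Σ<-bound k 1 λ j _ → 𝟙≤1 (good? j X q q′)) (≤-reflexive (*-identityʳ k))

  open Cells D k goodCount (*-mono-≤ (≤-trans (s≤s z≤n) 2≤d) 1≤k) goodCount≤k
    (λ n X Y x x′ y y′ ρ ρ′ _ lo v≤ v′≤ → Σ<-mono k λ j _ →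
      𝟙-mono (good? j Y _ _) (good? j X _ _) (good-shrink j n X Y x x′ y y′ ρ ρ′ lo v≤ v′≤))
    (λ n X Y x x′ y y′ ρ ρ′ _ hi ≤v ≤v′ → Σ<-mono k λ j _ →
      𝟙-mono (good? j X _ _) (good? j Y _ _) (good-expand j n X Y x x′ y y′ ρ ρ′ hi ≤v ≤v′))
    public

  complement : ∀ {j} → j < k → k ∸ suc j + suc j ≡ k
  complement j<k = m∸n+n≡m j<k

  -- With J = suc j and J̄ = k ∸ J: s q + t q′ + t k q = (s + t J̄) q + t (q′ + J q).
  k∣combination : ∀ {j} → j < k → ∀ s t q q′ → k ∣ s + t * (k ∸ suc j) → k ∣ q′ + suc j * q → k ∣ s * q + t * q′
  k∣combination {j} j<k s t q q′ l k∣ = ∣-mod 0 (t * q) (trans (e s t (k ∸ suc j) (suc j) q q′ k)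
      (cong (λ z → s * q + t * q′ + z * (t * q)) (complement j<k)))
    (∣m∣n⇒∣m+n (∣m⇒∣m*n q l) (∣n⇒∣m*n t k∣))
    where
    e : ∀ s t J̄ J q q′ k → (s + t * J̄) * q + t * (q′ + J * q) + k * 0 ≡ s * q + t * q′ + (J̄ + J) * (t * q)
    e = solve-∀

  module _ {j} (j<k : j < k) (X e q q′ : ℕ) .{{_ : NonZero e}} where

    -- Multiplying the denominator of a blocker by e keeps it coprime to d, since e divides the
    -- denominator e q, which is.
    good-divide : Good j X (e * q) (e * q′) → k ∣ q′ + suc j * q → gcd e d ≡ 1 × Good j (X / e) q q′
    good-divide (good c c′ _ jc ub) k∣ = gcd≡1-∣ e (e * q) d (m∣m*n q) c ,
      good (gcd≡1-∣ q (e * q) d (n∣m*n e) c) (gcd≡1-∣ q′ (e * q′) d (n∣m*n e) c′) k∣ jc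
        λ { (blocker s t n 1≤s 1≤t l eq n≤ cn) → ub (blocker s t (e * n) 1≤s 1≤t l
          (trans (swap-factor k e n) (trans (cong (e *_) eq) (dilate e s t q q′)))
          (≤-trans (*-monoʳ-≤ e n≤) (subst (_≤ X) (*-comm (X / e) e) (m/n*n≤m X e)))
          (gcd≡1-* e n d (gcd≡1-∣ e (e * q) d (m∣m*n q) c) cn)) }
      where
      swap-factor : ∀ a b c → a * (b * c) ≡ b * (a * c)
      swap-factor = solve-∀

    -- The lattice condition on s and t gives k ∣ s q + t q′ already before scaling. So every
    -- blocking denominator for (e q , e q′) is e times one for (q , q′), and the bound X becomes X
    -- / e.
    good-multiply : gcd e d ≡ 1 → Good j (X / e) q q′ → Good j X (e * q) (e * q′)
    good-multiply ce (good c c′ k∣ jc ub) = good (gcd≡1-* e q d ce c) (gcd≡1-* e q′ d ce c′)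
      (subst (k ∣_) (scaled e q q′ (suc j)) (∣n⇒∣m*n e k∣)) jc
      λ { (blocker s t n 1≤s 1≤t l eq n≤ cn) → case k∣combination j<k s t q q′ l k∣ of λ { (divides m eq′) →
        case (*-cancelˡ-≡ n (e * m) k (trans eq (trans (sym (dilate e s t q q′)) (trans (cong (e *_) eq′) (rotate e m k))))) of λ { refl →
          ub (blocker s t m 1≤s 1≤t l (trans (*-comm k m) (sym eq′))
            (subst (_≤ X / e) (p*e/p e m) (/-monoˡ-≤ e n≤)) (gcd≡1-∣ m (e * m) d (n∣m*n e) cn)) } } }
      where
      scaled : ∀ e q q′ J → e * (q′ + J * q) ≡ e * q′ + J * (e * q)
      scaled = solve-∀
      rotate : ∀ e m k → e * (m * k) ≡ k * (e * m)
      rotate = solve-∀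

  -- The quotient is w₂, the denominator of w. Coprimality of q and w₂ is what allows numerators
  -- with det (u , w) = 1.
  Primitive : (j q q′ : ℕ) → Set
  Primitive j q q′ = gcd q ((q′ + suc j * q) / k) ≡ 1

  abstract
    primitive? : ∀ j q q′ → Dec (Primitive j q q′)
    primitive? j q q′ = gcd q ((q′ + suc j * q) / k) ≟ 1

  Σ³ : ℕ → (ℕ → ℕ → ℕ → ℕ) → ℕ
  Σ³ X f = Σ< X (λ i → Σ< X (λ i′ → Σ< k (λ j → f j (suc i) (suc i′))))

  G : ℕ → ℕ
  G X = Σ³ X (λ j q q′ → 𝟙 (good? j X q q′) * 𝟙 (primitive? j q q′))

  Σ³-cong : ∀ X {f g : ℕ → ℕ → ℕ → ℕ} →
    (∀ j q q′ → j < k → 1 ≤ q → q ≤ X → f j q q′ ≡ g j q q′) → Σ³ X f ≡ Σ³ X g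
  Σ³-cong X h = Σ<-cong X λ i i<X → Σ<-cong X λ i′ _ → Σ<-cong k λ j j<k → h j (suc i) (suc i′) j<k (s≤s z≤n) i<X

  Σ³-+ : ∀ X f g → Σ³ X (λ j q q′ → f j q q′ + g j q q′) ≡ Σ³ X f + Σ³ X g
  Σ³-+ X f g = trans
    (Σ<-cong X λ i _ → trans (Σ<-cong X λ i′ _ → Σ<-+ k _ _) (Σ<-+ X _ _)) (Σ<-+ X _ _)

  Σ³-*ˡ : ∀ X c f → Σ³ X (λ j q q′ → c * f j q q′) ≡ c * Σ³ X f
  Σ³-*ˡ X c f = trans
    (Σ<-cong X λ i _ → trans (Σ<-cong X λ i′ _ → Σ<-*ˡ k c _) (Σ<-*ˡ X c _)) (Σ<-*ˡ X c _)

  Σ³-swap : ∀ X m (f : ℕ → ℕ → ℕ → ℕ → ℕ) →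
    Σ³ X (λ j q q′ → Σ< m (λ e → f e j q q′)) ≡ Σ< m (λ e → Σ³ X (f e))
  Σ³-swap X m f = trans
    (Σ<-cong X λ i _ → trans (Σ<-cong X λ i′ _ → Σ<-swap k m _) (Σ<-swap X m _)) (Σ<-swap X m _)

  -- If e divides q and w₂, it divides q′ = k w₂ - J q too. The pair is then e times a smaller one
  -- with the same index j.
  multiples-count : ∀ X e .{{_ : NonZero e}} →
    Σ³ X (λ j q q′ → 𝟙 (good? j X q q′) * 𝟙 (e ∣? gcd q ((q′ + suc j * q) / k))) ≡ 𝟙 (gcd e d ≟ 1) * A (X / e)
  multiples-count X e = begin
    Σ³ X (λ j q q′ → 𝟙 (good? j X q q′) * 𝟙 (e ∣? gcd q ((q′ + suc j * q) / k)))
      ≡⟨ Σ³-cong X (λ j q q′ j<k _ _ → separate j q q′) ⟩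
    Σ³ X (λ j q q′ → 𝟙 (e ∣? q) * (𝟙 (e ∣? q′) * 𝟙 (χ? j q q′)))
      ≡⟨ Σ<-cong X (λ i _ → trans
           (Σ<-cong X λ i′ _ → trans (Σ<-*ˡ k (𝟙 (e ∣? suc i)) _) (cong (𝟙 (e ∣? suc i) *_) (Σ<-*ˡ k (𝟙 (e ∣? suc i′)) _)))
           (Σ<-*ˡ X (𝟙 (e ∣? suc i)) _)) ⟩
    Σ< X (λ i → 𝟙 (e ∣? suc i) * Σ< X (λ i′ → 𝟙 (e ∣? suc i′) * Σ< k (λ j → 𝟙 (χ? j (suc i) (suc i′)))))
      ≡⟨ Σ<-multiples X e (λ q → Σ< X (λ i′ → 𝟙 (e ∣? suc i′) * Σ< k (λ j → 𝟙 (χ? j q (suc i′))))) ⟩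
    Σ< (X / e) (λ i → Σ< X (λ i′ → 𝟙 (e ∣? suc i′) * Σ< k (λ j → 𝟙 (χ? j (e * suc i) (suc i′)))))
      ≡⟨ Σ<-cong (X / e) (λ i _ → Σ<-multiples X e (λ q′ → Σ< k (λ j → 𝟙 (χ? j (e * suc i) q′)))) ⟩
    Σ³ (X / e) (λ j q q′ → 𝟙 (χ? j (e * q) (e * q′)))
      ≡⟨ Σ³-cong (X / e) (λ j q q′ j<k _ _ → divided j q q′ j<k) ⟩
    Σ³ (X / e) (λ j q q′ → 𝟙 (gcd e d ≟ 1) * 𝟙 (good? j (X / e) q q′))
      ≡⟨ Σ³-*ˡ (X / e) (𝟙 (gcd e d ≟ 1)) (λ j q q′ → 𝟙 (good? j (X / e) q q′)) ⟩
    𝟙 (gcd e d ≟ 1) * A (X / e) ∎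
    where
    open ≡-Reasoning
    χ? : ∀ j q q′ → Dec (Good j X q q′ × e * k ∣ q′ + suc j * q)
    χ? j q q′ = good? j X q q′ ×-dec e * k ∣? q′ + suc j * q
    scaled : ∀ e q q′ J → e * (q′ + J * q) ≡ e * q′ + J * (e * q)
    scaled = solve-∀
    e∣q′ : ∀ {j q q′} → e ∣ q → e * k ∣ q′ + suc j * q → e ∣ q′
    e∣q′ {j} {q} {q′} e∣q ek∣ = ∣m+n∣m⇒∣n (subst (e ∣_) (+-comm q′ (suc j * q)) (m*n∣⇒m∣ e k ek∣)) (∣n⇒∣m*n (suc j) e∣q)
    separate : ∀ j q q′ → 𝟙 (good? j X q q′) * 𝟙 (e ∣? gcd q ((q′ + suc j * q) / k)) ≡
      𝟙 (e ∣? q) * (𝟙 (e ∣? q′) * 𝟙 (χ? j q q′))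
    separate j q q′ = begin
      𝟙 (good? j X q q′) * 𝟙 (e ∣? gcd q r) ≡⟨ sym (𝟙-× (good? j X q q′) (e ∣? gcd q r)) ⟩
      𝟙 (good? j X q q′ ×-dec e ∣? gcd q r)
        ≡⟨ 𝟙-cong (good? j X q q′ ×-dec e ∣? gcd q r) (e ∣? q ×-dec (e ∣? q′ ×-dec χ? j q q′))
             (λ { (g , e∣) → let e∣q = ∣-trans e∣ (gcd[m,n]∣m q r)
                                 ek∣ = m∣n/o⇒m*o∣n (Good.k∣ g) (∣-trans e∣ (gcd[m,n]∣n q r))
                             in e∣q , e∣q′ {j} e∣q ek∣ , g , ek∣ })
             (λ { (e∣q , _ , g , ek∣) → g , gcd-greatest e∣q (m*n∣o⇒m∣o/n e k ek∣) }) ⟩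
      𝟙 (e ∣? q ×-dec (e ∣? q′ ×-dec χ? j q q′)) ≡⟨ 𝟙-× (e ∣? q) (e ∣? q′ ×-dec χ? j q q′) ⟩
      𝟙 (e ∣? q) * 𝟙 (e ∣? q′ ×-dec χ? j q q′) ≡⟨ cong (𝟙 (e ∣? q) *_) (𝟙-× (e ∣? q′) (χ? j q q′)) ⟩
      𝟙 (e ∣? q) * (𝟙 (e ∣? q′) * 𝟙 (χ? j q q′)) ∎
      where r = (q′ + suc j * q) / k
    divided : ∀ j q q′ → j < k → 𝟙 (χ? j (e * q) (e * q′)) ≡ 𝟙 (gcd e d ≟ 1) * 𝟙 (good? j (X / e) q q′)
    divided j q q′ j<k = trans
      (𝟙-cong (χ? j (e * q) (e * q′)) (gcd e d ≟ 1 ×-dec good? j (X / e) q q′)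
        (λ { (g , ek∣) → good-divide j<k X e q q′ g
               (*-cancelˡ-∣ e (subst (e * k ∣_) (sym (scaled e q q′ (suc j))) ek∣)) })
        (λ { (ce , g) → good-multiply j<k X e q q′ ce g ,
               subst (e * k ∣_) (scaled e q q′ (suc j)) (*-monoʳ-∣ e (Good.k∣ g)) }))
      (𝟙-× (gcd e d ≟ 1) (good? j (X / e) q q′))

  open Sieve A C k A-scales A≤κX² public

  -- Good pairs have denominators coprime to d, so no other e can occur as a common divisor.
  restrict : (ℕ → ℕ) → ℕ → ℕ
  restrict w e = 𝟙 (gcd e d ≟ 1) * w e

  divisor-sum-count : ∀ (w : ℕ → ℕ) X →
    Σ³ X (λ j q q′ → 𝟙 (good? j X q q′) * Σ< X (λ i → 𝟙 (suc i ∣? gcd q ((q′ + suc j * q) / k)) * w (suc i))) ≡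
    M (restrict w) X
  divisor-sum-count w X = begin
    Σ³ X (λ j q q′ → 𝟙 (good? j X q q′) * Σ< X (λ i → δ i j q q′ * w (suc i)))
      ≡⟨ Σ³-cong X (λ j q q′ _ _ _ → trans (sym (Σ<-*ˡ X (𝟙 (good? j X q q′)) (λ i → δ i j q q′ * w (suc i)))) (Σ<-cong X λ i _ → e₁ (𝟙 (good? j X q q′)) (δ i j q q′) (w (suc i)))) ⟩
    Σ³ X (λ j q q′ → Σ< X (λ i → w (suc i) * (𝟙 (good? j X q q′) * δ i j q q′)))
      ≡⟨ Σ³-swap X X (λ i j q q′ → w (suc i) * (𝟙 (good? j X q q′) * δ i j q q′)) ⟩
    Σ< X (λ i → Σ³ X (λ j q q′ → w (suc i) * (𝟙 (good? j X q q′) * δ i j q q′)))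
      ≡⟨ Σ<-cong X (λ i _ → trans (Σ³-*ˡ X (w (suc i)) (λ j q q′ → 𝟙 (good? j X q q′) * δ i j q q′)) (trans (cong (w (suc i) *_) (multiples-count X (suc i)))
           (e₂ (w (suc i)) (𝟙 (gcd (suc i) d ≟ 1)) (A (X / suc i))))) ⟩
    M (restrict w) X ∎
    where
    open ≡-Reasoning
    δ : ℕ → ℕ → ℕ → ℕ → ℕ
    δ i j q q′ = 𝟙 (suc i ∣? gcd q ((q′ + suc j * q) / k))
    e₁ : ∀ a b c → a * (b * c) ≡ c * (a * b)
    e₁ = solve-∀
    e₂ : ∀ a b c → a * (b * c) ≡ b * a * c
    e₂ = solve-∀

  inversion : ∀ X → G X + M (restrict μ⁻) X ≡ M (restrict μ⁺) X
  inversion X = begin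
    G X + M (restrict μ⁻) X ≡⟨ cong (G X +_) (sym (divisor-sum-count μ⁻ X)) ⟩
    G X + Σ³ X (λ j q q′ → 𝟙 (good? j X q q′) * S μ⁻ j q q′) ≡⟨ sym (Σ³-+ X (λ j q q′ → 𝟙 (good? j X q q′) * 𝟙 (primitive? j q q′)) (λ j q q′ → 𝟙 (good? j X q q′) * S μ⁻ j q q′)) ⟩
    Σ³ X (λ j q q′ → 𝟙 (good? j X q q′) * 𝟙 (primitive? j q q′) + 𝟙 (good? j X q q′) * S μ⁻ j q q′)
      ≡⟨ Σ³-cong X (λ j q q′ _ 1≤q q≤X → trans (sym (*-distribˡ-+ (𝟙 (good? j X q q′)) (𝟙 (primitive? j q q′)) (S μ⁻ j q q′)))
           (cong (𝟙 (good? j X q q′) *_) (trans (+-comm (𝟙 (primitive? j q q′)) (S μ⁻ j q q′)) (sym (pointwise j q q′ 1≤q q≤X))))) ⟩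
    Σ³ X (λ j q q′ → 𝟙 (good? j X q q′) * S μ⁺ j q q′) ≡⟨ divisor-sum-count μ⁺ X ⟩
    M (restrict μ⁺) X ∎
    where
    open ≡-Reasoning
    S : (ℕ → ℕ) → ℕ → ℕ → ℕ → ℕ
    S w j q q′ = Σ< X (λ i → 𝟙 (suc i ∣? gcd q ((q′ + suc j * q) / k)) * w (suc i))
    -- The gcd is at most q ≤ X, so the sum over e ≤ X sees all its divisors.
    pointwise : ∀ j q q′ → 1 ≤ q → q ≤ X → S μ⁺ j q q′ ≡ S μ⁻ j q q′ + 𝟙 (primitive? j q q′)
    pointwise j q q′ 1≤q q≤X = trans
      (mobius-sum g X (n≢0⇒n>0 λ g≡0 → <⇒≢ 1≤q (sym (gcd[m,n]≡0⇒m≡0 g≡0)))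
        (≤-trans (∣⇒≤ {{>-nonZero 1≤q}} (gcd[m,n]∣m q r)) q≤X))
      (cong (S μ⁻ j q q′ +_) (𝟙-cong (g ≟ 1) (primitive? j q q′) id id))
      where
      r = (q′ + suc j * q) / k
      g = gcd q r

  restrict≤1 : ∀ (w : ℕ → ℕ) → (∀ e → w e ≤ 1) → ∀ e → restrict w e ≤ 1
  restrict≤1 w w≤1 e = *-mono-≤ (𝟙≤1 (gcd e d ≟ 1)) (w≤1 e)

  restrict-1 : ∀ (w : ℕ → ℕ) → restrict w 1 ≡ w 1
  restrict-1 w = trans (cong (_* w 1) (𝟙-yes (gcd 1 d ≟ 1) (∣1⇒≡1 (gcd[m,n]∣m 1 d)))) (*-identityˡ (w 1))

  private
    w⁺≤1 = restrict≤1 μ⁺ (λ e → proj₁ (mobiusAux≤1 e e))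
    w⁻≤1 = restrict≤1 μ⁻ (λ e → proj₂ (mobiusAux≤1 e e))

  G-scale-upper : ∀ n X → 1 ≤ n → 1 ≤ X → G (n * X) ≤ n * n * G X + 2 * (E * (n * n * (X * L X)))
  G-scale-upper = G-upper G (restrict μ⁺) (restrict μ⁻) w⁺≤1 w⁻≤1 (restrict-1 μ⁺) (restrict-1 μ⁻) inversion

  G-scale-lower : ∀ n X → 1 ≤ n → 1 ≤ X → n * n * G X ≤ G (n * X) + 2 * (E * (n * n * (X * L X)))
  G-scale-lower = G-lower G (restrict μ⁺) (restrict μ⁻) w⁺≤1 w⁻≤1 (restrict-1 μ⁺) (restrict-1 μ⁻) inversion

  A-bounded-by-G : ∀ X → 1 ≤ X → A X ≤ 4 * G X + 8 * C * (X * L X)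
  A-bounded-by-G = A≤4G G (restrict μ⁺) (restrict μ⁻) w⁺≤1 w⁻≤1 (restrict-1 μ⁺) (restrict-1 μ⁻) inversion

-- A quadratic lower bound for the number of good pairs.

module Abundance (d k : ℕ) (2≤d : 2 ≤ d) (1≤k : 1 ≤ k) where

  open Pairs d k 2≤d 1≤k

  -- At X = W h there are h² sample pairs, one for each choice of two block numbers between k h and
  -- k h + h.
  W : ℕ
  W = suc k * D

  private
    2≤D : 2 ≤ D
    2≤D = ≤-trans 2≤d (m≤m*n d k)

    D-2 : ℕ
    D-2 = D ∸ 2

    2+D-2 : 2 + D-2 ≡ D
    2+D-2 = m+[n∸m]≡n 2≤D

  -- q ≡ 1 and q′ ≡ -1 mod d k, so that d divides w₂ = (q + q′) / k and J = 1; every other lattice vector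
  -- between u and u′ dominates u + w or w + u′.
  module _ (h y y′ : ℕ) (y≥ : k * h ≤ y) (y′≥ : k * h ≤ y′) where

    private
      X = (k * h + h) * D
      q = suc (y * D)
      q′ = suc (y′ * D + D-2)
      r = d * (y + y′ + 1)

    q+q′≡k*r : q + q′ ≡ k * r
    q+q′≡k*r = trans (e y y′ D D-2) (trans (cong (y * D + y′ * D +_) 2+D-2) (e′ y y′ d k))
      where
      e : ∀ y y′ D z → suc (y * D) + suc (y′ * D + z) ≡ y * D + y′ * D + (2 + z)
      e = solve-∀
      e′ : ∀ y y′ d k → y * (d * k) + y′ * (d * k) + d * k ≡ k * (d * (y + y′ + 1))
      e′ = solve-∀

    -- As D = d k, the summand h D of X is covered by r ≥ d k h, and the summand k h D by z D.
    X<r+suc : ∀ {z} → k * h ≤ z → X < r + suc (z * D)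
    X<r+suc {z} z≥ = begin-strict
      (k * h + h) * D ≡⟨ e k h d ⟩
      d * (k * h) + k * h * D ≤⟨ +-mono-≤ (*-monoʳ-≤ d (≤-trans y≥ (≤-trans (m≤m+n y y′) (m≤m+n (y + y′) 1)))) (*-monoˡ-≤ D z≥) ⟩
      r + z * D <⟨ +-monoʳ-< r ≤-refl ⟩
      r + suc (z * D) ∎
      where
      open ≤-Reasoning
      e : ∀ k h d → (k * h + h) * (d * k) ≡ d * (k * h) + k * h * (d * k)
      e = solve-∀

    X<r+q : X < r + q
    X<r+q = X<r+suc y≥

    X<r+q′ : X < r + q′
    X<r+q′ = <-≤-trans (X<r+suc y′≥) (+-monoʳ-≤ r (s≤s (m≤m+n (y′ * D) D-2)))

    k-1 : ℕ
    k-1 = k ∸ 1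

    1+k-1 : suc k-1 ≡ k
    1+k-1 = m+[n∸m]≡n 1≤k

    dominates : ∀ s n δ p → 1 ≤ s → 1 ≤ δ → k ∣ δ → k * n ≡ s * (k * r) + δ * p → r + p ≤ n
    dominates s n .0 p 1≤s () (divides zero refl) eq
    dominates s n δ p 1≤s 1≤δ (divides c@(suc _) refl) eq = begin
      r + p ≤⟨ +-mono-≤ (m≤n*m r s {{>-nonZero 1≤s}}) (m≤n*m p c) ⟩
      s * r + c * p ≡⟨ sym (*-cancelˡ-≡ n (s * r + c * p) k (trans eq (e s k r c p))) ⟩
      n ∎
      where
      open ≤-Reasoning
      e : ∀ s k r c p → s * (k * r) + c * k * p ≡ k * (s * r + c * p)
      e = solve-∀

    unblocked : ¬ Blocker 0 X q q′
    unblocked (blocker s t n 1≤s 1≤t l eq n≤X cn) with <-cmp s t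
    -- For J = 1 the lattice condition reads s ≡ t modulo k. If s = t then n = s r, and d ∣ r
    -- contradicts coprimality; otherwise s and t differ by a positive multiple of k.
    ... | tri≈ _ refl _ = <⇒≢ 2≤d (sym (trans (sym (gcd≡d (divides (s * (y + y′ + 1)) (*-cancelˡ-≡ n _ k
          (trans eq (trans (sym (*-distribˡ-+ s q q′)) (trans (cong (s *_) q+q′≡k*r) (e s k d (y + y′ + 1))))))))) cn))
      where
      e : ∀ s k d z → s * (k * (d * z)) ≡ k * (s * z * d)
      e = solve-∀
      gcd≡d : d ∣ n → gcd n d ≡ d
      gcd≡d d∣n = ∣-antisym (gcd[m,n]∣n n d) (gcd-greatest d∣n ∣-refl)
    ... | tri< s<t _ _ = <⇒≱ X<r+q′ (≤-trans (dominates s n δ q′ 1≤s (m<n⇒0<n∸m s<t) k∣δ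
          (trans eq (trans (cong (λ z → s * q + z * q′) (sym s+δ≡t)) (trans (e₁ s δ q q′) (cong (λ z → s * z + δ * q′) q+q′≡k*r))))) n≤X)
      where
      δ = t ∸ s
      s+δ≡t : s + δ ≡ t
      s+δ≡t = m+[n∸m]≡n (<⇒≤ s<t)
      e₁ : ∀ s δ q q′ → s * q + (s + δ) * q′ ≡ s * (q + q′) + δ * q′
      e₁ = solve-∀
      e₂ : ∀ s δ z → s + (s + δ) * z + δ ≡ suc z * (s + δ)
      e₂ = solve-∀
      k∣δ : k ∣ δ
      k∣δ = ∣m+n∣m⇒∣n (subst (k ∣_) (sym (trans (cong (λ z → s + z * k-1 + δ) (sym s+δ≡t)) (trans (e₂ s δ k-1) (cong (_* (s + δ)) 1+k-1))))
        (m∣m*n (s + δ))) l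
    ... | tri> _ _ t<s = <⇒≱ X<r+q (≤-trans (dominates t n δ q 1≤t (m<n⇒0<n∸m t<s) k∣δ
          (trans eq (trans (cong (λ z → z * q + t * q′) (sym t+δ≡s)) (trans (e₁ t δ q q′) (cong (λ z → t * z + δ * q) q+q′≡k*r))))) n≤X)
      where
      δ = s ∸ t
      t+δ≡s : t + δ ≡ s
      t+δ≡s = m+[n∸m]≡n (<⇒≤ t<s)
      e₁ : ∀ t δ q q′ → (t + δ) * q + t * q′ ≡ t * (q + q′) + δ * q
      e₁ = solve-∀
      e₂ : ∀ t δ z → (t + δ) + t * z ≡ suc z * t + δ
      e₂ = solve-∀
      k∣δ : k ∣ δ
      k∣δ = ∣m+n∣m⇒∣n (subst (k ∣_) (trans (cong (λ z → z + t * k-1) (sym t+δ≡s)) (trans (e₂ t δ k-1) (cong (λ z → z * t + δ) 1+k-1))) l)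
        (m∣m*n t)

    good-sample : Good 0 X q q′
    good-sample = good
      (gcd≡1-mod d 1 q (y * k) 0 (e₁ y d k) (∣1⇒≡1 (gcd[m,n]∣m 1 d)))
      (∣1⇒≡1 (∣m+n∣m⇒∣n (subst (gcd q′ d ∣_) (sym (trans (e₂ (y′ * D) D-2) (cong (y′ * D +_) 2+D-2)))
        (∣m∣n⇒∣m+n (∣n⇒∣m*n y′ g∣D) g∣D)) (gcd[m,n]∣m q′ d)))
      (subst (k ∣_) (sym (trans (cong (q′ +_) (*-identityˡ q)) (trans (+-comm q′ q) q+q′≡k*r))) (m∣m*n r))
      (∣1⇒≡1 (gcd[m,n]∣m 1 k))
      unblocked
      where
      g∣D : gcd q′ d ∣ D
      g∣D = ∣m⇒∣m*n k (gcd[m,n]∣n q′ d)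
      e₁ : ∀ y d k → 1 + d * (y * k) ≡ suc (y * (d * k)) + d * 0
      e₁ = solve-∀
      e₂ : ∀ a b → suc (a + b) + 1 ≡ a + (2 + b)
      e₂ = solve-∀

  sample : ∀ h (f : ℕ → ℕ) ρ → ρ < D → Σ< h (λ m → f ((k * h + m) * D + ρ)) ≤ Σ< ((k * h + h) * D) f
  sample h f ρ ρ<D = begin
    Σ< h (λ m → f ((k * h + m) * D + ρ)) ≤⟨ m≤n+m _ (Σ< (k * h) (λ m → f (m * D + ρ))) ⟩
    Σ< (k * h) (λ m → f (m * D + ρ)) + Σ< h (λ m → f ((k * h + m) * D + ρ))
      ≡⟨ sym (Σ<-split (k * h) h (λ m → f (m * D + ρ))) ⟩
    Σ< (k * h + h) (λ m → f (m * D + ρ)) ≤⟨ Σ<-mono (k * h + h) (λ m _ → Σ<-term D (λ ρ → f (m * D + ρ)) ρ<D) ⟩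
    Σ< (k * h + h) (λ m → Σ< D (λ ρ → f (m * D + ρ))) ≡⟨ sym (Σ<-blocks (k * h + h) D f) ⟩
    Σ< ((k * h + h) * D) f ∎
    where open ≤-Reasoning

  h²≤A : ∀ h → h * h ≤ A (W * h)
  h²≤A h = subst (λ z → h * h ≤ A z) (e k h D) (begin
    h * h ≡⟨ sym (trans (Σ<-cong h λ _ _ → trans (Σ<-const h 1) (*-identityʳ h)) (Σ<-const h h)) ⟩
    Σ< h (λ _ → Σ< h (λ _ → 1)) ≤⟨ Σ<-mono h (λ m _ → Σ<-mono h λ m′ _ → term m m′) ⟩
    Σ< h (λ m → Σ< h (λ m′ → t (p m 0) (p m′ D-2)))
      ≤⟨ Σ<-mono h (λ m _ → sample h (t (p m 0)) D-2 (subst (D-2 <_) 2+D-2 (n≤1+n (suc D-2)))) ⟩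
    Σ< h (λ m → Σ< X (t (p m 0))) ≤⟨ sample h (λ i → Σ< X (t i)) 0 (≤-trans (s≤s z≤n) 2≤D) ⟩
    A X ∎)
    where
    open ≤-Reasoning
    X = (k * h + h) * D
    t : ℕ → ℕ → ℕ
    t i i′ = goodCount X (suc i) (suc i′)
    -- The summation index is the denominator minus 1, so denominators ≡ 1 and ≡ -1 modulo D sit at
    -- the residues 0 and D - 2.
    p : ℕ → ℕ → ℕ
    p m ρ = (k * h + m) * D + ρ
    e : ∀ k h D → (k * h + h) * D ≡ suc k * D * h
    e = solve-∀
    term : ∀ m m′ → 1 ≤ t (p m 0) (p m′ D-2)
    term m m′ = begin
      1 ≡⟨ sym (𝟙-yes (good? 0 X _ _) (subst (λ z → Good 0 X (suc z) (suc (p m′ D-2))) (sym (+-identityʳ ((k * h + m) * D)))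
             (good-sample h (k * h + m) (k * h + m′) (m≤m+n (k * h) m) (m≤m+n (k * h) m′)))) ⟩
      𝟙 (good? 0 X (suc (p m 0)) (suc (p m′ D-2))) ≤⟨ Σ<-term k (λ j → 𝟙 (good? j X (suc (p m 0)) (suc (p m′ D-2)))) 1≤k ⟩
      t (p m 0) (p m′ D-2) ∎

-- Neighbouring fractions versus good primitive pairs.

∣-between : ∀ q {x y} z → 1 ≤ x → x ≤ y → y ≤ q → q ∣ y ∸ x + z → q ∣ z → y ≡ x
∣-between q {x} {y} z 1≤x x≤y y≤q q∣ q∣z with y ∸ x in eq
... | zero = ≤-antisym (m∸n≡0⇒m≤n eq) x≤y
... | suc δ = contradiction (∣m+n∣m⇒∣n (subst (q ∣_) (+-comm (suc δ) z) q∣) q∣z)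
  (>⇒∤ (subst (_< q) eq (<-≤-trans (∸-monoʳ-< 1≤x x≤y) y≤q)))

module Correspondence (d k : ℕ) (2≤d : 2 ≤ d) (1≤k : 1 ≤ k) where

  open Pairs d k 2≤d 1≤k

  -- The bounds on a, q, a′ and q′ themselves are left to the ranges of summation.
  record Neighbours (Q a q a′ q′ : ℕ) : Set where
    constructor neighbours
    field
      q-coprime : gcd q d ≡ 1
      a-reduced : gcd a q ≡ 1
      q′-coprime : gcd q′ d ≡ 1
      a′-reduced : gcd a′ q′ ≡ 1
      det : q * a′ ≡ a * q′ + k
      nothing-between : ∀ m n → 1 ≤ m → m ≤ n → n ≤ Q → gcd n d ≡ 1 → gcd m n ≡ 1 → a * n < m * q → ¬ m * q′ < a′ * n

  module _ {a q a′ q′ : ℕ} (det : q * a′ ≡ a * q′ + k) where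

    private
      κ = k ∸ 1
      1+κ : suc κ ≡ k
      1+κ = m+[n∸m]≡n 1≤k
      +κ : ∀ z → z + κ * z ≡ k * z
      +κ z = cong (_* z) 1+κ

    -- A Bézout relation α a + β q = 1 makes J ≡ - (α a′ + β q′) mod k work.
    index-mod-k : gcd a q ≡ 1 → ∃ λ J → k ∣ a′ + J * a × k ∣ q′ + J * q
    index-mod-k coprime with coprime-Bézout (gcd≡1⇒coprime coprime)
    ... | Bézout.Identity.+- x y eq = y * q′ + κ * (x * a′) ,
          ∣m+n∣m⇒∣n (divides (x * a * a′) (begin
            y * k + (a′ + (y * q′ + κ * (x * a′)) * a) ≡⟨ e₁ y k a a′ q′ κ x ⟩
            y * (a * q′ + k) + a′ + κ * (x * a * a′) ≡⟨ cong (λ z → y * z + a′ + κ * (x * a * a′)) (sym det) ⟩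
            y * (q * a′) + a′ + κ * (x * a * a′) ≡⟨ e₂ y q a′ (κ * (x * a * a′)) ⟩
            (1 + y * q) * a′ + κ * (x * a * a′) ≡⟨ cong (λ z → z * a′ + κ * (x * a * a′)) eq ⟩
            x * a * a′ + κ * (x * a * a′) ≡⟨ trans (+κ (x * a * a′)) (*-comm k _) ⟩
            x * a * a′ * k ∎)) (n∣m*n y) ,
          ∣m+n∣m⇒∣n (divides (x * (q * a′)) (begin
            x * k + (q′ + (y * q′ + κ * (x * a′)) * q) ≡⟨ e₃ x k q′ y κ a′ q ⟩
            x * k + (1 + y * q) * q′ + κ * (x * (q * a′)) ≡⟨ cong (λ z → x * k + z * q′ + κ * (x * (q * a′))) eq ⟩
            x * k + x * a * q′ + κ * (x * (q * a′)) ≡⟨ e₄ x k a q′ (κ * (x * (q * a′))) ⟩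
            x * (a * q′ + k) + κ * (x * (q * a′)) ≡⟨ cong (λ z → x * z + κ * (x * (q * a′))) (sym det) ⟩
            x * (q * a′) + κ * (x * (q * a′)) ≡⟨ trans (+κ (x * (q * a′))) (*-comm k _) ⟩
            x * (q * a′) * k ∎)) (n∣m*n x)
      where
      open ≡-Reasoning
      e₁ : ∀ y k a a′ q′ κ x → y * k + (a′ + (y * q′ + κ * (x * a′)) * a) ≡ y * (a * q′ + k) + a′ + κ * (x * a * a′)
      e₁ = solve-∀
      e₂ : ∀ y q a′ z → y * (q * a′) + a′ + z ≡ (1 + y * q) * a′ + z
      e₂ = solve-∀
      e₃ : ∀ x k q′ y κ a′ q → x * k + (q′ + (y * q′ + κ * (x * a′)) * q) ≡ x * k + (1 + y * q) * q′ + κ * (x * (q * a′))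
      e₃ = solve-∀
      e₄ : ∀ x k a q′ z → x * k + x * a * q′ + z ≡ x * (a * q′ + k) + z
      e₄ = solve-∀
    ... | Bézout.Identity.-+ x y eq = x * a′ + κ * (y * q′) ,
          divides (y * (a * q′) + y) (begin
            a′ + (x * a′ + κ * (y * q′)) * a ≡⟨ e₁ a′ x a κ y q′ ⟩
            (1 + x * a) * a′ + κ * (y * (a * q′)) ≡⟨ cong (λ z → z * a′ + κ * (y * (a * q′))) eq ⟩
            y * q * a′ + κ * (y * (a * q′)) ≡⟨ cong (_+ κ * (y * (a * q′))) (trans (*-assoc y q a′) (cong (y *_) det)) ⟩
            y * (a * q′ + k) + κ * (y * (a * q′)) ≡⟨ e₂ y (a * q′) k κ ⟩
            (y * (a * q′) + κ * (y * (a * q′))) + y * k ≡⟨ cong (_+ y * k) (trans (+κ (y * (a * q′))) (*-comm k _)) ⟩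
            y * (a * q′) * k + y * k ≡⟨ sym (*-distribʳ-+ k (y * (a * q′)) y) ⟩
            (y * (a * q′) + y) * k ∎) ,
          divides (y * (q * q′) + x) (begin
            q′ + (x * a′ + κ * (y * q′)) * q ≡⟨ e₃ q′ x a′ κ y q ⟩
            q′ + x * (q * a′) + κ * (y * (q * q′)) ≡⟨ cong (λ z → q′ + x * z + κ * (y * (q * q′))) det ⟩
            q′ + x * (a * q′ + k) + κ * (y * (q * q′)) ≡⟨ e₄ q′ x a k (κ * (y * (q * q′))) ⟩
            (1 + x * a) * q′ + κ * (y * (q * q′)) + x * k ≡⟨ cong (λ z → z * q′ + κ * (y * (q * q′)) + x * k) eq ⟩
            y * q * q′ + κ * (y * (q * q′)) + x * k ≡⟨ cong (λ z → z + κ * (y * (q * q′)) + x * k) (*-assoc y q q′) ⟩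
            y * (q * q′) + κ * (y * (q * q′)) + x * k ≡⟨ cong (_+ x * k) (trans (+κ (y * (q * q′))) (*-comm k _)) ⟩
            y * (q * q′) * k + x * k ≡⟨ sym (*-distribʳ-+ k (y * (q * q′)) x) ⟩
            (y * (q * q′) + x) * k ∎)
      where
      open ≡-Reasoning
      e₁ : ∀ a′ x a κ y q′ → a′ + (x * a′ + κ * (y * q′)) * a ≡ (1 + x * a) * a′ + κ * (y * (a * q′))
      e₁ = solve-∀
      e₂ : ∀ y z k κ → y * (z + k) + κ * (y * z) ≡ (y * z + κ * (y * z)) + y * k
      e₂ = solve-∀
      e₃ : ∀ q′ x a′ κ y q → q′ + (x * a′ + κ * (y * q′)) * q ≡ q′ + x * (q * a′) + κ * (y * (q * q′))
      e₃ = solve-∀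
      e₄ : ∀ q′ x a k z → q′ + x * (a * q′ + k) + z ≡ (1 + x * a) * q′ + z + x * k
      e₄ = solve-∀

    index-exists : gcd a q ≡ 1 → ∃ λ j → j < k × k ∣ a′ + suc j * a × k ∣ q′ + suc j * q
    index-exists coprime with index-mod-k coprime
    ... | J , ka , kq = j , m%n<n (J + κ) k , reduce a′ a ka , reduce q′ q kq
      where
      -- Adding κ = k - 1 before reducing gives suc j ≡ J modulo k with 1 ≤ suc j ≤ k.
      j = (J + κ) % k
      t = (J + κ) / k
      J+k : J + k ≡ suc j + k * t
      J+k = trans (cong (J +_) (sym 1+κ)) (trans (+-suc J κ) (cong suc (trans (m≡m%n+[m/n]*n (J + κ) k) (cong (j +_) (*-comm t k)))))
      reduce : ∀ x′ x → k ∣ x′ + J * x → k ∣ x′ + suc j * x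
      reduce x′ x = ∣-mod x (t * x) (trans (e₁ x′ J x k) (trans (cong (λ z → x′ + z * x) J+k) (e₂ x′ (suc j) x k t)))
        where
        e₁ : ∀ x′ J x k → x′ + J * x + k * x ≡ x′ + (J + k) * x
        e₁ = solve-∀
        e₂ : ∀ x′ J x k t → x′ + (J + k * t) * x ≡ x′ + J * x + k * (t * x)
        e₂ = solve-∀

    -- The difference j - i is annihilated modulo k by both a and q, which are coprime, so k divides
    -- it; yet it is less than k.
    index-unique-≤ : gcd a q ≡ 1 → ∀ {i j} → i ≤ j → j < k → k ∣ a′ + suc i * a → k ∣ q′ + suc i * q →
      k ∣ a′ + suc j * a → k ∣ q′ + suc j * q → i ≡ j
    index-unique-≤ coprime {i} {j} i≤j j<k kai kqi kaj kqj =
      sym (suc-injective (∣-between k 0 (s≤s z≤n) (s≤s i≤j) j<k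
        (subst (k ∣_) (sym (+-identityʳ (j ∸ i))) (coprime-factors {m = a} {n = q} (gcd≡1⇒coprime {m = a} {n = q} coprime) (step a′ a kai kaj , step q′ q kqi kqj)))
        (k ∣0)))
      where
      step : ∀ x′ x → k ∣ x′ + suc i * x → k ∣ x′ + suc j * x → k ∣ x * (j ∸ i)
      step x′ x ki kj = ∣m+n∣m⇒∣n (subst (k ∣_) (trans (cong (λ z → x′ + suc z * x) (sym (m+[n∸m]≡n i≤j))) (e x′ i (j ∸ i) x)) kj) ki
        where
        e : ∀ x′ i δ x → x′ + suc (i + δ) * x ≡ x′ + suc i * x + x * δ
        e = solve-∀

    index-unique : gcd a q ≡ 1 → ∀ {i j} → i < k → j < k → k ∣ a′ + suc i * a → k ∣ q′ + suc i * q →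
      k ∣ a′ + suc j * a → k ∣ q′ + suc j * q → i ≡ j
    index-unique coprime {i} {j} i<k j<k kai kqi kaj kqj with ≤-total i j
    ... | inj₁ i≤j = index-unique-≤ coprime i≤j j<k kai kqi kaj kqj
    ... | inj₂ j≤i = sym (index-unique-≤ coprime j≤i i<k kaj kqj kai kqi)

    -- det (u , u′ + J u) = det (u , u′) = k, and w = (b , r) is the second vector divided by k.
    basis-det : ∀ J b r → a′ + J * a ≡ b * k → q′ + J * q ≡ r * k → q * b ≡ a * r + 1
    basis-det J b r eqb eqr = *-cancelˡ-≡ (q * b) (a * r + 1) k (begin
      k * (q * b) ≡⟨ e₁ k q b ⟩
      q * (b * k) ≡⟨ cong (q *_) (sym eqb) ⟩
      q * (a′ + J * a) ≡⟨ *-distribˡ-+ q a′ (J * a) ⟩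
      q * a′ + q * (J * a) ≡⟨ cong (_+ q * (J * a)) det ⟩
      a * q′ + k + q * (J * a) ≡⟨ e₂ a q′ k q J ⟩
      a * (q′ + J * q) + k ≡⟨ cong (λ z → a * z + k) eqr ⟩
      a * (r * k) + k ≡⟨ e₃ a r k ⟩
      k * (a * r + 1) ∎)
      where
      open ≡-Reasoning
      e₁ : ∀ k q b → k * (q * b) ≡ q * (b * k)
      e₁ = solve-∀
      e₂ : ∀ a q′ k q J → a * q′ + k + q * (J * a) ≡ a * (q′ + J * q) + k
      e₂ = solve-∀
      e₃ : ∀ a r k → a * (r * k) + k ≡ k * (a * r + 1)
      e₃ = solve-∀

    -- For z = (s u + t u′) / k, the determinant det (u , z) equals t because det (u , u′) = k.
    between-left : ∀ {s t m n} → k * m ≡ s * a + t * a′ → k * n ≡ s * q + t * q′ → m * q ≡ a * n + t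
    between-left {s} {t} {m} {n} eqm eqn = *-cancelˡ-≡ (m * q) (a * n + t) k (begin
      k * (m * q) ≡⟨ sym (*-assoc k m q) ⟩
      k * m * q ≡⟨ cong (_* q) eqm ⟩
      (s * a + t * a′) * q ≡⟨ e₁ s a t a′ q ⟩
      s * a * q + t * (q * a′) ≡⟨ cong (λ z → s * a * q + t * z) det ⟩
      s * a * q + t * (a * q′ + k) ≡⟨ e₂ s a q t q′ k ⟩
      a * (s * q + t * q′) + t * k ≡⟨ cong (λ z → a * z + t * k) (sym eqn) ⟩
      a * (k * n) + t * k ≡⟨ e₃ a k n t ⟩
      k * (a * n + t) ∎)
      where
      open ≡-Reasoning
      e₁ : ∀ s a t a′ q → (s * a + t * a′) * q ≡ s * a * q + t * (q * a′)
      e₁ = solve-∀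
      e₂ : ∀ s a q t q′ k → s * a * q + t * (a * q′ + k) ≡ a * (s * q + t * q′) + t * k
      e₂ = solve-∀
      e₃ : ∀ a k n t → a * (k * n) + t * k ≡ k * (a * n + t)
      e₃ = solve-∀

    between-right : ∀ {s t m n} → k * m ≡ s * a + t * a′ → k * n ≡ s * q + t * q′ → a′ * n ≡ m * q′ + s
    between-right {s} {t} {m} {n} eqm eqn = *-cancelˡ-≡ (a′ * n) (m * q′ + s) k (begin
      k * (a′ * n) ≡⟨ e₀ k a′ n ⟩
      a′ * (k * n) ≡⟨ cong (a′ *_) eqn ⟩
      a′ * (s * q + t * q′) ≡⟨ e₁ a′ s q t q′ ⟩
      s * (q * a′) + t * a′ * q′ ≡⟨ cong (λ z → s * z + t * a′ * q′) det ⟩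
      s * (a * q′ + k) + t * a′ * q′ ≡⟨ e₂ s a q′ k t a′ ⟩
      (s * a + t * a′) * q′ + s * k ≡⟨ cong (λ z → z * q′ + s * k) (sym eqm) ⟩
      k * m * q′ + s * k ≡⟨ e₃ k m q′ s ⟩
      k * (m * q′ + s) ∎)
      where
      open ≡-Reasoning
      e₀ : ∀ k a′ n → k * (a′ * n) ≡ a′ * (k * n)
      e₀ = solve-∀
      e₁ : ∀ a′ s q t q′ → a′ * (s * q + t * q′) ≡ s * (q * a′) + t * a′ * q′
      e₁ = solve-∀
      e₂ : ∀ s a q′ k t a′ → s * (a * q′ + k) + t * a′ * q′ ≡ (s * a + t * a′) * q′ + s * k
      e₂ = solve-∀
      e₃ : ∀ k m q′ s → k * m * q′ + s * k ≡ k * (m * q′ + s)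
      e₃ = solve-∀

    -- s = det (z , u′) and t = det (u , z) for z = (m , n).
    between⇒blocker : ∀ {Q j} m n → j < k → k ∣ a′ + suc j * a → k ∣ q′ + suc j * q → n ≤ Q → gcd n d ≡ 1 →
      a * n < m * q → m * q′ < a′ * n → Blocker j Q q q′
    between⇒blocker {Q} {j} m n j<k ka kq n≤Q cn left right =
      blocker s t n (m<n⇒0<n∸m right) (m<n⇒0<n∸m left) inLattice value n≤Q cn
      where
      open ≡-Reasoning
      s = a′ * n ∸ m * q′
      t = m * q ∸ a * n
      J̄ = k ∸ suc j
      s+ : m * q′ + s ≡ a′ * n
      s+ = m+[n∸m]≡n (<⇒≤ right)
      t+ : a * n + t ≡ m * q
      t+ = m+[n∸m]≡n (<⇒≤ left)
      -- s - t J = n (a′ + J a) - m (q′ + J q), and J̄ is congruent to -J modulo k.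
      inLattice : k ∣ s + t * J̄
      inLattice = ∣m+n∣m⇒∣n (∣-mod t 0 (sym balance) (∣n⇒∣m*n n ka)) (∣n⇒∣m*n m kq)
        where
        e₁ : ∀ m q′ J q s t J̄ k → m * (q′ + J * q) + (s + t * J̄) + k * 0 ≡ (m * q′ + s) + J * (m * q) + t * J̄
        e₁ = solve-∀
        e₂ : ∀ a′ n J a t J̄ → a′ * n + J * (a * n + t) + t * J̄ ≡ n * (a′ + J * a) + (J̄ + J) * t
        e₂ = solve-∀
        balance : m * (q′ + suc j * q) + (s + t * J̄) + k * 0 ≡ n * (a′ + suc j * a) + k * t
        balance = begin
          m * (q′ + suc j * q) + (s + t * J̄) + k * 0 ≡⟨ e₁ m q′ (suc j) q s t J̄ k ⟩
          (m * q′ + s) + suc j * (m * q) + t * J̄ ≡⟨ cong₂ (λ x y → x + suc j * y + t * J̄) s+ (sym t+) ⟩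
          a′ * n + suc j * (a * n + t) + t * J̄ ≡⟨ e₂ a′ n (suc j) a t J̄ ⟩
          n * (a′ + suc j * a) + (J̄ + suc j) * t ≡⟨ cong (λ z → n * (a′ + suc j * a) + z * t) (complement j<k) ⟩
          n * (a′ + suc j * a) + k * t ∎
      -- Second coordinate of Cramer's rule k z = s u + t u′, with the subtracted products restored
      -- on both sides.
      value : k * n ≡ s * q + t * q′
      value = +-cancelˡ-≡ (m * q′ * q + a * n * q′) _ _ (begin
        m * q′ * q + a * n * q′ + k * n ≡⟨ f₁ m q′ q a n k ⟩
        m * q′ * q + (a * q′ + k) * n ≡⟨ cong (λ z → m * q′ * q + z * n) (sym det) ⟩
        m * q′ * q + q * a′ * n ≡⟨ f₂ m q′ q a′ n ⟩
        a′ * n * q + m * q * q′ ≡⟨ cong₂ (λ x y → x * q + y * q′) (sym s+) (sym t+) ⟩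
        (m * q′ + s) * q + (a * n + t) * q′ ≡⟨ f₃ m q′ s q a n t ⟩
        m * q′ * q + a * n * q′ + (s * q + t * q′) ∎)
        where
        f₁ : ∀ m q′ q a n k → m * q′ * q + a * n * q′ + k * n ≡ m * q′ * q + (a * q′ + k) * n
        f₁ = solve-∀
        f₂ : ∀ m q′ q a′ n → m * q′ * q + q * a′ * n ≡ a′ * n * q + m * q * q′
        f₂ = solve-∀
        f₃ : ∀ m q′ s q a n t → (m * q′ + s) * q + (a * n + t) * q′ ≡ m * q′ * q + a * n * q′ + (s * q + t * q′)
        f₃ = solve-∀

  quotient-k : ∀ {x r} → x ≡ r * k → x / k ≡ r
  quotient-k {r = r} refl = m*n/n≡m r k

  det-1⇒coprime : ∀ q b a r → q * b ≡ a * r + 1 → ∀ {c} → c ∣ q → c ∣ a ⊎ c ∣ r → c ∣ 1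
  det-1⇒coprime q b a r eq {c} c∣q (inj₁ c∣a) = ∣m+n∣m⇒∣n (subst (c ∣_) eq (∣m⇒∣m*n b c∣q)) (∣m⇒∣m*n r c∣a)
  det-1⇒coprime q b a r eq {c} c∣q (inj₂ c∣r) = ∣m+n∣m⇒∣n (subst (c ∣_) eq (∣m⇒∣m*n b c∣q)) (∣n⇒∣m*n a c∣r)

  module _ {Q a q a′ q′ j : ℕ} (1≤a : 1 ≤ a) (a≤q : a ≤ q) (a′≤q′ : a′ ≤ q′) (j<k : j < k) where

    -- A blocker yields an integral vector between u and u′ that may be imprimitive. Dividing it by
    -- its gcd gives a reduced fraction whose denominator is still at most Q and coprime to d.
    neighbours⇒good : Neighbours Q a q a′ q′ → k ∣ a′ + suc j * a → k ∣ q′ + suc j * q →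
      Good j Q q q′ × Primitive j q q′
    neighbours⇒good (neighbours cq ca cq′ ca′ det empty) ka@(divides b eqb) kq@(divides r eqr) =
      good cq cq′ kq j-coprime unblocked , isPrimitive
      where
      J : ℕ
      J = suc j
      isPrimitive : Primitive j q q′
      isPrimitive = subst (λ z → gcd q z ≡ 1) (sym (quotient-k eqr))
        (∣1⇒≡1 (det-1⇒coprime q b a r (basis-det {a} {q} {_} {q′} det J b r eqb eqr) (gcd[m,n]∣m q r) (inj₂ (gcd[m,n]∣n q r))))
      j-coprime : gcd J k ≡ 1
      -- A common divisor of J and k divides both coordinates of u′ = k w - J u.
      j-coprime = ∣1⇒≡1 (subst (g ∣_) ca′ (gcd-greatest (descend a′ a ka) (descend q′ q kq)))
        where
        g = gcd J k
        descend : ∀ x′ x → k ∣ x′ + J * x → g ∣ x′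
        descend x′ x kx = ∣m+n∣m⇒∣n (subst (g ∣_) (+-comm x′ (J * x)) (∣-trans (gcd[m,n]∣n J k) kx)) (∣m⇒∣m*n x (gcd[m,n]∣m J k))
      unblocked : ¬ Blocker j Q q q′
      unblocked (blocker s t n 1≤s 1≤t l eqn n≤Q cn) with k∣combination j<k s t a a′ l ka
      ... | divides m eqm′ = empty (m / g) (n / g) 1≤m/g (/-monoˡ-≤ g m≤n) (≤-trans (m/n≤m n g) n≤Q)
          (gcd≡1-∣ (n / g) n d (m/n∣m (gcd[m,n]∣n m n)) cn)
          (coprime⇒gcd≡1 (coprime-/gcd m n))
          (*-cancelˡ-< g _ _ (subst₂ _<_ (scale-down a n (gcd[m,n]∣n m n)) (scale-down′ m q (gcd[m,n]∣m m n))
            (subst (a * n <_) (sym (between-left {a} {q} {a′} {q′} det {s} {t} {m} {n} eqm eqn)) (m<m+n (a * n) 1≤t))))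
          (*-cancelˡ-< g _ _ (subst₂ _<_ (scale-down′ m q′ (gcd[m,n]∣m m n)) (scale-down a′ n (gcd[m,n]∣n m n))
            (subst (m * q′ <_) (sym (between-right {a} {q} {a′} {q′} det {s} {t} {m} {n} eqm eqn)) (m<m+n (m * q′) 1≤s))))
        where
        eqm : k * m ≡ s * a + t * a′
        eqm = trans (*-comm k m) (sym eqm′)
        1≤m : 1 ≤ m
        1≤m = n≢0⇒n>0 λ { refl → <⇒≢ (≤-trans (*-mono-≤ 1≤s 1≤a) (m≤m+n (s * a) (t * a′))) (sym eqm′) }
        m≤n : m ≤ n
        m≤n = *-cancelˡ-≤ k (subst₂ _≤_ (sym eqm) (sym eqn) (+-mono-≤ (*-monoʳ-≤ s a≤q) (*-monoʳ-≤ t a′≤q′)))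
        g = gcd m n
        instance
          m-nonZero : NonZero m
          m-nonZero = >-nonZero 1≤m
          g-nonZero : NonZero g
          g-nonZero = ≢-nonZero λ g≡0 → <⇒≢ 1≤m (sym (gcd[m,n]≡0⇒m≡0 g≡0))
        1≤m/g : 1 ≤ m / g
        1≤m/g = m≥n⇒m/n>0 (∣⇒≤ (gcd[m,n]∣m m n))
        scale-down : ∀ x y → g ∣ y → x * y ≡ g * (x * (y / g))
        scale-down x y g∣y = trans (cong (x *_) (sym (m*[n/m]≡n g∣y))) (e x g (y / g))
          where
          e : ∀ x g z → x * (g * z) ≡ g * (x * z)
          e = solve-∀
        scale-down′ : ∀ y x → g ∣ y → y * x ≡ g * (y / g * x)
        scale-down′ y x g∣y = trans (cong (_* x) (sym (m*[n/m]≡n g∣y))) (*-assoc g (y / g) x)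

  -- Solves a r ≡ -1 modulo q, that is det (u , w) = 1. The residue 0 is impossible because q ≥ 2
  -- does not divide 1.
  numerator-exists : ∀ {q r} → 2 ≤ q → gcd q r ≡ 1 → ∃ λ a → 1 ≤ a × a < q × ∃ λ b → q * b ≡ a * r + 1
  numerator-exists {q} {r} 2≤q coprime = reduce (solution (coprime-Bézout (gcd≡1⇒coprime coprime)))
    where
    open ≡-Reasoning
    instance
      q-nonZero : NonZero q
      q-nonZero = >-nonZero (≤-trans (s≤s z≤n) 2≤q)
    κ = q ∸ 1
    e : ∀ κ x → κ * suc (x * suc κ) + 1 ≡ (κ * x + 1) * suc κ
    e = solve-∀
    solution : Bézout.Identity 1 q r → ∃ λ a → q ∣ a * r + 1
    solution (Bézout.Identity.+- x y eq) = y , divides x (trans (+-comm (y * r) 1) eq)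
    -- Here y r ≡ 1 modulo q, and κ = q - 1 supplies the sign.
    solution (Bézout.Identity.-+ x y eq) = κ * y , divides (κ * x + 1) (begin
      κ * y * r + 1 ≡⟨ cong (_+ 1) (*-assoc κ y r) ⟩
      κ * (y * r) + 1 ≡⟨ cong (λ z → κ * z + 1) (sym eq) ⟩
      κ * suc (x * q) + 1 ≡⟨ cong (λ z → κ * suc (x * z) + 1) (sym 1+κ) ⟩
      κ * suc (x * suc κ) + 1 ≡⟨ e κ x ⟩
      (κ * x + 1) * suc κ ≡⟨ cong ((κ * x + 1) *_) 1+κ ⟩
      (κ * x + 1) * q ∎)
      where
      1+κ : suc κ ≡ q
      1+κ = m+[n∸m]≡n (≤-trans (s≤s z≤n) 2≤q)
    reduce : (∃ λ a → q ∣ a * r + 1) → ∃ λ a → 1 ≤ a × a < q × ∃ λ b → q * b ≡ a * r + 1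
    reduce (a , q∣) with ∣-mod {q} {b = a % q * r + 1} 0 (a / q * r)
      (trans (cong (λ z → z * r + 1 + q * 0) (m≡m%n+[m/n]*n a q)) (e′ (a % q) (a / q) q r)) q∣
      where
      e′ : ∀ x y q r → (x + y * q) * r + 1 + q * 0 ≡ x * r + 1 + q * (y * r)
      e′ = solve-∀
    ... | divides b eq = a % q ,
      n≢0⇒n>0 (λ a%q≡0 → <⇒≢ 2≤q (sym (∣1⇒≡1 (divides b (trans (cong (λ z → z * r + 1) (sym a%q≡0)) eq))))) ,
      m%n<n a q , b , trans (*-comm q b) (sym eq)

  numerator-unique-≤ : ∀ {q r a₁ a₂} → gcd q r ≡ 1 → 1 ≤ a₁ → a₁ ≤ a₂ → a₂ ≤ q →
    q ∣ a₁ * r + 1 → q ∣ a₂ * r + 1 → a₂ ≡ a₁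
  numerator-unique-≤ {q} {r} {a₁} {a₂} coprime 1≤a₁ a₁≤a₂ a₂≤q q∣₁ q∣₂ = ∣-between q 0 1≤a₁ a₁≤a₂ a₂≤q
    (subst (q ∣_) (sym (+-identityʳ (a₂ ∸ a₁))) (coprime-divisor (gcd≡1⇒coprime coprime)
      (∣m+n∣m⇒∣n (subst (q ∣_) (trans (cong (λ z → z * r + 1) (sym (m+[n∸m]≡n a₁≤a₂))) (e a₁ (a₂ ∸ a₁) r)) q∣₂) q∣₁)))
    (q ∣0)
    where
    e : ∀ a δ r → (a + δ) * r + 1 ≡ (a * r + 1) + r * δ
    e = solve-∀

  numerator-unique : ∀ {q r a₁ a₂} → gcd q r ≡ 1 → 1 ≤ a₁ → a₁ ≤ q → 1 ≤ a₂ → a₂ ≤ q →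
    q ∣ a₁ * r + 1 → q ∣ a₂ * r + 1 → a₁ ≡ a₂
  numerator-unique {a₁ = a₁} {a₂} coprime 1≤a₁ a₁≤q 1≤a₂ a₂≤q q∣₁ q∣₂ with ≤-total a₁ a₂
  ... | inj₁ a₁≤a₂ = sym (numerator-unique-≤ coprime 1≤a₁ a₁≤a₂ a₂≤q q∣₁ q∣₂)
  ... | inj₂ a₂≤a₁ = numerator-unique-≤ coprime 1≤a₂ a₂≤a₁ a₁≤q q∣₂ q∣₁

  module _ {Q q q′ j : ℕ} (2≤q : 2 ≤ q) (1≤Q : 1 ≤ Q) (j<k : j < k) where

    neighbours-from : ∀ a b r → gcd q d ≡ 1 → gcd q′ d ≡ 1 → q′ + suc j * q ≡ r * k → gcd (suc j) k ≡ 1 →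
      ¬ Blocker j Q q q′ → 1 ≤ a → a < q → q * b ≡ a * r + 1 →
      ∃ λ a → ∃ λ a′ → 1 ≤ a × a ≤ q × 1 ≤ a′ × a′ ≤ q′ × Neighbours Q a q a′ q′ × k ∣ a′ + suc j * a
    neighbours-from a b r cq cq′ eqr cj ub 1≤a a<q qb =
      a , a′ , 1≤a , <⇒≤ a<q , 1≤a′ , a′≤q′ ,
          neighbours cq a-reduced cq′ a′-reduced det
            (λ m n _ _ n≤Q cn _ left right → ub (between⇒blocker det m n j<k ka kq n≤Q cn left right)) ,
          ka
      where
      open ≡-Reasoning
      J : ℕ
      J = suc j
      kq : k ∣ q′ + J * q
      kq = divides r eqr
      instance
        q-nonZero : NonZero q
        q-nonZero = >-nonZero (≤-trans (s≤s z≤n) 2≤q)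
      qkb : q * (b * k) ≡ q * (J * a) + (a * q′ + k)
      qkb = begin
        q * (b * k) ≡⟨ sym (*-assoc q b k) ⟩
        q * b * k ≡⟨ cong (_* k) qb ⟩
        (a * r + 1) * k ≡⟨ e₁ a r k ⟩
        a * (r * k) + k ≡⟨ cong (λ z → a * z + k) (sym eqr) ⟩
        a * (q′ + J * q) + k ≡⟨ e₂ a q′ J q k ⟩
        q * (J * a) + (a * q′ + k) ∎
        where
        e₁ : ∀ a r k → (a * r + 1) * k ≡ a * (r * k) + k
        e₁ = solve-∀
        e₂ : ∀ a q′ J q k → a * (q′ + J * q) + k ≡ q * (J * a) + (a * q′ + k)
        e₂ = solve-∀
      -- u′ is recovered as k w - J u; `qkb` shows that the subtraction is not truncated.
      a′ = b * k ∸ J * a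
      a′+Ja : a′ + J * a ≡ b * k
      a′+Ja = m∸n+n≡m (*-cancelˡ-≤ q (subst (q * (J * a) ≤_) (sym qkb) (m≤m+n _ _)))
      det : q * a′ ≡ a * q′ + k
      det = +-cancelˡ-≡ (q * (J * a)) _ _ (trans (trans (sym (*-distribˡ-+ q (J * a) a′)) (cong (q *_) (trans (+-comm (J * a) a′) a′+Ja))) qkb)
      ka : k ∣ a′ + J * a
      ka = divides b a′+Ja
      1≤a′ : 1 ≤ a′
      1≤a′ = n≢0⇒n>0 λ a′≡0 → <⇒≢ (≤-trans 1≤k (m≤n+m k (a * q′))) (trans (sym (*-zeroʳ q)) (trans (cong (q *_) (sym a′≡0)) det))
      -- Otherwise u′ lies beyond 1/1, which is itself a blocker.
      a′≤q′ : a′ ≤ q′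
      a′≤q′ = ≮⇒≥ λ q′<a′ → ub (between⇒blocker det 1 1 j<k ka kq 1≤Q (∣1⇒≡1 (gcd[m,n]∣m 1 d))
        (subst₂ _<_ (sym (*-identityʳ a)) (sym (*-identityˡ q)) a<q)
        (subst₂ _<_ (sym (*-identityˡ q′)) (sym (*-identityʳ a′)) q′<a′))
      a-reduced : gcd a q ≡ 1
      a-reduced = ∣1⇒≡1 (det-1⇒coprime q b a r qb (gcd[m,n]∣n a q) (inj₁ (gcd[m,n]∣m a q)))
      a′-reduced : gcd a′ q′ ≡ 1
      a′-reduced = ∣1⇒≡1 (subst (g ∣_) cj (gcd-greatest {m = J} {n = k}
        -- The gcd of a′ and q′ divides their determinant k with u, hence also J a and J q, hence J;
        -- but J and k are coprime.
        (coprime-factors {m = a} {n = q} {o = J} (gcd≡1⇒coprime {m = a} {n = q} a-reduced) (ascend a′ a (gcd[m,n]∣m a′ q′) ka , ascend q′ q (gcd[m,n]∣n a′ q′) kq)) g∣k))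
        where
        g = gcd a′ q′
        g∣k : g ∣ k
        g∣k = ∣m+n∣m⇒∣n (subst (g ∣_) det (∣n⇒∣m*n q (gcd[m,n]∣m a′ q′))) (∣n⇒∣m*n a (gcd[m,n]∣n a′ q′))
        ascend : ∀ x′ x → g ∣ x′ → k ∣ x′ + J * x → g ∣ x * J
        ascend x′ x g∣x′ kx = subst (g ∣_) (*-comm J x) (∣m+n∣m⇒∣n (∣-trans g∣k kx) g∣x′)

    good⇒neighbours : Good j Q q q′ → Primitive j q q′ →
      ∃ λ a → ∃ λ a′ → 1 ≤ a × a ≤ q × 1 ≤ a′ × a′ ≤ q′ × Neighbours Q a q a′ q′ × k ∣ a′ + suc j * a
    good⇒neighbours (good cq cq′ kq@(divides r eqr) cj ub) prim =
      case numerator-exists 2≤q (subst (λ z → gcd q z ≡ 1) (quotient-k eqr) prim) of λ { (a , 1≤a , a<q , b , qb) →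
        neighbours-from a b r cq cq′ eqr cj ub 1≤a a<q qb }

    -- `basis-det` turns the hypotheses into a r ≡ -1 modulo q, which has one solution in 1 ≤ a ≤ q.
    -- The determinant then fixes a′.
    neighbours-unique : ∀ {a₁ a₁′ a₂ a₂′} → Primitive j q q′ → k ∣ q′ + suc j * q →
      1 ≤ a₁ → a₁ ≤ q → 1 ≤ a₂ → a₂ ≤ q →
      q * a₁′ ≡ a₁ * q′ + k → q * a₂′ ≡ a₂ * q′ + k → k ∣ a₁′ + suc j * a₁ → k ∣ a₂′ + suc j * a₂ →
      a₁ ≡ a₂ × a₁′ ≡ a₂′
    neighbours-unique {a₁} {a₁′} {a₂} {a₂′} prim (divides r eqr) 1≤a₁ a₁≤q 1≤a₂ a₂≤q det₁ det₂ ka₁ ka₂ =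
      a₁≡a₂ , *-cancelˡ-≡ a₁′ a₂′ q {{>-nonZero (≤-trans (s≤s z≤n) 2≤q)}} (trans det₁ (trans (cong (λ z → z * q′ + k) a₁≡a₂) (sym det₂)))
      where
      q∣ : ∀ {a a′} → q * a′ ≡ a * q′ + k → k ∣ a′ + suc j * a → q ∣ a * r + 1
      q∣ {a} {a′} det (divides b eqb) = divides b (trans (sym (basis-det {a} {q} {a′} {q′} det (suc j) b r eqb eqr)) (*-comm q b))
      a₁≡a₂ : a₁ ≡ a₂
      a₁≡a₂ = numerator-unique (subst (λ z → gcd q z ≡ 1) (quotient-k eqr) prim) 1≤a₁ a₁≤q 1≤a₂ a₂≤q (q∣ det₁ ka₁) (q∣ det₂ ka₂)

-- From the list-based count to sums of indicators.

listSum : ∀ {ℓ} {A : Set ℓ} → (A → ℕ) → List A → ℕ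
listSum f [] = 0
listSum f (x ∷ xs) = f x + listSum f xs

listSum-cong : ∀ {ℓ} {A : Set ℓ} {f g : A → ℕ} (xs : List A) → (∀ x → f x ≡ g x) → listSum f xs ≡ listSum g xs
listSum-cong [] h = refl
listSum-cong (x ∷ xs) h = cong₂ _+_ (h x) (listSum-cong xs h)

listSum-++ : ∀ {ℓ} {A : Set ℓ} (f : A → ℕ) xs ys → listSum f (xs ++ ys) ≡ listSum f xs + listSum f ys
listSum-++ f [] ys = refl
listSum-++ f (x ∷ xs) ys = trans (cong (f x +_) (listSum-++ f xs ys)) (sym (+-assoc (f x) _ _))

listSum-map : ∀ {ℓ m} {A : Set ℓ} {B : Set m} (f : B → ℕ) (g : A → B) xs → listSum f (map g xs) ≡ listSum (f ∘ g) xs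
listSum-map f g [] = refl
listSum-map f g (x ∷ xs) = cong (f (g x) +_) (listSum-map f g xs)

listSum-concatMap : ∀ {ℓ m} {A : Set ℓ} {B : Set m} (f : B → ℕ) (g : A → List B) xs →
  listSum f (concatMap g xs) ≡ listSum (λ x → listSum f (g x)) xs
listSum-concatMap f g [] = refl
listSum-concatMap f g (x ∷ xs) = trans (listSum-++ f (g x) _) (cong (listSum f (g x) +_) (listSum-concatMap f g xs))

listSum-filter : ∀ {ℓ p} {A : Set ℓ} {P : A → Set p} (P? : Decidable P) (f : A → ℕ) xs →
  listSum f (filter P? xs) ≡ listSum (λ x → 𝟙 (P? x) * f x) xs
listSum-filter P? f [] = refl
listSum-filter P? f (x ∷ xs) with P? x
... | yes _ = cong₂ _+_ (sym (*-identityˡ (f x))) (listSum-filter P? f xs)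
... | no _ = listSum-filter P? f xs

length-listSum : ∀ {ℓ} {A : Set ℓ} (xs : List A) → length xs ≡ listSum (λ _ → 1) xs
length-listSum [] = refl
length-listSum (x ∷ xs) = cong suc (length-listSum xs)

listSum-applyUpTo : ∀ {ℓ} {A : Set ℓ} (f : A → ℕ) (g : ℕ → A) n → listSum f (applyUpTo g n) ≡ Σ< n (f ∘ g)
listSum-applyUpTo f g zero = refl
listSum-applyUpTo f g (suc n) = trans (cong (f (g 0) +_) (listSum-applyUpTo f (g ∘ suc) n)) (sym (Σ<-sucˡ n (f ∘ g)))

length-filter-pairs : ∀ {ℓ p} {A : Set ℓ} {P : A × A → Set p} (P? : Decidable P) (xs : List A) →
  length (filter P? (concatMap (λ x → map (λ y → (x , y)) xs) xs)) ≡
  listSum (λ x → listSum (λ y → 𝟙 (P? (x , y))) xs) xs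
length-filter-pairs P? xs = begin
  length (filter P? pairs) ≡⟨ length-listSum (filter P? pairs) ⟩
  listSum (λ _ → 1) (filter P? pairs) ≡⟨ listSum-filter P? (λ _ → 1) pairs ⟩
  listSum (λ z → 𝟙 (P? z) * 1) pairs ≡⟨ listSum-cong pairs (λ z → *-identityʳ (𝟙 (P? z))) ⟩
  listSum (λ z → 𝟙 (P? z)) pairs ≡⟨ listSum-concatMap (λ z → 𝟙 (P? z)) (λ x → map (λ y → (x , y)) xs) xs ⟩
  listSum (λ x → listSum (λ z → 𝟙 (P? z)) (map (λ y → (x , y)) xs)) xs
    ≡⟨ listSum-cong xs (λ x → listSum-map (λ z → 𝟙 (P? z)) (λ y → (x , y)) xs) ⟩
  listSum (λ x → listSum (λ y → 𝟙 (P? (x , y))) xs) xs ∎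
  where
  open ≡-Reasoning
  pairs = concatMap (λ x → map (λ y → (x , y)) xs) xs

𝟙-map′ : ∀ {p q} {P : Set p} {Q : Set q} {f : P → Q} {g : Q → P} (P? : Dec P) → 𝟙 (map′ f g P?) ≡ 𝟙 P?
𝟙-map′ (yes _) = refl
𝟙-map′ (no _) = refl

𝟙-×⁵ : ∀ {A B C D E : Set} (A? : Dec A) (B? : Dec B) (C? : Dec C) (D? : Dec D) (E? : Dec E) →
  𝟙 (A? ×-dec B? ×-dec C? ×-dec D? ×-dec E?) ≡ 𝟙 A? * (𝟙 B? * (𝟙 C? * (𝟙 D? * 𝟙 E?)))
𝟙-×⁵ A? B? C? D? E? =
  trans (𝟙-× A? (B? ×-dec C? ×-dec D? ×-dec E?)) (cong (𝟙 A? *_)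
  (trans (𝟙-× B? (C? ×-dec D? ×-dec E?)) (cong (𝟙 B? *_)
  (trans (𝟙-× C? (D? ×-dec E?)) (cong (𝟙 C? *_) (𝟙-× D? E?))))))

module Counting (d k : ℕ) (2≤d : 2 ≤ d) (1≤k : 1 ≤ k) where

  open Pairs d k 2≤d 1≤k
  open Correspondence d k 2≤d 1≤k

  fractions : ℕ → List Frac
  fractions Q = concatMap (λ q → map (λ a → (suc a , q)) (upTo q)) (map suc (upTo Q))

  listSum-FareyD : ∀ Q (f : Frac → ℕ) → listSum f (FareyD Q d) ≡
    Σ< Q (λ i → Σ< (suc i) (λ a → 𝟙 (gcd (suc i) d ≟ 1) * (𝟙 (gcd (suc a) (suc i) ≟ 1) * f (suc a , suc i))))
  listSum-FareyD Q f = begin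
    listSum f (FareyD Q d)
      ≡⟨ listSum-filter (λ p → gcd (proj₁ p) (proj₂ p) ≟ 1) f (filter (λ p → gcd (proj₂ p) d ≟ 1) (fractions Q)) ⟩
    listSum f₁ (filter (λ p → gcd (proj₂ p) d ≟ 1) (fractions Q))
      ≡⟨ listSum-filter (λ p → gcd (proj₂ p) d ≟ 1) f₁ (fractions Q) ⟩
    listSum f₂ (fractions Q)
      ≡⟨ listSum-concatMap f₂ (λ q → map (λ a → (suc a , q)) (upTo q)) (map suc (upTo Q)) ⟩
    listSum (λ q → listSum f₂ (map (λ a → (suc a , q)) (upTo q))) (map suc (upTo Q))
      ≡⟨ listSum-map _ suc (upTo Q) ⟩
    listSum (λ i → listSum f₂ (map (λ a → (suc a , suc i)) (upTo (suc i)))) (upTo Q)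
      ≡⟨ listSum-applyUpTo _ id Q ⟩
    Σ< Q (λ i → listSum f₂ (map (λ a → (suc a , suc i)) (upTo (suc i))))
      ≡⟨ Σ<-cong Q (λ i _ → trans (listSum-map f₂ (λ a → (suc a , suc i)) (upTo (suc i))) (listSum-applyUpTo _ id (suc i))) ⟩
    Σ< Q (λ i → Σ< (suc i) (λ a → f₂ (suc a , suc i))) ∎
    where
    open ≡-Reasoning
    f₁ f₂ : Frac → ℕ
    f₁ p = 𝟙 (gcd (proj₁ p) (proj₂ p) ≟ 1) * f p
    f₂ p = 𝟙 (gcd (proj₂ p) d ≟ 1) * f₁ p

  ∈-FareyD⁺ : ∀ {Q m n} → 1 ≤ m → m ≤ n → n ≤ Q → gcd n d ≡ 1 → gcd m n ≡ 1 → (m , n) ∈ FareyD Q d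
  ∈-FareyD⁺ {Q} {suc m} {suc n} _ m≤n n≤Q cn cm =
    ∈-filter⁺ (λ p → gcd (proj₁ p) (proj₂ p) ≟ 1) (∈-filter⁺ (λ p → gcd (proj₂ p) d ≟ 1)
      (∈-concat⁺′ (∈-map⁺ (λ a → (suc a , suc n)) (∈-upTo⁺ m≤n))
        (∈-map⁺ (λ q → map (λ a → (suc a , q)) (upTo q)) (∈-map⁺ suc (∈-upTo⁺ n≤Q))))
      cn) cm

  ∈-FareyD⁻ : ∀ {Q m n} → (m , n) ∈ FareyD Q d → 1 ≤ m × m ≤ n × n ≤ Q × gcd n d ≡ 1 × gcd m n ≡ 1
  ∈-FareyD⁻ {Q} z∈ with ∈-filter⁻ (λ p → gcd (proj₁ p) (proj₂ p) ≟ 1) {xs = filter (λ p → gcd (proj₂ p) d ≟ 1) (fractions Q)} z∈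
  ... | z∈′ , cm with ∈-filter⁻ (λ p → gcd (proj₂ p) d ≟ 1) {xs = fractions Q} z∈′
  ... | z∈″ , cn with ∈-concat⁻′ (map (λ q → map (λ a → (suc a , q)) (upTo q)) (map suc (upTo Q))) z∈″
  ... | row , z∈row , row∈ with ∈-map⁻ (λ q → map (λ a → (suc a , q)) (upTo q)) row∈
  ... | q , q∈ , refl with ∈-map⁻ suc q∈ | ∈-map⁻ (λ a → (suc a , q)) z∈row
  ... | i , i∈ , refl | a , a∈ , refl = s≤s z≤n , ∈-upTo⁻ a∈ , ∈-upTo⁻ i∈ , cn , cm

  module _ (F : List Frac) (a q a′ q′ : ℕ) where

    private
      between? : Frac → Bool
      between? z = ((a , q) ≺ᵇ z) ∧ (z ≺ᵇ (a′ , q′))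
      before? empty? det? : Bool
      before? = (a , q) ≺ᵇ (a′ , q′)
      empty? = all (λ z → not (between? z)) F
      det? = detᵇ k (a , q) (a′ , q′)

    consecutive-sound : (consecutiveᵇ F (a , q) (a′ , q′) ∧ detᵇ k (a , q) (a′ , q′)) ≡ true →
      q * a′ ≡ a * q′ + k × (∀ m n → (m , n) ∈ F → a * n < m * q → ¬ m * q′ < a′ * n)
    consecutive-sound eq with Equivalence.to (T-∧ {before? ∧ empty?} {det?}) (Equivalence.from T-≡ eq)
    ... | c , det with Equivalence.to (T-∧ {before?} {empty?}) c
    ... | _ , empty = toWitness {a? = q * a′ ≟ a * q′ + k} det , λ m n z∈ left right → contradiction
      (trans (sym (Equivalence.to T-≡ (Equivalence.from (T-∧ {(a , q) ≺ᵇ (m , n)} {(m , n) ≺ᵇ (a′ , q′)})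
               (fromWitness {a? = suc (a * n) ≤? m * q} left , fromWitness {a? = suc (m * q′) ≤? a′ * n} right))))
             (Equivalence.to (T-not-≡ {between? (m , n)}) (All.lookup (all⁺ (λ z → not (between? z)) F empty) z∈)))
      λ ()

    consecutive-complete : q * a′ ≡ a * q′ + k →
      (∀ m n → (m , n) ∈ F → a * n < m * q → ¬ m * q′ < a′ * n) →
      (consecutiveᵇ F (a , q) (a′ , q′) ∧ detᵇ k (a , q) (a′ , q′)) ≡ true
    consecutive-complete det none = Equivalence.to T-≡ (Equivalence.from (T-∧ {before? ∧ empty?} {det?})
      (Equivalence.from (T-∧ {before?} {empty?})
        (fromWitness {a? = suc (a * q′) ≤? a′ * q} (subst (a * q′ <_) (trans (sym det) (*-comm q a′)) (m<m+n (a * q′) 1≤k)) ,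
         all⁻ (λ z → not (between? z)) (All.tabulate not-between)) ,
       fromWitness {a? = q * a′ ≟ a * q′ + k} det))
      where
      ¬-true : ∀ b → ¬ b ≡ true → b ≡ false
      ¬-true true b≢ = contradiction refl b≢
      ¬-true false _ = refl
      not-between : ∀ {z} → z ∈ F → T (not (between? z))
      not-between {m , n} z∈ = Equivalence.from (T-not-≡ {between? (m , n)}) (¬-true (between? (m , n)) λ eq →
        case Equivalence.to (T-∧ {(a , q) ≺ᵇ (m , n)} {(m , n) ≺ᵇ (a′ , q′)}) (Equivalence.from T-≡ eq) of λ { (left , right) →
          none m n z∈ (toWitness {a? = suc (a * n) ≤? m * q} left) (toWitness {a? = suc (m * q′) ≤? a′ * n} right) })

  abstract
    -- Decided through the Boolean test inside `N`, so that its indicator factors into exactly the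
    -- weights produced by the filters.
    neighbours? : ∀ Q a q a′ q′ → Dec (Neighbours Q a q a′ q′)
    neighbours? Q a q a′ q′ = map′
      (λ { (cq , ca , cq′ , ca′ , eq) → case consecutive-sound (FareyD Q d) a q a′ q′ eq of λ { (det , none) →
        neighbours cq ca cq′ ca′ det (λ m n 1≤m m≤n n≤Q cn cm left right → none m n (∈-FareyD⁺ 1≤m m≤n n≤Q cn cm) left right) } })
      (λ { (neighbours cq ca cq′ ca′ det none) → cq , ca , cq′ , ca′ , consecutive-complete (FareyD Q d) a q a′ q′ det
        (λ m n z∈ left right → case ∈-FareyD⁻ {Q} {m} {n} z∈ of λ { (1≤m , m≤n , n≤Q , cn , cm) → none m n 1≤m m≤n n≤Q cn cm left right }) })
      (gcd q d ≟ 1 ×-dec gcd a q ≟ 1 ×-dec gcd q′ d ≟ 1 ×-dec gcd a′ q′ ≟ 1 ×-dec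
        (consecutiveᵇ (FareyD Q d) (a , q) (a′ , q′) ∧ detᵇ k (a , q) (a′ , q′) Data.Bool.≟ true))

    𝟙-neighbours : ∀ Q a q a′ q′ → 𝟙 (neighbours? Q a q a′ q′) ≡
      𝟙 (gcd q d ≟ 1) * (𝟙 (gcd a q ≟ 1) * (𝟙 (gcd q′ d ≟ 1) * (𝟙 (gcd a′ q′ ≟ 1) *
        𝟙 (consecutiveᵇ (FareyD Q d) (a , q) (a′ , q′) ∧ detᵇ k (a , q) (a′ , q′) Data.Bool.≟ true))))
    𝟙-neighbours Q a q a′ q′ = trans (𝟙-map′ (gcd q d ≟ 1 ×-dec gcd a q ≟ 1 ×-dec gcd q′ d ≟ 1 ×-dec gcd a′ q′ ≟ 1 ×-dec
        (consecutiveᵇ (FareyD Q d) (a , q) (a′ , q′) ∧ detᵇ k (a , q) (a′ , q′) Data.Bool.≟ true)))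
      (𝟙-×⁵ (gcd q d ≟ 1) (gcd a q ≟ 1) (gcd q′ d ≟ 1) (gcd a′ q′ ≟ 1)
        (consecutiveᵇ (FareyD Q d) (a , q) (a′ , q′) ∧ detᵇ k (a , q) (a′ , q′) Data.Bool.≟ true))

  N≡ : ∀ Q → N Q d k ≡
    Σ< Q (λ i → Σ< Q (λ i′ → Σ< (suc i) (λ a → Σ< (suc i′) (λ a′ → 𝟙 (neighbours? Q (suc a) (suc i) (suc a′) (suc i′))))))
  N≡ Q = begin
    N Q d k ≡⟨ length-filter-pairs _ F ⟩
    listSum (λ x → listSum (λ y → e x y) F) F ≡⟨ listSum-FareyD Q (λ x → listSum (e x) F) ⟩
    Σ< Q (λ i → Σ< (suc i) (λ a → α i * (β a i * listSum (e (suc a , suc i)) F)))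
      ≡⟨ Σ<-cong Q (λ i _ → trans (Σ<-cong (suc i) λ a _ → inner i a) (Σ<-swap (suc i) Q _)) ⟩
    Σ< Q (λ i → Σ< Q (λ i′ → Σ< (suc i) (λ a → Σ< (suc i′) (λ a′ → 𝟙 (neighbours? Q (suc a) (suc i) (suc a′) (suc i′)))))) ∎
    where
    open ≡-Reasoning
    F = FareyD Q d
    e : Frac → Frac → ℕ
    e x y = 𝟙 (consecutiveᵇ F x y ∧ detᵇ k x y Data.Bool.≟ true)
    α : ℕ → ℕ
    α i = 𝟙 (gcd (suc i) d ≟ 1)
    β : ℕ → ℕ → ℕ
    β a i = 𝟙 (gcd (suc a) (suc i) ≟ 1)
    inner : ∀ i a → α i * (β a i * listSum (e (suc a , suc i)) F) ≡
      Σ< Q (λ i′ → Σ< (suc i′) (λ a′ → 𝟙 (neighbours? Q (suc a) (suc i) (suc a′) (suc i′))))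
    inner i a = begin
      α i * (β a i * listSum (e (suc a , suc i)) F) ≡⟨ sym (*-assoc (α i) (β a i) _) ⟩
      α i * β a i * listSum (e (suc a , suc i)) F
        ≡⟨ cong (α i * β a i *_) (listSum-FareyD Q (e (suc a , suc i))) ⟩
      α i * β a i * Σ< Q (λ i′ → Σ< (suc i′) (λ a′ → α i′ * (β a′ i′ * e (suc a , suc i) (suc a′ , suc i′))))
        ≡⟨ sym (trans (Σ<-cong Q λ i′ _ → Σ<-*ˡ (suc i′) (α i * β a i) _) (Σ<-*ˡ Q (α i * β a i) _)) ⟩
      Σ< Q (λ i′ → Σ< (suc i′) (λ a′ → α i * β a i * (α i′ * (β a′ i′ * e (suc a , suc i) (suc a′ , suc i′)))))
        ≡⟨ Σ<-cong Q (λ i′ _ → Σ<-cong (suc i′) λ a′ _ → trans (*-assoc (α i) (β a i) _)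
             (sym (𝟙-neighbours Q (suc a) (suc i) (suc a′) (suc i′)))) ⟩
      Σ< Q (λ i′ → Σ< (suc i′) (λ a′ → 𝟙 (neighbours? Q (suc a) (suc i) (suc a′) (suc i′)))) ∎

  -- The relation that is counted twice: a neighbouring pair has one linked index j, and for q ≥ 2 a
  -- good primitive triple (j , q , q′) has one linked pair of numerators.
  Linked : (j a q a′ q′ : ℕ) → Set
  Linked j a q a′ q′ = k ∣ a′ + suc j * a × k ∣ q′ + suc j * q

  linked? : ∀ Q j a q a′ q′ → Dec (Neighbours Q a q a′ q′ × Linked j a q a′ q′)
  linked? Q j a q a′ q′ = neighbours? Q a q a′ q′ ×-dec k ∣? a′ + suc j * a ×-dec k ∣? q′ + suc j * q

  neighbourCount primitiveCount : ℕ → ℕ → ℕ → ℕ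
  neighbourCount Q i i′ = Σ< (suc i) (λ a → Σ< (suc i′) (λ a′ → 𝟙 (neighbours? Q (suc a) (suc i) (suc a′) (suc i′))))
  primitiveCount Q i i′ = Σ< k (λ j → 𝟙 (good? j Q (suc i) (suc i′)) * 𝟙 (primitive? j (suc i) (suc i′)))

  count-over-j : ∀ Q a q a′ q′ → Σ< k (λ j → 𝟙 (linked? Q j a q a′ q′)) ≡ 𝟙 (neighbours? Q a q a′ q′)
  count-over-j Q a q a′ q′ = Σ<-𝟙-unique k (neighbours? Q a q a′ q′) (λ j → linked? Q j a q a′ q′) (λ _ _ → proj₁)
    λ nb → let open Neighbours nb in case index-exists {a} {q} {a′} {q′} det a-reduced of λ { (j , j<k , ka , kq) →
      j , j<k , (nb , ka , kq) , λ { i i<k (_ , ka′ , kq′) → index-unique {a} {q} {a′} {q′} det a-reduced i<k j<k ka′ kq′ ka kq } }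

  count-single : ∀ Q i i′ j → 1 ≤ i → i < Q → j < k → Primitive j (suc i) (suc i′) → ∀ a₀ a₀′ → a₀ < suc i → a₀′ < suc i′ →
    Neighbours Q (suc a₀) (suc i) (suc a₀′) (suc i′) → Linked j (suc a₀) (suc i) (suc a₀′) (suc i′) →
    Σ< (suc i) (λ a → Σ< (suc i′) (λ a′ → 𝟙 (linked? Q j (suc a) (suc i) (suc a′) (suc i′)))) ≡ 1
  count-single Q i i′ j 1≤i i<Q j<k p a₀ a₀′ a₀<q a₀′<q′ nb₀ (ka₀ , kq) = begin
    Σ< (suc i) (λ a → Σ< (suc i′) (λ a′ → χ a a′))
      ≡⟨ Σ<-single (suc i) a₀<q (λ a a<q a≢a₀ → Σ<-zero (suc i′) λ a′ a′<q′ →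
           𝟙-no (linked? Q j (suc a) (suc i) (suc a′) (suc i′)) λ l → a≢a₀ (suc-injective (proj₁ (unique a a′ a<q l)))) ⟩
    Σ< (suc i′) (λ a′ → χ a₀ a′)
      ≡⟨ Σ<-single (suc i′) a₀′<q′ (λ a′ a′<q′ a′≢a₀′ →
           𝟙-no (linked? Q j (suc a₀) (suc i) (suc a′) (suc i′)) λ l → a′≢a₀′ (suc-injective (proj₂ (unique a₀ a′ a₀<q l)))) ⟩
    χ a₀ a₀′ ≡⟨ 𝟙-yes (linked? Q j (suc a₀) (suc i) (suc a₀′) (suc i′)) (nb₀ , ka₀ , kq) ⟩
    1 ∎
    where
    open ≡-Reasoning
    χ : ℕ → ℕ → ℕ
    χ a a′ = 𝟙 (linked? Q j (suc a) (suc i) (suc a′) (suc i′))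
    unique : ∀ a a′ → a < suc i → Neighbours Q (suc a) (suc i) (suc a′) (suc i′) × Linked j (suc a) (suc i) (suc a′) (suc i′) →
      suc a ≡ suc a₀ × suc a′ ≡ suc a₀′
    unique a a′ a<q (nb , ka , _) = neighbours-unique {Q} {suc i} {suc i′} {j} (s≤s 1≤i) (≤-trans (s≤s z≤n) i<Q) j<k p kq
      (s≤s z≤n) a<q (s≤s z≤n) a₀<q (Neighbours.det nb) (Neighbours.det nb₀) ka ka₀

  count-over-a : ∀ Q i i′ j → 1 ≤ i → i < Q → j < k →
    Σ< (suc i) (λ a → Σ< (suc i′) (λ a′ → 𝟙 (linked? Q j (suc a) (suc i) (suc a′) (suc i′)))) ≡
    𝟙 (good? j Q (suc i) (suc i′) ×-dec primitive? j (suc i) (suc i′))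
  count-over-a Q i i′ j 1≤i i<Q j<k = by-cases (good? j Q (suc i) (suc i′) ×-dec primitive? j (suc i) (suc i′))
    where
    by-cases : (dec : Dec (Good j Q (suc i) (suc i′) × Primitive j (suc i) (suc i′))) →
      Σ< (suc i) (λ a → Σ< (suc i′) (λ a′ → 𝟙 (linked? Q j (suc a) (suc i) (suc a′) (suc i′)))) ≡ 𝟙 dec
    by-cases (no ¬g) = Σ<-zero (suc i) λ a a<q → Σ<-zero (suc i′) λ a′ a′<q′ →
      𝟙-no (linked? Q j (suc a) (suc i) (suc a′) (suc i′)) λ { (nb , ka , kq) →
        ¬g (neighbours⇒good {Q} {suc a} {suc i} {suc a′} {suc i′} {j} (s≤s z≤n) a<q a′<q′ j<k nb ka kq) }
    by-cases (yes (g , p)) = case good⇒neighbours {Q} {suc i} {suc i′} {j} (s≤s 1≤i) (≤-trans (s≤s z≤n) i<Q) j<k g p of λ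
      { (suc a₀ , suc a₀′ , _ , a₀≤q , _ , a₀′≤q′ , nb₀ , ka₀) →
          count-single Q i i′ j 1≤i i<Q j<k p a₀ a₀′ a₀≤q a₀′≤q′ nb₀ (ka₀ , Good.k∣ g)
      ; (zero , _ , () , _)
      ; (suc _ , zero , _ , _ , () , _) }

  counts-agree : ∀ Q i i′ → 1 ≤ i → i < Q → neighbourCount Q i i′ ≡ primitiveCount Q i i′
  counts-agree Q i i′ 1≤i i<Q = begin
    Σ< (suc i) (λ a → Σ< (suc i′) (λ a′ → 𝟙 (neighbours? Q (suc a) (suc i) (suc a′) (suc i′))))
      ≡⟨ Σ<-cong (suc i) (λ a _ → Σ<-cong (suc i′) λ a′ _ → sym (count-over-j Q (suc a) (suc i) (suc a′) (suc i′))) ⟩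
    Σ< (suc i) (λ a → Σ< (suc i′) (λ a′ → Σ< k (λ j → χ j a a′)))
      ≡⟨ Σ<-cong (suc i) (λ a _ → Σ<-swap (suc i′) k (λ a′ j → χ j a a′)) ⟩
    Σ< (suc i) (λ a → Σ< k (λ j → Σ< (suc i′) (λ a′ → χ j a a′)))
      ≡⟨ Σ<-swap (suc i) k (λ a j → Σ< (suc i′) (λ a′ → χ j a a′)) ⟩
    Σ< k (λ j → Σ< (suc i) (λ a → Σ< (suc i′) (λ a′ → χ j a a′)))
      ≡⟨ Σ<-cong k (λ j j<k → trans (count-over-a Q i i′ j 1≤i i<Q j<k) (𝟙-× (good? j Q (suc i) (suc i′)) (primitive? j (suc i) (suc i′)))) ⟩
    primitiveCount Q i i′ ∎
    where
    open ≡-Reasoning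
    χ : ℕ → ℕ → ℕ → ℕ
    χ j a a′ = 𝟙 (linked? Q j (suc a) (suc i) (suc a′) (suc i′))

  -- For q = 1 the fraction is 1/1, which has no successor in (0 , 1].
  neighbourCount-1 : ∀ Q i′ → neighbourCount Q 0 i′ ≡ 0
  neighbourCount-1 Q i′ = Σ<-zero (suc i′) λ a′ a′<q′ →
    𝟙-no (neighbours? Q 1 1 (suc a′) (suc i′)) λ nb → <⇒≱ (m<m+n (suc i′) 1≤k) (subst (_≤ suc i′)
      (trans (sym (*-identityˡ (suc a′))) (trans (Neighbours.det nb) (cong (_+ k) (*-identityˡ (suc i′))))) a′<q′)

  primitiveCount≤k : ∀ Q i i′ → primitiveCount Q i i′ ≤ k
  primitiveCount≤k Q i i′ = ≤-trans (Σ<-bound k 1 λ j _ → *-mono-≤ (𝟙≤1 (good? j Q (suc i) (suc i′))) (𝟙≤1 (primitive? j (suc i) (suc i′))))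
    (≤-reflexive (*-identityʳ k))

  N≤G : ∀ Q → N Q d k ≤ G Q
  N≤G Q = subst (_≤ G Q) (sym (N≡ Q)) (Σ<-mono Q λ i i<Q → Σ<-mono Q λ i′ _ → term i i′ i<Q)
    where
    term : ∀ i i′ → i < Q → neighbourCount Q i i′ ≤ primitiveCount Q i i′
    term zero i′ _ = ≤-trans (≤-reflexive (neighbourCount-1 Q i′)) z≤n
    term (suc i) i′ i<Q = ≤-reflexive (counts-agree Q (suc i) i′ (s≤s z≤n) i<Q)

  -- The counts differ only in the row q = 1, which has Q entries of size at most k.
  G≤N+kQ : ∀ Q → G Q ≤ N Q d k + k * Q
  G≤N+kQ zero = z≤n
  G≤N+kQ Q@(suc Q′) = subst (λ z → G Q ≤ z + k * Q) (sym (N≡ Q)) (begin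
    G Q ≡⟨ Σ<-sucˡ Q′ g ⟩
    g 0 + Σ< Q′ (g ∘ suc)
      ≡⟨ cong (g 0 +_) (Σ<-cong Q′ λ i i<Q′ → Σ<-cong Q λ i′ _ → sym (counts-agree Q (suc i) i′ (s≤s z≤n) (s≤s i<Q′))) ⟩
    g 0 + Σ< Q′ (h ∘ suc)
      ≤⟨ +-mono-≤ (Σ<-bound Q k λ i′ _ → primitiveCount≤k Q 0 i′) (≤-trans (m≤n+m _ (h 0)) (≤-reflexive (sym (Σ<-sucˡ Q′ h)))) ⟩
    Q * k + Σ< Q h ≡⟨ trans (+-comm (Q * k) _) (cong (Σ< Q h +_) (*-comm Q k)) ⟩
    Σ< Q h + k * Q ∎)
    where
    open ≤-Reasoning
    g h : ℕ → ℕ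
    g i = Σ< Q (λ i′ → primitiveCount Q i i′)
    h i = Σ< Q (λ i′ → neighbourCount Q i i′)

-- Rational fractions with natural numerators.

fraction-≤ : ∀ a b c d .{{_ : NonZero b}} .{{_ : NonZero d}} → a * d ≤ c * b → (ℤ.+ a) ℚ./ b ℚ.≤ (ℤ.+ c) ℚ./ d
fraction-≤ a (suc b) c (suc d) h = ℚₚ.toℚᵘ-cancel-≤
  (ℚᵘₚ.≤-respˡ-≃ (ℚᵘₚ.≃-sym (ℚₚ.toℚᵘ-fromℚᵘ (mkℚᵘ (ℤ.+ a) b)))
  (ℚᵘₚ.≤-respʳ-≃ (ℚᵘₚ.≃-sym (ℚₚ.toℚᵘ-fromℚᵘ (mkℚᵘ (ℤ.+ c) d)))
  (*≤* (subst₂ ℤ._≤_ (pos-* a (suc d)) (pos-* c (suc b)) (ℤ.+≤+ h)))))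

fraction-< : ∀ a b c d .{{_ : NonZero b}} .{{_ : NonZero d}} → a * d < c * b → (ℤ.+ a) ℚ./ b ℚ.< (ℤ.+ c) ℚ./ d
fraction-< a (suc b) c (suc d) h = ℚₚ.toℚᵘ-cancel-<
  (ℚᵘₚ.<-respˡ-≃ (ℚᵘₚ.≃-sym (ℚₚ.toℚᵘ-fromℚᵘ (mkℚᵘ (ℤ.+ a) b)))
  (ℚᵘₚ.<-respʳ-≃ (ℚᵘₚ.≃-sym (ℚₚ.toℚᵘ-fromℚᵘ (mkℚᵘ (ℤ.+ c) d)))
  (*<* (subst₂ ℤ._<_ (pos-* a (suc d)) (pos-* c (suc b)) (ℤ.+<+ h)))))

fraction-+ : ∀ a b c d .{{_ : NonZero b}} .{{_ : NonZero d}} →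
  (ℤ.+ a) ℚ./ b ℚ.+ (ℤ.+ c) ℚ./ d ≡ ((ℤ.+ (a * d + c * b)) ℚ./ (b * d)) {{m*n≢0 b d}}
fraction-+ a (suc b) c (suc d) = ℚₚ.toℚᵘ-injective (begin
  ℚ.toℚᵘ (ℚ.fromℚᵘ p ℚ.+ ℚ.fromℚᵘ q) ≈⟨ ℚₚ.toℚᵘ-homo-+ (ℚ.fromℚᵘ p) (ℚ.fromℚᵘ q) ⟩
  ℚ.toℚᵘ (ℚ.fromℚᵘ p) ℚᵘ.+ ℚ.toℚᵘ (ℚ.fromℚᵘ q) ≈⟨ ℚᵘₚ.+-cong (ℚₚ.toℚᵘ-fromℚᵘ p) (ℚₚ.toℚᵘ-fromℚᵘ q) ⟩
  p ℚᵘ.+ q ≡⟨ cong (λ z → mkℚᵘ z (d + b * suc d)) (cong₂ ℤ._+_ (sym (pos-* a (suc d))) (sym (pos-* c (suc b)))) ⟩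
  mkℚᵘ (ℤ.+ (a * suc d + c * suc b)) (d + b * suc d) ≈⟨ ℚᵘₚ.≃-sym (ℚₚ.toℚᵘ-fromℚᵘ (mkℚᵘ (ℤ.+ (a * suc d + c * suc b)) (d + b * suc d))) ⟩
  ℚ.toℚᵘ (ℚ.fromℚᵘ (mkℚᵘ (ℤ.+ (a * suc d + c * suc b)) (d + b * suc d))) ∎)
  where
  open import Relation.Binary.Reasoning.Setoid ℚᵘₚ.≃-setoid
  p = mkℚᵘ (ℤ.+ a) b
  q = mkℚᵘ (ℤ.+ c) d

fraction-* : ∀ a b c d .{{_ : NonZero b}} .{{_ : NonZero d}} →
  ((ℤ.+ a) ℚ./ b) ℚ.* ((ℤ.+ c) ℚ./ d) ≡ ((ℤ.+ (a * c)) ℚ./ (b * d)) {{m*n≢0 b d}}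
fraction-* a (suc b) c (suc d) = ℚₚ.toℚᵘ-injective (begin
  ℚ.toℚᵘ (ℚ.fromℚᵘ p ℚ.* ℚ.fromℚᵘ q) ≈⟨ ℚₚ.toℚᵘ-homo-* (ℚ.fromℚᵘ p) (ℚ.fromℚᵘ q) ⟩
  ℚ.toℚᵘ (ℚ.fromℚᵘ p) ℚᵘ.* ℚ.toℚᵘ (ℚ.fromℚᵘ q) ≈⟨ ℚᵘₚ.*-cong (ℚₚ.toℚᵘ-fromℚᵘ p) (ℚₚ.toℚᵘ-fromℚᵘ q) ⟩
  p ℚᵘ.* q ≡⟨ cong (λ z → mkℚᵘ z (d + b * suc d)) (sym (pos-* a c)) ⟩
  mkℚᵘ (ℤ.+ (a * c)) (d + b * suc d) ≈⟨ ℚᵘₚ.≃-sym (ℚₚ.toℚᵘ-fromℚᵘ (mkℚᵘ (ℤ.+ (a * c)) (d + b * suc d))) ⟩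
  ℚ.toℚᵘ (ℚ.fromℚᵘ (mkℚᵘ (ℤ.+ (a * c)) (d + b * suc d))) ∎)
  where
  open import Relation.Binary.Reasoning.Setoid ℚᵘₚ.≃-setoid
  p = mkℚᵘ (ℤ.+ a) b
  q = mkℚᵘ (ℤ.+ c) d

p≤q+e⇒p-q≤e : ∀ p q e → p ℚ.≤ q ℚ.+ e → p ℚ.- q ℚ.≤ e
p≤q+e⇒p-q≤e p q e h = subst (p ℚ.- q ℚ.≤_) (trans (cong (ℚ._- q) (ℚₚ.+-comm q e))
  (trans (ℚₚ.+-assoc e q (ℚ.- q)) (trans (cong (e ℚ.+_) (ℚₚ.+-inverseʳ q)) (ℚₚ.+-identityʳ e))))
  (ℚₚ.+-monoˡ-≤ (ℚ.- q) h)

∣p-q∣≤ : ∀ p q e → p ℚ.≤ q ℚ.+ e → q ℚ.≤ p ℚ.+ e → ℚ.∣ p ℚ.- q ∣ ℚ.≤ e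
∣p-q∣≤ p q e p≤ q≤ with ℚₚ.∣p∣≡p∨∣p∣≡-p (p ℚ.- q)
... | inj₁ eq = subst (ℚ._≤ e) (sym eq) (p≤q+e⇒p-q≤e p q e p≤)
... | inj₂ eq = subst (ℚ._≤ e) (sym (trans eq flipped)) (p≤q+e⇒p-q≤e q p e q≤)
  where
  flipped : ℚ.- (p ℚ.- q) ≡ q ℚ.- p
  flipped = trans (ℚₚ.neg-distrib-+ p (ℚ.- q))
    (trans (cong (ℚ.- p ℚ.+_) (⁻¹-involutive q)) (ℚₚ.+-comm (ℚ.- p) q))

-- The limit of an almost quadratic function.

n<2^n : ∀ n → n < 2 ^ n
n<2^n zero = s≤s z≤n
n<2^n (suc n) = begin-strict
  1 + n ≤⟨ +-mono-≤ (≤-trans (s≤s z≤n) (n<2^n n)) (≤-reflexive (sym (+-identityʳ n))) ⟩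
  2 ^ n + (n + 0) <⟨ +-monoʳ-< (2 ^ n) (+-monoˡ-< 0 (n<2^n n)) ⟩
  2 ^ n + (2 ^ n + 0) ∎
  where open ≤-Reasoning

L-2^ : ∀ W .{{_ : NonZero W}} t → L (W * 2 ^ t) ≡ t + L W
L-2^ W zero = cong L (*-identityʳ W)
L-2^ W (suc t) = begin
  suc ⌊log₂ (W * (2 * 2 ^ t)) ⌋ ≡⟨ cong (suc ∘ ⌊log₂_⌋) (e W (2 ^ t)) ⟩
  suc ⌊log₂ (2 * (W * 2 ^ t)) ⌋ ≡⟨ cong suc (⌊log₂[2*b]⌋≡1+⌊log₂b⌋ (W * 2 ^ t) {{m*n≢0 W (2 ^ t) {{it}} {{m^n≢0 2 t}}}}) ⟩
  suc (L (W * 2 ^ t)) ≡⟨ cong suc (L-2^ W t) ⟩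
  suc (t + L W) ∎
  where
  open ≡-Reasoning
  e : ∀ w x → w * (2 * x) ≡ 2 * (w * x)
  e = solve-∀

-- With s = 3 c + l the exponent is 2 s, and c (2 s + l) ≤ 3 c s ≤ s² ≤ 2^(2 s).
exponent : ℕ → ℕ → ℕ
exponent c l = 2 * (3 * c + l)

exponent-beats-log : ∀ c l → c * (exponent c l + l) ≤ 2 ^ exponent c l
exponent-beats-log c l = begin
  c * (2 * s + l) ≤⟨ *-monoʳ-≤ c (+-monoʳ-≤ (2 * s) (m≤n+m l (3 * c))) ⟩
  c * (2 * s + s) ≡⟨ e c s ⟩
  3 * c * s ≤⟨ *-monoˡ-≤ s (m≤m+n (3 * c) l) ⟩
  s * s ≤⟨ *-mono-≤ (<⇒≤ (n<2^n s)) (<⇒≤ (n<2^n s)) ⟩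
  2 ^ s * 2 ^ s ≡⟨ sym (^-distribˡ-+-* 2 s s) ⟩
  2 ^ (s + s) ≡⟨ cong (2 ^_) (cong (s +_) (sym (+-identityʳ s))) ⟩
  2 ^ (2 * s) ∎
  where
  open ≤-Reasoning
  s = 3 * c + l
  e : ∀ c s → c * (2 * s + s) ≡ 3 * c * s
  e = solve-∀

AlmostQuadratic : ℕ → (ℕ → ℕ) → Set
AlmostQuadratic K G = ∀ n X → 1 ≤ n → 1 ≤ X →
  G (n * X) ≤ n * n * G X + K * (n * n * (X * L X)) × n * n * G X ≤ G (n * X) + K * (n * n * (X * L X))

module Limit (G : ℕ → ℕ) (K W : ℕ) (1≤W : 1 ≤ W) (almostQuadratic : AlmostQuadratic K G)
  (lower : ∀ h → 1 ≤ h → h * h ≤ 4 * (G (W * h) + K * (W * h * L (W * h)))) where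

  -- Both G m and G n are compared with G (m n). Divided by m² n², the error is K (L m / m + L n /
  -- n).
  cross : ∀ m n → 1 ≤ m → 1 ≤ n → m * m * G n ≤ n * n * G m + K * (m * n * (n * L m + m * L n))
  cross m n 1≤m 1≤n = begin
    m * m * G n ≤⟨ proj₂ (almostQuadratic m n 1≤m 1≤n) ⟩
    G (m * n) + K * (m * m * (n * L n)) ≡⟨ cong (λ z → G z + K * (m * m * (n * L n))) (*-comm m n) ⟩
    G (n * m) + K * (m * m * (n * L n)) ≤⟨ +-monoˡ-≤ _ (proj₁ (almostQuadratic n m 1≤n 1≤m)) ⟩
    n * n * G m + K * (n * n * (m * L m)) + K * (m * m * (n * L n)) ≡⟨ e (n * n * G m) K m n (L m) (L n) ⟩
    n * n * G m + K * (m * n * (n * L m + m * L n)) ∎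
    where
    open ≤-Reasoning
    e : ∀ z K m n a b → z + K * (n * n * (m * a)) + K * (m * m * (n * b)) ≡ z + K * (m * n * (n * a + m * b))
    e = solve-∀

  -- Sampling points of the limit: multiples of W, so that `lower` applies, and large enough for K
  -- L(M i) / M i ≤ 1/(i + 1), which is `modulus`.
  M : ℕ → ℕ
  M i = W * 2 ^ exponent (K * suc i) (L W)

  1≤M : ∀ i → 1 ≤ M i
  1≤M i = *-mono-≤ 1≤W (m^n>0 2 (exponent (K * suc i) (L W)))

  instance
    M-nonZero : ∀ {i} → NonZero (M i)
    M-nonZero {i} = >-nonZero (1≤M i)
    M²-nonZero : ∀ {i} → NonZero (M i * M i)
    M²-nonZero {i} = m*n≢0 (M i) (M i)

  modulus : ∀ i → K * suc i * L (M i) ≤ M i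
  modulus i = begin
    K * suc i * L (M i) ≡⟨ cong (K * suc i *_) (L-2^ W {{>-nonZero 1≤W}} (exponent (K * suc i) (L W))) ⟩
    K * suc i * (exponent (K * suc i) (L W) + L W) ≤⟨ exponent-beats-log (K * suc i) (L W) ⟩
    2 ^ exponent (K * suc i) (L W) ≤⟨ m≤n*m _ W {{>-nonZero 1≤W}} ⟩
    M i ∎
    where open ≤-Reasoning

  c-seq : ℕ → ℚ
  c-seq i = (ℤ.+ G (M i)) ℚ./ (M i * M i)

  c-regular-≤ : ∀ i j → c-seq i ℚ.≤ c-seq j ℚ.+ ((ℤ.+ 1) ℚ./ suc i ℚ.+ (ℤ.+ 1) ℚ./ suc j)
  c-regular-≤ i j = subst (c-seq i ℚ.≤_)
    (sym (trans (cong (c-seq j ℚ.+_) (fraction-+ 1 (suc i) 1 (suc j)))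
      (fraction-+ (G n) (n * n) (1 * suc j + 1 * suc i) (suc i * suc j))))
    (fraction-≤ (G m) (m * m) (G n * (suc i * suc j) + (1 * suc j + 1 * suc i) * (n * n)) (n * n * (suc i * suc j)) {{M²-nonZero}} {{m*n≢0 (n * n) (suc i * suc j)}} (begin
      G m * (n * n * (suc i * suc j)) ≡⟨ e₁ (G m) n (suc i) (suc j) ⟩
      n * n * G m * (suc i * suc j) ≤⟨ *-monoˡ-≤ (suc i * suc j) (cross n m (1≤M j) (1≤M i)) ⟩
      (m * m * G n + K * (n * m * (m * L n + n * L m))) * (suc i * suc j) ≡⟨ e₂ (G n) m n K (L m) (L n) (suc i) (suc j) ⟩
      G n * (suc i * suc j) * (m * m) + n * m * (m * suc i * (K * suc j * L n) + n * suc j * (K * suc i * L m))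
        ≤⟨ +-monoʳ-≤ _ (*-monoʳ-≤ (n * m) (+-mono-≤ (*-monoʳ-≤ (m * suc i) (modulus j)) (*-monoʳ-≤ (n * suc j) (modulus i)))) ⟩
      G n * (suc i * suc j) * (m * m) + n * m * (m * suc i * n + n * suc j * m) ≡⟨ e₃ (G n) m n (suc i) (suc j) ⟩
      (G n * (suc i * suc j) + (1 * suc j + 1 * suc i) * (n * n)) * (m * m) ∎))
    where
    open ≤-Reasoning
    m = M i
    n = M j
    e₁ : ∀ g n i j → g * (n * n * (i * j)) ≡ n * n * g * (i * j)
    e₁ = solve-∀
    e₂ : ∀ g m n K a b i j → (m * m * g + K * (n * m * (m * b + n * a))) * (i * j) ≡
      g * (i * j) * (m * m) + n * m * (m * i * (K * j * b) + n * j * (K * i * a))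
    e₂ = solve-∀
    e₃ : ∀ g m n i j → g * (i * j) * (m * m) + n * m * (m * i * n + n * j * m) ≡
      (g * (i * j) + (1 * j + 1 * i) * (n * n)) * (m * m)
    e₃ = solve-∀

  c : ℝ
  c = record
    { seq = c-seq
    ; reg = λ i j → ∣p-q∣≤ (c-seq i) (c-seq j) _ (c-regular-≤ i j)
        (subst (λ z → c-seq j ℚ.≤ c-seq i ℚ.+ z) (ℚₚ.+-comm ((ℤ.+ 1) ℚ./ suc j) ((ℤ.+ 1) ℚ./ suc i)) (c-regular-≤ j i))
    }

  -- With m = M (8 W²) the lower bound gives G m / m² ≥ 1 / (4 W²) - 1 / (8 W² + 1).
  c-positive : Positive c
  c-positive = i , fraction-< 1 (suc i) (G m) (m * m) (subst (_< G m * suc i) (sym (*-identityˡ (m * m)))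
    (*-cancelˡ-< (4 * (W * W)) (m * m) (G m * suc i) (begin-strict
      4 * (W * W) * (m * m) <⟨ *-monoˡ-< (m * m) (n<1+n (4 * (W * W))) ⟩
      suc (4 * (W * W)) * (m * m) ≤⟨ +-cancelʳ-≤ (4 * (W * W) * (m * m)) _ _ key ⟩
      4 * (W * W) * (G m * suc i) ∎)))
    where
    open ≤-Reasoning
    i = 8 * (W * W)
    m = M i
    h = 2 ^ exponent (K * suc i) (L W)
    e₁ : ∀ W m → suc (4 * (W * W)) * (m * m) + 4 * (W * W) * (m * m) ≡ suc (8 * (W * W)) * (m * m)
    e₁ = solve-∀
    e₂ : ∀ s W h → s * (W * h * (W * h)) ≡ s * (W * W) * (h * h)
    e₂ = solve-∀
    e₃ : ∀ s W g K m l → s * (W * W) * (4 * (g + K * (m * l))) ≡ 4 * (W * W) * (g * s) + 4 * (W * W) * (m * (K * s * l))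
    e₃ = solve-∀
    key : suc (4 * (W * W)) * (m * m) + 4 * (W * W) * (m * m) ≤ 4 * (W * W) * (G m * suc i) + 4 * (W * W) * (m * m)
    key = begin
      suc (4 * (W * W)) * (m * m) + 4 * (W * W) * (m * m) ≡⟨ e₁ W m ⟩
      suc i * (m * m) ≡⟨ e₂ (suc i) W h ⟩
      suc i * (W * W) * (h * h) ≤⟨ *-monoʳ-≤ (suc i * (W * W)) (lower h (m^n>0 2 (exponent (K * suc i) (L W)))) ⟩
      suc i * (W * W) * (4 * (G m + K * (m * L m))) ≡⟨ e₃ (suc i) W (G m) K m (L m) ⟩
      4 * (W * W) * (G m * suc i) + 4 * (W * W) * (m * (K * suc i * L m))
        ≤⟨ +-monoʳ-≤ (4 * (W * W) * (G m * suc i)) (*-monoʳ-≤ (4 * (W * W)) (*-monoʳ-≤ m (modulus i))) ⟩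
      4 * (W * W) * (G m * suc i) + 4 * (W * W) * (m * m) ∎

  module _ (κ A Q : ℕ) (2≤Q : 2 ≤ Q) (A≤G : A ≤ G Q) (G≤A : G Q ≤ A + κ * Q) where

    private
      l = ⌊log₂ Q ⌋
      -- K is doubled because L Q = 1 + l ≤ 2 l for Q ≥ 2; κ accounts for the distance between A and
      -- G Q.
      C = 2 * K + κ
      Eq = C * Q * l

      1≤Q : 1 ≤ Q
      1≤Q = ≤-trans (s≤s z≤n) 2≤Q

      1≤l : 1 ≤ l
      1≤l = subst (_≤ l) (⌊log₂[2^n]⌋≡n 1) (⌊log₂⌋-mono-≤ 2≤Q)

      error≤ : K * (Q * L Q) + κ * Q ≤ Eq
      error≤ = begin
        K * (Q * suc l) + κ * Q ≤⟨ +-mono-≤ (*-monoʳ-≤ K (*-monoʳ-≤ Q (+-monoˡ-≤ l 1≤l))) (m≤m*n (κ * Q) l {{>-nonZero 1≤l}}) ⟩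
        K * (Q * (l + l)) + κ * Q * l ≡⟨ e K Q l κ ⟩
        (2 * K + κ) * Q * l ∎
        where
        open ≤-Reasoning
        e : ∀ K Q l κ → K * (Q * (l + l)) + κ * Q * l ≡ (2 * K + κ) * Q * l
        e = solve-∀

      module _ (n : ℕ) where

        m = M n

        -- The error of `cross` splits in two: the part with L Q belongs to the final bound `Eq`,
        -- and the part with L m is at most Q²/(n + 1) after normalisation, the slack that
        -- `AbsDiffLe` grants to the n-th approximation.
        spread : K * (m * Q * (Q * L m + m * L Q)) * suc n + κ * Q * (m * m * suc n) ≤ (Eq * suc n + Q * Q) * (m * m)
        spread = begin
          K * (m * Q * (Q * L m + m * L Q)) * suc n + κ * Q * (m * m * suc n) ≡⟨ e₁ K m Q (L m) (L Q) (suc n) κ ⟩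
          (K * (Q * L Q) + κ * Q) * suc n * (m * m) + m * (Q * Q) * (K * suc n * L m)
            ≤⟨ +-mono-≤ (*-monoˡ-≤ (m * m) (*-monoˡ-≤ (suc n) error≤)) (*-monoʳ-≤ (m * (Q * Q)) (modulus n)) ⟩
          Eq * suc n * (m * m) + m * (Q * Q) * m ≡⟨ e₂ Eq (suc n) m Q ⟩
          (Eq * suc n + Q * Q) * (m * m) ∎
          where
          open ≤-Reasoning
          e₁ : ∀ K m Q a b s κ → K * (m * Q * (Q * a + m * b)) * s + κ * Q * (m * m * s) ≡
            (K * (Q * b) + κ * Q) * s * (m * m) + m * (Q * Q) * (K * s * a)
          e₁ = solve-∀
          e₂ : ∀ E s m Q → E * s * (m * m) + m * (Q * Q) * m ≡ (E * s + Q * Q) * (m * m)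
          e₂ = solve-∀

        upper-ℕ : A * (m * m * suc n) ≤ G m * (Q * Q) * suc n + (Eq * suc n + Q * Q) * (m * m)
        upper-ℕ = begin
          A * (m * m * suc n) ≤⟨ *-monoˡ-≤ (m * m * suc n) A≤G ⟩
          G Q * (m * m * suc n) ≡⟨ e₁ (G Q) m (suc n) ⟩
          m * m * G Q * suc n ≤⟨ *-monoˡ-≤ (suc n) (cross m Q (1≤M n) 1≤Q) ⟩
          (Q * Q * G m + K * (m * Q * (Q * L m + m * L Q))) * suc n ≡⟨ e₂ Q (G m) (K * (m * Q * (Q * L m + m * L Q))) (suc n) ⟩
          G m * (Q * Q) * suc n + K * (m * Q * (Q * L m + m * L Q)) * suc n
            ≤⟨ +-monoʳ-≤ (G m * (Q * Q) * suc n) (≤-trans (m≤m+n _ (κ * Q * (m * m * suc n))) spread) ⟩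
          G m * (Q * Q) * suc n + (Eq * suc n + Q * Q) * (m * m) ∎
          where
          open ≤-Reasoning
          e₁ : ∀ g m s → g * (m * m * s) ≡ m * m * g * s
          e₁ = solve-∀
          e₂ : ∀ Q g z s → (Q * Q * g + z) * s ≡ g * (Q * Q) * s + z * s
          e₂ = solve-∀

        lower-ℕ : G m * (Q * Q) * suc n ≤ A * (m * m * suc n) + (Eq * suc n + Q * Q) * (m * m)
        lower-ℕ = begin
          G m * (Q * Q) * suc n ≡⟨ cong (_* suc n) (*-comm (G m) (Q * Q)) ⟩
          Q * Q * G m * suc n ≤⟨ *-monoˡ-≤ (suc n) (cross Q m 1≤Q (1≤M n)) ⟩
          (m * m * G Q + K * (Q * m * (m * L Q + Q * L m))) * suc n ≤⟨ *-monoˡ-≤ (suc n) (+-monoˡ-≤ _ (*-monoʳ-≤ (m * m) G≤A)) ⟩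
          (m * m * (A + κ * Q) + K * (Q * m * (m * L Q + Q * L m))) * suc n ≡⟨ e m A κ Q K (L Q) (L m) (suc n) ⟩
          A * (m * m * suc n) + (K * (m * Q * (Q * L m + m * L Q)) * suc n + κ * Q * (m * m * suc n))
            ≤⟨ +-monoʳ-≤ (A * (m * m * suc n)) spread ⟩
          A * (m * m * suc n) + (Eq * suc n + Q * Q) * (m * m) ∎
          where
          open ≤-Reasoning
          e : ∀ m A κ Q K b a s → (m * m * (A + κ * Q) + K * (Q * m * (m * b + Q * a))) * s ≡
            A * (m * m * s) + (K * (m * Q * (Q * a + m * b)) * s + κ * Q * (m * m * s))
          e = solve-∀

        c*Q² : c-seq n ℚ.* ((ℤ.+ (Q * Q)) ℚ./ 1) ≡ (ℤ.+ (G m * (Q * Q))) ℚ./ (m * m)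
        c*Q² = trans (fraction-* (G m) (m * m) (Q * Q) 1) (ℚₚ./-cong {ℤ.+ (G m * (Q * Q))} {m * m * 1} {ℤ.+ (G m * (Q * Q))} {m * m} {{m*n≢0 (m * m) 1}} {{M²-nonZero}} refl (*-identityʳ (m * m)))

        error-sum : (ℤ.+ Eq) ℚ./ 1 ℚ.+ (ℤ.+ (Q * Q)) ℚ./ suc n ≡ (ℤ.+ (Eq * suc n + Q * Q)) ℚ./ suc n
        error-sum = trans (fraction-+ Eq 1 (Q * Q) (suc n))
          (ℚₚ./-cong {ℤ.+ (Eq * suc n + Q * Q * 1)} {1 * suc n} {ℤ.+ (Eq * suc n + Q * Q)} {suc n} {{m*n≢0 1 (suc n)}} {{_}} (cong (λ z → ℤ.+ (Eq * suc n + z)) (*-identityʳ (Q * Q))) (*-identityˡ (suc n)))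

    approximates : AbsDiffLe A c (Q * Q) ((2 * K + κ) * Q * ⌊log₂ Q ⌋)
    approximates n = ∣p-q∣≤ ((ℤ.+ A) ℚ./ 1) (c-seq n ℚ.* ((ℤ.+ (Q * Q)) ℚ./ 1)) _
      (subst₂ (λ x y → (ℤ.+ A) ℚ./ 1 ℚ.≤ x ℚ.+ y) (sym (c*Q² n)) (sym (error-sum n))
        (subst ((ℤ.+ A) ℚ./ 1 ℚ.≤_) (sym (fraction-+ (G (M n) * (Q * Q)) (M n * M n) (Eq * suc n + Q * Q) (suc n)))
          (fraction-≤ A 1 (G (M n) * (Q * Q) * suc n + (Eq * suc n + Q * Q) * (M n * M n)) (M n * M n * suc n)
            {{_}} {{m*n≢0 (M n * M n) (suc n)}}
            (subst (A * (M n * M n * suc n) ≤_) (sym (*-identityʳ _)) (upper-ℕ n)))))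
      (subst₂ (λ x y → x ℚ.≤ (ℤ.+ A) ℚ./ 1 ℚ.+ y) (sym (c*Q² n)) (sym (error-sum n))
        (subst ((ℤ.+ (G (M n) * (Q * Q))) ℚ./ (M n * M n) ℚ.≤_) (sym (fraction-+ A 1 (Eq * suc n + Q * Q) (suc n)))
          (fraction-≤ (G (M n) * (Q * Q)) (M n * M n) (A * suc n + (Eq * suc n + Q * Q) * 1) (1 * suc n)
            {{M²-nonZero}} {{m*n≢0 1 (suc n)}}
            (subst₂ _≤_ (e₁ (G (M n) * (Q * Q)) (suc n)) (e₂ A (M n) (suc n) (Eq * suc n + Q * Q)) (lower-ℕ n)))))
      where
      e₁ : ∀ g s → g * s ≡ g * (1 * s)
      e₁ = solve-∀
      e₂ : ∀ A m s z → A * (m * m * s) + z * (m * m) ≡ (A * s + z * 1) * (m * m)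
      e₂ = solve-∀

-- Assembly of the asymptotic formula.

module Asymptotics (d k : ℕ) (2≤d : 2 ≤ d) (1≤k : 1 ≤ k) where

  open Pairs d k 2≤d 1≤k using (G; E; C; A; G-scale-upper; G-scale-lower; A-bounded-by-G)
  open Abundance d k 2≤d 1≤k using (W; h²≤A)
  open Counting d k 2≤d 1≤k using (N≤G; G≤N+kQ)

  1≤W : 1 ≤ W
  1≤W = *-mono-≤ (s≤s {n = k} z≤n) (*-mono-≤ (≤-trans (s≤s z≤n) 2≤d) 1≤k)

  G-almostQuadratic : AlmostQuadratic (2 * E) G
  G-almostQuadratic n X 1≤n 1≤X =
    subst (λ z → G (n * X) ≤ n * n * G X + z) (sym (*-assoc 2 E _)) (G-scale-upper n X 1≤n 1≤X) ,
    subst (λ z → n * n * G X ≤ G (n * X) + z) (sym (*-assoc 2 E _)) (G-scale-lower n X 1≤n 1≤X)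

  G-lower-bound : ∀ h → 1 ≤ h → h * h ≤ 4 * (G (W * h) + 2 * E * (W * h * L (W * h)))
  G-lower-bound h 1≤h = begin
    h * h ≤⟨ h²≤A h ⟩
    A (W * h) ≤⟨ A-bounded-by-G (W * h) (*-mono-≤ 1≤W 1≤h) ⟩
    -- E contains 2 C, so the sieve constant 2 E also covers the error 8 C of the lower bound.
    4 * G (W * h) + 8 * C * z ≤⟨ +-monoʳ-≤ (4 * G (W * h)) (*-monoˡ-≤ z (≤-trans (≤-reflexive (e₁ C)) (*-monoʳ-≤ 4 (≤-trans (m≤m+n (2 * C) k) (m≤m+n E (E + 0)))))) ⟩
    4 * G (W * h) + 4 * (2 * E) * z ≡⟨ e₂ (G (W * h)) (2 * E) z ⟩
    4 * (G (W * h) + 2 * E * z) ∎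
    where
    open ≤-Reasoning
    z = W * h * L (W * h)
    e₁ : ∀ c → 8 * c ≡ 4 * (2 * c)
    e₁ = solve-∀
    e₂ : ∀ g e z → 4 * g + 4 * e * z ≡ 4 * (g + e * z)
    e₂ = solve-∀

  open Limit G (2 * E) W 1≤W G-almostQuadratic G-lower-bound public using (c; c-positive; approximates)

  errorConstant : ℕ
  errorConstant = 2 * (2 * E) + k

  N-asymptotics : ∀ Q → 2 ≤ Q → AbsDiffLe (N Q d k) c (Q ^ 2) (errorConstant * Q * ⌊log₂ Q ⌋)
  N-asymptotics Q 2≤Q = subst (λ z → AbsDiffLe (N Q d k) c z (errorConstant * Q * ⌊log₂ Q ⌋))
    (cong (Q *_) (sym (*-identityʳ Q))) (approximates k (N Q d k) Q 2≤Q (N≤G Q) (G≤N+kQ Q))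

theorem1 : (d k : ℕ) → 2 ≤ d → 1 ≤ k →
    Σ ℝ λ c → Positive c ×
    ∃ λ C → ∃ λ Q₀ → ∀ Q → Q₀ ≤ Q →
    AbsDiffLe (N Q d k) c (Q ^ 2) (C * Q * ⌊log₂ Q ⌋)
-- The threshold is 2 because the error term vanishes at Q = 1, where the logarithm is 0.
theorem1 d k 2≤d 1≤k = c , c-positive , errorConstant , 2 , N-asymptotics
  where open Asymptotics d k 2≤d 1≤k
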